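{- Let $m\ge 0$ be an integer, let $\mathcal{G}=(G,\{a_1,\ldots,a_m\},b_1,b_2)$ be an $m$-rooted graph, and let $U\subseteq V(G)\setminus\{a_1,\ldots,a_m,b_1,b_2\}$. Suppose $\mathcal{G}$ is critically feasible with respect to $U$. Then there exists an $(\{a_1,\ldots,a_m,b_1,b_2\}\cup U)$-collection $\mathcal{X}$ in $G$ such that (i) $|N(X)|\le m+2$ for all $X\in\mathcal{X}$, and (ii) $e(\mathcal{G}/\mathcal{X})\le (m+2)\,v(G/\mathcal{X})-m^2/2-5m/2-3-|U|$.
   Context: All graphs are finite and simple; $v(H)$ and $e(H)$ denote the numbers of vertices and edges of $H$. For $A\subseteq V(G)$, $N(A)=N_G(A)$ is the set of vertices outside $A$ adjacent to some vertex of $A$, and $N[A]=N(A)\cup A$. An $m$-rooted graph $(G,\{a_1,\ldots,a_m\},b_1,b_2)$ consists of a graph $G$ and distinct vertices $a_1,\ldots,a_m,b_1,b_2$ of $G$ ($m=0$ allowed). A linkage pair in $\mathcal{G}$ is an ordered pair $(A,B)$ of vertex-disjoint subgraphs of $G$ where $A$ is connected with $\{a_1,\ldots,a_m\}\subseteq V(A)$ and $B$ is a $b_1$-$b_2$ path; when $m=0$, $(\emptyset,B)$ is a linkage pair for every $b_1$-$b_2$ path $B$ in $G$. $\mathcal{G}$ is feasible if it has a linkage pair. For $U\subseteq V(G)\setminus\{a_1,\ldots,a_m,b_1,b_2\}$, $\mathcal{G}$ is critically feasible with respect to $U$ if $\mathcal{G}$ is feasible and $U\subseteq V(B)$ for every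 linkage pair $(A,B)$ in $\mathcal{G}$. For $S\subseteq V(G)$, an $S$-collection in $G$ is a family $\mathcal{X}$ of subsets of $V(G)\setminus S$ such that $N[X_1]\cap X_2=\emptyset$ for all distinct $X_1,X_2\in\mathcal{X}$. $G/\mathcal{X}$ denotes the graph obtained from $G$ by, for each $X\in\mathcal{X}$, deleting $X$ and adding edges making $N_G(X)$ a clique. $\mathcal{G}/\mathcal{X}$ denotes the graph obtained from $G/\mathcal{X}$ by adding an edge between every pair of distinct vertices of $\{a_1,\ldots,a_m,b_1,b_2\}$ except the pair $\{b_1,b_2\}$ (if not already present). -}

module Defs where

open import Data.Bool using (Bool; true; false; _∧_; _∨_; not; if_then_else_)
open import Data.Nat using (ℕ; zero; suc; _+_; _*_; _≤_)
open import Data.Fin using (Fin; toℕ)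
open import Data.Fin.Properties using (_≟_)
open import Data.Fin.Subset using (Subset; _∈_; _∉_; _∩_; _∪_; ∁; ⊥; ⁅_⁆; ∣_∣)
open import Data.Vec using (tabulate; lookup)
open import Data.List using (List; []; _∷_; head; last; map; allFin)
open import Data.Nat.ListAction using (sum)
open import Data.Bool.ListAction using (any)
open import Data.List.Relation.Unary.Unique.Propositional using (Unique)
import Data.List.Membership.Propositional as LM
open import Data.Maybe using (just)
open import Data.Product using (Σ; _×_; ∃; ∃-syntax)
open import Relation.Nullary using (¬_)
open import Relation.Nullary.Decidable using (⌊_⌋)
open import Relation.Binary.PropositionalEquality using (_≡_; _≢_)
import Data.Nat as N

record Graph (n : ℕ) : Set where
  field
    adj    : Fin n → Fin n → Bool
    sym    : ∀ u v → adj u v ≡ adj v u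
    irrefl : ∀ v → adj v v ≡ false
open Graph public

mem : ∀ {n} → Subset n → Fin n → Bool
mem S v = lookup S v

countPairs : ∀ {n} → (Fin n → Fin n → Bool) → ℕ
countPairs {n} p =
  sum (map (λ u → sum (map (λ v → if ⌊ toℕ u N.<? toℕ v ⌋ ∧ p u v then 1 else 0)
                           (allFin n)))
           (allFin n))

nbhd : ∀ {n} → Graph n → Subset n → Subset n
nbhd {n} G A = tabulate λ v → not (mem A v) ∧ any (λ u → mem A u ∧ adj G u v) (allFin n)

cnbhd : ∀ {n} → Graph n → Subset n → Subset n
cnbhd G A = nbhd G A ∪ A

data Chain {n} (G : Graph n) : List (Fin n) → Set where
  nil  : Chain G []
  one  : ∀ x → Chain G (x ∷ [])
  cons : ∀ {x y xs} → adj G x y ≡ true → Chain G (y ∷ xs) → Chain G (x ∷ y ∷ xs)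

IsWalk : ∀ {n} → Graph n → Fin n → Fin n → List (Fin n) → Set
IsWalk G u v xs = Chain G xs × head xs ≡ just u × last xs ≡ just v

IsPath : ∀ {n} → Graph n → Fin n → Fin n → List (Fin n) → Set
IsPath G u v xs = IsWalk G u v xs × Unique xs

-- The subgraph induced on A is connected (vacuously so for A = ∅).
Connected : ∀ {n} → Graph n → Subset n → Set
Connected {n} G A = ∀ u v → u ∈ A → v ∈ A →
  ∃[ xs ] (IsWalk G u v xs × (∀ w → w LM.∈ xs → w ∈ A))

record Rooted (m n : ℕ) : Set where
  field
    G      : Graph n
    a      : Fin m → Fin n
    b₁ b₂  : Fin n
    a-inj  : ∀ i j → a i ≡ a j → i ≡ j
    b₁≢b₂  : b₁ ≢ b₂
    a≢b₁   : ∀ i → a i ≢ b₁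
    a≢b₂   : ∀ i → a i ≢ b₂
open Rooted public

isA : ∀ {m n} → Rooted m n → Fin n → Bool
isA {m} R v = any (λ i → ⌊ a R i ≟ v ⌋) (allFin m)

isRoot : ∀ {m n} → Rooted m n → Fin n → Bool
isRoot R v = isA R v ∨ ⌊ v ≟ b₁ R ⌋ ∨ ⌊ v ≟ b₂ R ⌋

rootSet : ∀ {m n} → Rooted m n → Subset n
rootSet R = tabulate (isRoot R)

-- Linkage pair (A, B): A given by its vertex set (a connected subgraph
-- containing all a_i; A = ∅ allowed exactly when m = 0), B by the vertex
-- sequence of a b1-b2 path, vertex-disjoint from A.
LinkagePair : ∀ {m n} → Rooted m n → Subset n → List (Fin n) → Set
LinkagePair R A B =
  Connected (G R) A × (∀ i → a R i ∈ A) × IsPath (G R) (b₁ R) (b₂ R) B ×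
  (∀ v → v ∈ A → ¬ (v LM.∈ B))

Feasible : ∀ {m n} → Rooted m n → Set
Feasible R = ∃[ A ] ∃[ B ] LinkagePair R A B

CriticallyFeasible : ∀ {m n} → Rooted m n → Subset n → Set
CriticallyFeasible R U =
  Feasible R × (∀ A B → LinkagePair R A B → ∀ u → u ∈ U → u LM.∈ B)

IsCollection : ∀ {n k} → Graph n → Subset n → (Fin k → Subset n) → Set
IsCollection G S X =
  (∀ i v → v ∈ X i → v ∉ S) ×
  (∀ i j → i ≢ j → cnbhd G (X i) ∩ X j ≡ ⊥)

unionC : ∀ {n k} → (Fin k → Subset n) → Subset n
unionC {n} {k} X = tabulate λ v → any (λ i → mem (X i) v) (allFin k)

quotVerts : ∀ {n k} → (Fin k → Subset n) → Subset n
quotVerts X = ∁ (unionC X)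

quotAdj : ∀ {n k} → Graph n → (Fin k → Subset n) → Fin n → Fin n → Bool
quotAdj {n} {k} G X u v =
  mem (quotVerts X) u ∧ mem (quotVerts X) v ∧
  (adj G u v ∨ any (λ i → mem (nbhd G (X i)) u ∧ mem (nbhd G (X i)) v) (allFin k))

rootedQuotAdj : ∀ {m n k} → Rooted m n → (Fin k → Subset n) → Fin n → Fin n → Bool
rootedQuotAdj R X u v =
  quotAdj (G R) X u v ∨
  (mem (quotVerts X) u ∧ mem (quotVerts X) v ∧ isRoot R u ∧ isRoot R v ∧
   not ((⌊ u ≟ b₁ R ⌋ ∧ ⌊ v ≟ b₂ R ⌋) ∨ (⌊ u ≟ b₂ R ⌋ ∧ ⌊ v ≟ b₁ R ⌋)))

vQuot : ∀ {n k} → (Fin k → Subset n) → ℕ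
vQuot X = ∣ quotVerts X ∣

eRootedQuot : ∀ {m n k} → Rooted m n → (Fin k → Subset n) → ℕ
eRootedQuot R X = countPairs (rootedQuotAdj R X)

{-# OPTIONS --safe #-}
module Submission where

-- An instance consists of free vertices F and k = m + 2 roots R, two of which are b₁
-- and b₂.  A linkage may be taken to be a pair of disjoint connected sets, so it pulls
-- back along contractions and along the quotient G/X whenever X is "good", i.e. any two
-- neighbours of X can be joined inside X while the others stay connected.  Replacing
-- good sets X by cliques on N(X), one reduces to two bounds on the number of edges that
-- meet F, proved by simultaneous induction on |F| + |R|:
--   (k - 1)|F| + 1 for infeasible instances,
--   k|F| + 1 - |U| for instances in which every linkage has U ⊆ B.
-- In the second case, good sets containing part of U split the instance additively.
-- Otherwise either every path contains U, and the components of F ∖ U are sparse, or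
-- some u ∈ U can be avoided; then G - u is infeasible and deg u ≤ |F| - |U| + k - 1.
-- In the first case let a be a root aᵢ.  If G - a is infeasible, or all its linkages
-- contain N(a), the induction hypothesis applies to G - a.  Otherwise take a linkage
-- (A′, B′) of G - a with |A′| maximal such that B′ misses some y ∈ N(a).  By maximality
-- every path avoiding A′ contains T = N(A′) or W = N(a).  As there are no good sets,
-- all vertices outside A′ lie in T ∪ W ∪ {a, b₁, b₂}, and contracting ay loses at most
-- three edges.

-- Deleting a vertex or contracting an edge can create good sets, so their absence is not inherited.
-- The infeasible bound therefore only assumes that good sets with at most k - 1 neighbours are
-- sparse, meeting at most (k - 1)|X| edges each. After a deletion this holds because a set X that
-- is not good is itself an infeasible instance with roots N(X), hence meets at most (|N(X)| - 1)|X|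
-- + 1 edges, and the edge lost to the deleted vertex removes the + 1.
--
-- The two bounds feed each other: the critical one needs the infeasible one after deleting u, while
-- the critical bound for G - a with U = N(a) saves exactly the edges at a.
--
-- The + 1 of the critical bound disappears at the end. As b₁b₂ is missing, the roots span at most
-- k(k - 1)/2 - 1 edges, and for k = m + 2 the number k(k + 1)/2 is m²/2 + 5m/2 + 3.
--
-- Whether a linkage or a good set exists is never decided. The bounds are inequalities between
-- numbers and so stable; case distinctions on linkages and choices of largest sets are made under
-- double negation.

module Development where

  open import Data.Nat.Properties hiding (_≟_; _≤?_; _<?_)
  open import Algebra.Properties.Semiring.Sum +-*-semiring using () renaming
    (sum to Sum; sum-cong-≗ to Sum-cong; ∑-distrib-+ to Sum-+; sum-replicate-zero to Sum-0;
     ∑-comm to Sum-swap; *-distribˡ-sum to Sum-*)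
  open import Data.Bool using (Bool; true; false; not; _∧_; _∨_; if_then_else_)
  import Data.Bool.ListAction as Bool
  import Data.Bool.Properties as Bool
  open import Data.Empty using (⊥; ⊥-elim)
  open import Data.Fin using (Fin; zero; suc; toℕ)
  open import Data.Fin.Properties using (_≟_; any?; all?)
  open import Data.Fin.Subset as Subset using (Subset; ∣_∣)
  import Data.Fin.Subset.Properties as Subset
  open import Data.List as List using (List; []; _∷_; head; last; map; allFin)
  import Data.List.Membership.Propositional as List
  open import Data.List.Membership.DecPropositional using () renaming (_∈?_ to list-∈?)
  open import Data.List.Properties using (map-tabulate)
  import Data.List.Relation.Unary.All.Properties as All
  open import Data.List.Relation.Unary.All using ([]; _∷_)
  open import Data.List.Relation.Unary.AllPairs using ([]; _∷_)
  open import Data.List.Relation.Unary.Any using (here; there)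
  open import Data.List.Relation.Unary.Unique.Propositional using (Unique)
  open import Data.Maybe using (just)
  import Data.Nat.ListAction as Nat
  open import Data.Nat using (ℕ; zero; suc; _+_; _*_; _≤_; _<_; z≤n; s≤s; _≤?_; _<?_)
  open import Data.Nat.Tactic.RingSolver using (solve-∀)
  open import Data.Product using (Σ; _×_; _,_; proj₁; proj₂; ∃)
  open import Data.Sum using (_⊎_; inj₁; inj₂; [_,_]′)
  open import Data.Vec using (Vec; []; _∷_; lookup; tabulate)
  open import Data.Vec.Properties using (lookup∘tabulate; []=⇒lookup; lookup⇒[]=; lookup-map; ≡-dec)
  import Defs as D
  open import Function using (_∘_; id)
  open import Relation.Binary.PropositionalEquality
    using (_≡_; _≢_; refl; sym; trans; cong; cong₂; subst; ≢-sym)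
  open import Relation.Nullary using (¬_; Dec; yes; no; contradiction)
  open import Relation.Nullary.Decidable
    using (¬?; _×-dec_; _⊎-dec_; _→-dec_; decidable-stable; map′; ⌊_⌋; ¬¬-excluded-middle)

  -- Finite sets and counting

  excluded-middle : ∀ {ℓ} (P : Set ℓ) → (Dec P → ⊥) → ⊥
  excluded-middle P = ¬¬-excluded-middle {A = P}

  ≤-stable : ∀ {a b} → (¬ a ≤ b → ⊥) → a ≤ b
  ≤-stable {a} {b} = decidable-stable (a ≤? b)

  Sum-mono : ∀ {n} {f g : Fin n → ℕ} → (∀ i → f i ≤ g i) → Sum f ≤ Sum g
  Sum-mono {zero}  h = z≤n
  Sum-mono {suc n} h = +-mono-≤ (h zero) (Sum-mono λ i → h (suc i))

  ⟦_⟧ : ∀ {P : Set} → Dec P → ℕ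
  ⟦ yes _ ⟧ = 1
  ⟦ no _ ⟧ = 0

  ⟦⟧-mono : ∀ {P Q : Set} (p : Dec P) (q : Dec Q) → (P → Q) → ⟦ p ⟧ ≤ ⟦ q ⟧
  ⟦⟧-mono (yes p) (yes q) h = ≤-refl
  ⟦⟧-mono (yes p) (no ¬q) h = contradiction (h p) ¬q
  ⟦⟧-mono (no ¬p) q h = z≤n

  ⟦⟧-yes : ∀ {P : Set} (p : Dec P) → P → ⟦ p ⟧ ≡ 1
  ⟦⟧-yes (yes _) _ = refl
  ⟦⟧-yes (no ¬p) p = contradiction p ¬p

  ⟦⟧-no : ∀ {P : Set} (p : Dec P) → ¬ P → ⟦ p ⟧ ≡ 0
  ⟦⟧-no (yes p) ¬p = contradiction p ¬p
  ⟦⟧-no (no _) _ = refl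

  ⟦⟧-⊎ : ∀ {P Q R : Set} (p : Dec P) (q : Dec Q) (r : Dec R) →
    (P → Q ⊎ R) → ⟦ p ⟧ ≤ ⟦ q ⟧ + ⟦ r ⟧
  ⟦⟧-⊎ (no _) q r h = z≤n
  ⟦⟧-⊎ (yes p) (yes _) r h = s≤s z≤n
  ⟦⟧-⊎ (yes p) (no ¬q) r h with h p
  ... | inj₁ q = contradiction q ¬q
  ... | inj₂ r′ = ≤-reflexive (sym (⟦⟧-yes r r′))

  ⟦⟧-disjoint : ∀ {P Q R : Set} (p : Dec P) (q : Dec Q) (r : Dec R) →
    (Q → P) → (R → P) → (Q → R → ⊥) → ⟦ q ⟧ + ⟦ r ⟧ ≤ ⟦ p ⟧
  ⟦⟧-disjoint p (yes q) (yes r) f g d = ⊥-elim (d q r)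
  ⟦⟧-disjoint p (yes q) (no _) f g d = ≤-reflexive (sym (⟦⟧-yes p (f q)))
  ⟦⟧-disjoint p (no _) r f g d = ⟦⟧-mono r p g

  -- Membership is a decidable predicate rather than a bit vector, so that a proof of membership
  -- carries its witnesses. The price is that `DS n` lies in `Set₁` and cannot be searched; the
  -- final collection is converted back to `Subset`.
  record DS (n : ℕ) : Set₁ where
    constructor mkDS
    field
      mem  : Fin n → Set
      mem? : ∀ v → Dec (mem v)
  open DS public

  infix 4 _∈_ _∉_ _⊆_
  infixr 6 _∪_ _∩_
  infixl 7 _∖_

  _∈_ _∉_ : ∀ {n} → Fin n → DS n → Set
  v ∈ S = mem S v
  v ∉ S = ¬ (v ∈ S)

  _⊆_ : ∀ {n} → DS n → DS n → Set
  S ⊆ T = ∀ v → v ∈ S → v ∈ T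

  Disjoint : ∀ {n} → DS n → DS n → Set
  Disjoint S T = ∀ v → v ∈ S → v ∈ T → ⊥

  ∅ : ∀ {n} → DS n
  ∅ = mkDS (λ _ → ⊥) (λ _ → no λ ())

  ｛_｝ : ∀ {n} → Fin n → DS n
  ｛ x ｝ = mkDS (λ v → v ≡ x) (λ v → v ≟ x)

  _∪_ _∩_ _∖_ : ∀ {n} → DS n → DS n → DS n
  S ∪ T = mkDS (λ v → v ∈ S ⊎ v ∈ T) (λ v → mem? S v ⊎-dec mem? T v)
  S ∩ T = mkDS (λ v → v ∈ S × v ∈ T) (λ v → mem? S v ×-dec mem? T v)
  S ∖ T = mkDS (λ v → v ∈ S × v ∉ T) (λ v → mem? S v ×-dec ¬? (mem? T v))

  ⊆-dec : ∀ {n} (S T : DS n) → S ⊆ T ⊎ ∃ λ v → v ∈ S × v ∉ T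
  ⊆-dec S T with any? (λ v → mem? S v ×-dec ¬? (mem? T v))
  ... | yes e = inj₂ e
  ... | no ¬e = inj₁ λ v s → decidable-stable (mem? T v) λ t → ¬e (v , s , t)

  meets? : ∀ {n} (S T : DS n) → (∃ λ v → v ∈ S × v ∈ T) ⊎ Disjoint S T
  meets? S T with any? (λ v → mem? S v ×-dec mem? T v)
  ... | yes e = inj₁ e
  ... | no ¬e = inj₂ λ v s t → ¬e (v , s , t)

  # : ∀ {n} → DS n → ℕ
  # S = Sum (λ v → ⟦ mem? S v ⟧)

  #-mono : ∀ {n} (S T : DS n) → S ⊆ T → # S ≤ # T
  #-mono S T h = Sum-mono λ v → ⟦⟧-mono (mem? S v) (mem? T v) (h v)

  #-cong : ∀ {n} (S T : DS n) → S ⊆ T → T ⊆ S → # S ≡ # T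
  #-cong S T h g = ≤-antisym (#-mono S T h) (#-mono T S g)

  #-⊎ : ∀ {n} (S T U : DS n) → (∀ v → v ∈ S → v ∈ T ⊎ v ∈ U) → # S ≤ # T + # U
  #-⊎ S T U h = ≤-trans (Sum-mono λ v → ⟦⟧-⊎ (mem? S v) (mem? T v) (mem? U v) (h v))
                        (≤-reflexive (Sum-+ (λ v → ⟦ mem? T v ⟧) (λ v → ⟦ mem? U v ⟧)))

  #-disjoint : ∀ {n} (S T U : DS n) → T ⊆ S → U ⊆ S → Disjoint T U → # T + # U ≤ # S
  #-disjoint S T U f g d = ≤-trans (≤-reflexive (sym (Sum-+ (λ v → ⟦ mem? T v ⟧) (λ v → ⟦ mem? U v ⟧))))
    (Sum-mono λ v → ⟦⟧-disjoint (mem? S v) (mem? T v) (mem? U v) (f v) (g v) (d v))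

  #-empty : ∀ {n} (S : DS n) → (∀ v → v ∉ S) → # S ≡ 0
  #-empty {n} S h = trans (Sum-cong λ v → ⟦⟧-no (mem? S v) (h v)) (Sum-0 n)

  #-nonempty : ∀ {n} (S : DS n) v → v ∈ S → 1 ≤ # S
  #-nonempty {suc n} S zero s = ≤-trans (≤-reflexive (sym (⟦⟧-yes (mem? S zero) s))) (m≤m+n _ _)
  #-nonempty {suc n} S (suc v) s =
    ≤-trans (#-nonempty (mkDS (λ i → suc i ∈ S) (λ i → mem? S (suc i))) v s) (m≤n+m _ _)

  #-single : ∀ {n} (x : Fin n) → # ｛ x ｝ ≡ 1
  #-single {suc n} zero = cong suc (trans (Sum-cong {n} λ v → ⟦⟧-no (suc v ≟ zero) λ ()) (Sum-0 n))
  #-single {suc n} (suc x) = trans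
    (Sum-cong λ v → ≤-antisym (⟦⟧-mono (suc v ≟ suc x) (v ≟ x) λ { refl → refl })
                              (⟦⟧-mono (v ≟ x) (suc v ≟ suc x) (cong suc)))
    (#-single x)

  #-∖ : ∀ {n} (S T : DS n) → T ⊆ S → # (S ∖ T) + # T ≡ # S
  #-∖ S T h = ≤-antisym
    (#-disjoint S (S ∖ T) T (λ v → proj₁) h λ v a b → proj₂ a b)
    (#-⊎ S (S ∖ T) T λ v s → split v s (mem? T v))
    where
    split : ∀ v → v ∈ S → Dec (v ∈ T) → v ∈ (S ∖ T) ⊎ v ∈ T
    split v s (yes t) = inj₂ t
    split v s (no ¬t) = inj₁ (s , ¬t)

  #-remove : ∀ {n} (S : DS n) x → x ∈ S → suc (# (S ∖ ｛ x ｝)) ≡ # S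
  #-remove S x s = trans (+-comm 1 _)
    (trans (cong (# (S ∖ ｛ x ｝) +_) (sym (#-single x))) (#-∖ S ｛ x ｝ λ { v refl → s }))

  #-insert : ∀ {n} (S : DS n) x → x ∉ S → # (S ∪ ｛ x ｝) ≡ suc (# S)
  #-insert S x s = trans (sym (#-remove (S ∪ ｛ x ｝) x (inj₂ refl)))
    (cong suc (#-cong ((S ∪ ｛ x ｝) ∖ ｛ x ｝) S
      (λ { v (inj₁ a , _) → a ; v (inj₂ a , b) → contradiction a b })
      (λ v a → inj₁ a , λ { refl → s a })))

  #-strict : ∀ {n} (S T : DS n) → S ⊆ T → ∀ v → v ∈ T → v ∉ S → # S < # T
  #-strict S T h v t s = subst (_≤ # T) (trans (cong (# S +_) (#-single v)) (+-comm (# S) 1))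
    (#-disjoint T S ｛ v ｝ h (λ { _ refl → t }) (λ { _ a refl → s a }))

  #-≤2 : ∀ {n} (S : DS n) x y → (∀ v → v ∈ S → v ≡ x ⊎ v ≡ y) → # S ≤ 2
  #-≤2 S x y h = ≤-trans (#-⊎ S ｛ x ｝ ｛ y ｝ h)
    (≤-reflexive (cong₂ _+_ (#-single x) (#-single y)))

  #-≤1 : ∀ {n} (S : DS n) x → (∀ v → v ∈ S → v ≡ x) → # S ≤ 1
  #-≤1 S x h = ≤-trans (#-mono S ｛ x ｝ h) (≤-reflexive (#-single x))

  #-≤3 : ∀ {n} (S : DS n) x y z → (∀ v → v ∈ S → v ≡ x ⊎ v ≡ y ⊎ v ≡ z) → # S ≤ 3
  #-≤3 S x y z h = ≤-trans (#-⊎ S ｛ x ｝ (｛ y ｝ ∪ ｛ z ｝) h)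
    (+-mono-≤ (≤-reflexive (#-single x)) (#-≤2 (｛ y ｝ ∪ ｛ z ｝) y z λ v → id))

  #-≤1⇒≡ : ∀ {n} (S : DS n) → # S ≤ 1 → ∀ u v → u ∈ S → v ∈ S → u ≡ v
  #-≤1⇒≡ S small u v a b = decidable-stable (u ≟ v) λ ne → 1+n≰n (≤-trans
    (≤-trans (≤-reflexive (sym (cong₂ _+_ (#-single u) (#-single v))))
      (#-disjoint S ｛ u ｝ ｛ v ｝ (λ { _ refl → a }) (λ { _ refl → b }) λ { _ refl refl → ne refl })) small)

  #-two : ∀ {n} (S : DS n) → ¬ # S ≤ 1 → ∃ λ u → ∃ λ v → u ∈ S × v ∈ S × v ≢ u
  #-two S big with any? (mem? S)
  ... | no none = contradiction (≤-trans (≤-reflexive (#-empty S λ v s → none (v , s))) z≤n) big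
  ... | yes (u , uS) with any? (λ v → mem? S v ×-dec ¬? (v ≟ u))
  ...   | yes (v , vS , ne) = u , v , uS , vS , ne
  ...   | no none = contradiction (#-≤1 S u λ v vS → decidable-stable (v ≟ u) λ ne → none (v , vS , ne)) big

  ΣΣ : ∀ {n} {P : Fin n → Fin n → Set} → (∀ u v → Dec (P u v)) → ℕ
  ΣΣ p = Sum (λ u → Sum (λ v → ⟦ p u v ⟧))

  ΣΣ-mono : ∀ {n} {P Q : Fin n → Fin n → Set} (p : ∀ u v → Dec (P u v)) (q : ∀ u v → Dec (Q u v)) →
    (∀ u v → P u v → Q u v) → ΣΣ p ≤ ΣΣ q
  ΣΣ-mono p q h = Sum-mono λ u → Sum-mono λ v → ⟦⟧-mono (p u v) (q u v) (h u v)

  module _ {n : ℕ} {P Q R : Fin n → Fin n → Set} where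

    ΣΣ-+ : (q : ∀ u v → Dec (Q u v)) (r : ∀ u v → Dec (R u v)) →
      Sum (λ u → Sum (λ v → ⟦ q u v ⟧ + ⟦ r u v ⟧)) ≡ ΣΣ q + ΣΣ r
    ΣΣ-+ q r = trans (Sum-cong λ u → Sum-+ (λ v → ⟦ q u v ⟧) (λ v → ⟦ r u v ⟧))
                     (Sum-+ (λ u → Sum (λ v → ⟦ q u v ⟧)) (λ u → Sum (λ v → ⟦ r u v ⟧)))

    ΣΣ-⊎ : (p : ∀ u v → Dec (P u v)) (q : ∀ u v → Dec (Q u v)) (r : ∀ u v → Dec (R u v)) →
      (∀ u v → P u v → Q u v ⊎ R u v) → ΣΣ p ≤ ΣΣ q + ΣΣ r
    ΣΣ-⊎ p q r h = ≤-trans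
      (Sum-mono λ u → Sum-mono λ v → ⟦⟧-⊎ (p u v) (q u v) (r u v) (h u v))
      (≤-reflexive (ΣΣ-+ q r))

    ΣΣ-disjoint : (p : ∀ u v → Dec (P u v)) (q : ∀ u v → Dec (Q u v)) (r : ∀ u v → Dec (R u v)) →
      (∀ u v → Q u v → P u v) → (∀ u v → R u v → P u v) → (∀ u v → Q u v → R u v → ⊥) →
      ΣΣ q + ΣΣ r ≤ ΣΣ p
    ΣΣ-disjoint p q r f g d = ≤-trans (≤-reflexive (sym (ΣΣ-+ q r)))
      (Sum-mono λ u → Sum-mono λ v → ⟦⟧-disjoint (p u v) (q u v) (r u v) (f u v) (g u v) (d u v))

  module _ {n : ℕ} where

    ΣΣ-row : (x : Fin n) (S : DS n) → ΣΣ (λ u v → (u ≟ x) ×-dec mem? S v) ≡ # S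
    ΣΣ-row x S = trans (Sum-cong λ u → step u (u ≟ x))
      (trans (sym (Sum-* (# S) (λ u → ⟦ u ≟ x ⟧))) (trans (cong (# S *_) (#-single x)) (*-identityʳ _)))
      where
      step : ∀ u (d : Dec (u ≡ x)) → Sum (λ v → ⟦ d ×-dec mem? S v ⟧) ≡ # S * ⟦ d ⟧
      step u (yes e) = trans (Sum-cong λ v → ≤-antisym (⟦⟧-mono (yes e ×-dec mem? S v) (mem? S v) proj₂)
                                                       (⟦⟧-mono (mem? S v) (yes e ×-dec mem? S v) (e ,_)))
                             (sym (*-identityʳ _))
      step u (no ¬e) = trans (Sum-cong λ v → ⟦⟧-no (no ¬e ×-dec mem? S v) (¬e ∘ proj₁))
                             (trans (Sum-0 n) (sym (*-zeroʳ (# S))))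

    ΣΣ-col : (x : Fin n) (S : DS n) → ΣΣ (λ u v → (v ≟ x) ×-dec mem? S u) ≡ # S
    ΣΣ-col x S = trans (Sum-swap (λ u v → ⟦ (v ≟ x) ×-dec mem? S u ⟧)) (ΣΣ-row x S)

  -- Graphs, connected sets and linkages

  record Gr (n : ℕ) : Set₁ where
    field
      adj   : Fin n → Fin n → Set
      adj?  : ∀ u v → Dec (adj u v)
      symm  : ∀ {u v} → adj u v → adj v u
      irr   : ∀ {v} → ¬ adj v v
  open Gr public

  data Reach {n : ℕ} (E : Gr n) (S : DS n) : Fin n → Fin n → Set where
    here : ∀ {u} → u ∈ S → Reach E S u u
    step : ∀ {u w v} → u ∈ S → adj E u w → Reach E S w v → Reach E S u v

  Conn : ∀ {n} → Gr n → DS n → Set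
  Conn E S = ∀ u v → u ∈ S → v ∈ S → Reach E S u v

  N : ∀ {n} → Gr n → DS n → DS n → DS n
  N E V X = mkDS (λ v → v ∈ V × v ∉ X × ∃ λ x → x ∈ X × adj E x v)
                 (λ v → mem? V v ×-dec ¬? (mem? X v) ×-dec any? λ x → mem? X x ×-dec adj? E x v)

  -- The graph obtained by turning the neighbourhood of X into a clique; X itself
  -- is removed by passing to the vertex set V ∖ X.
  quot : ∀ {n} → Gr n → DS n → DS n → Gr n
  quot E V X = record
    { adj = λ u v → u ≢ v × (adj E u v ⊎ u ∈ N E V X × v ∈ N E V X)
    ; adj? = λ u v → ¬? (u ≟ v) ×-dec (adj? E u v ⊎-dec mem? (N E V X) u ×-dec mem? (N E V X) v)
    ; symm = λ { (ne , inj₁ e) → ≢-sym ne , inj₁ (symm E e)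
               ; (ne , inj₂ (a , b)) → ≢-sym ne , inj₂ (b , a) }
    ; irr = λ { (ne , _) → ne refl } }

  -- Edges between two neighbours of `X` are dropped, so that goodness of `X` depends only on edges
  -- with an end in `X`. A quotient by another set may make further neighbours of `X` adjacent; such
  -- edges must not help.
  restr : ∀ {n} → Gr n → DS n → Gr n
  restr E X = record
    { adj = λ u v → adj E u v × (u ∈ X ⊎ v ∈ X)
    ; adj? = λ u v → adj? E u v ×-dec (mem? X u ⊎-dec mem? X v)
    ; symm = λ { (e , inj₁ a) → symm E e , inj₂ a ; (e , inj₂ a) → symm E e , inj₁ a }
    ; irr = λ { (e , _) → irr E e } }

  module _ {n : ℕ} {E : Gr n} {S : DS n} where

    reach-start : ∀ {u v} → Reach E S u v → u ∈ S
    reach-start (here s) = s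
    reach-start (step s _ _) = s

    reach-end : ∀ {u v} → Reach E S u v → v ∈ S
    reach-end (here s) = s
    reach-end (step _ _ r) = reach-end r

    reach-trans : ∀ {u w v} → Reach E S u w → Reach E S w v → Reach E S u v
    reach-trans (here _) r = r
    reach-trans (step s e p) r = step s e (reach-trans p r)

    reach-edge : ∀ {u v} → u ∈ S → v ∈ S → adj E u v → Reach E S u v
    reach-edge s t e = step s e (here t)

    reach-sym : ∀ {u v} → Reach E S u v → Reach E S v u
    reach-sym (here s) = here s
    reach-sym (step s e r) = reach-trans (reach-sym r) (reach-edge (reach-start r) s (symm E e))

    conn-hub : ∀ h → (∀ u → u ∈ S → Reach E S u h) → Conn E S
    conn-hub h f u v s t = reach-trans (f u s) (reach-sym (f v t))

    reach-exit : (X : DS n) → ∀ {u v} → Reach E S u v → u ∈ X → v ∉ X →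
      ∃ λ x → ∃ λ w → x ∈ X × x ∈ S × w ∈ S × w ∉ X × adj E x w
    reach-exit X (here _) a b = contradiction a b
    reach-exit X (step {u} {w} s e r) a b with mem? X w
    ... | yes c = reach-exit X r c b
    ... | no c = u , w , a , s , reach-start r , c , e

  reach-map : ∀ {n} {E E′ : Gr n} {S S′ : DS n} → S ⊆ S′ →
    (∀ u v → u ∈ S → v ∈ S → adj E u v → Reach E′ S′ u v) →
    ∀ {u v} → Reach E S u v → Reach E′ S′ u v
  reach-map h f (here s) = here (h _ s)
  reach-map h f (step s e r) = reach-trans (f _ _ s (reach-start r) e) (reach-map h f r)

  _≼[_]_ : ∀ {n} → Gr n → DS n → Gr n → Set
  E ≼[ S ] E′ = ∀ u v → u ∈ S → v ∈ S → adj E u v → adj E′ u v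

  module _ {n : ℕ} where

    reach-mono : {E E′ : Gr n} {S S′ : DS n} → S ⊆ S′ → E ≼[ S ] E′ →
      ∀ {u v} → Reach E S u v → Reach E′ S′ u v
    reach-mono h f = reach-map h λ u v a b e → reach-edge (h u a) (h v b) (f u v a b e)

    conn-mono : {E E′ : Gr n} {S : DS n} → E ≼[ S ] E′ → Conn E S → Conn E′ S
    conn-mono {S = S} f c u v a b = reach-mono (λ _ → id) f (c u v a b)

    conn-subsingleton : (E : Gr n) (S : DS n) → (∀ u v → u ∈ S → v ∈ S → u ≡ v) → Conn E S
    conn-subsingleton E S h u v a b with h u v a b
    ... | refl = here a

    conn-single : (E : Gr n) (x : Fin n) → Conn E ｛ x ｝
    conn-single E x = conn-subsingleton E ｛ x ｝ λ { u v refl refl → refl }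

    conn-∪ : {E : Gr n} {S T : DS n} → Conn E S → Conn E T →
      ∀ {x y} → x ∈ S → y ∈ T → x ≡ y ⊎ adj E x y → Conn E (S ∪ T)
    conn-∪ {E} {S} {T} c d {x} {y} xs yt link = conn-hub x λ
      { u (inj₁ s) → left (c u x s xs)
      ; u (inj₂ t) → reach-trans (right (d u y t yt)) (reach-sym (bridge link)) }
      where
      left : ∀ {u v} → Reach E S u v → Reach E (S ∪ T) u v
      left = reach-mono (λ _ → inj₁) λ _ _ _ _ → id
      right : ∀ {u v} → Reach E T u v → Reach E (S ∪ T) u v
      right = reach-mono (λ _ → inj₂) λ _ _ _ _ → id
      bridge : x ≡ y ⊎ adj E x y → Reach E (S ∪ T) x y
      bridge (inj₁ refl) = here (inj₁ xs)
      bridge (inj₂ e) = reach-edge (inj₁ xs) (inj₂ yt) e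

    conn-cong : {E : Gr n} {S T : DS n} → S ⊆ T → T ⊆ S → Conn E S → Conn E T
    conn-cong h g c u v a b = reach-mono h (λ _ _ _ _ → id) (c u v (g u a) (g v b))

    -- The part of a walk from `b` up to its first vertex `p` in `S`, kept as a set. Having a single
    -- vertex in `S`, it uses no clique edge of a quotient by a set with neighbourhood `S`, and
    -- `Bridge` can tell which vertices of `S` a rerouted path meets.
    record Hit (E : Gr n) (B S : DS n) (b : Fin n) : Set₁ where
      field
        C      : DS n
        p      : Fin n
        C⊆B    : C ⊆ B
        connC  : Conn E C
        b∈C    : b ∈ C
        p∈C    : p ∈ C
        p∈S    : p ∈ S
        only   : ∀ v → v ∈ C → v ∈ S → v ≡ p

    first-hit : (E : Gr n) (B S : DS n) → ∀ {b s} → Reach E B b s → s ∈ S → Hit E B S b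
    first-hit E B S {b} r sS with mem? S b
    ... | yes bS = record
      { C = ｛ b ｝ ; p = b ; C⊆B = λ { _ refl → reach-start r } ; connC = conn-single E b
      ; b∈C = refl ; p∈C = refl ; p∈S = bS ; only = λ _ e _ → e }
    first-hit E B S (here _) sS | no ¬bS = contradiction sS ¬bS
    first-hit E B S {b} (step {u} {w} bB e r) sS | no ¬bS = record
      { C = ｛ b ｝ ∪ C ; p = p
      ; C⊆B = λ { _ (inj₁ refl) → bB ; v (inj₂ c) → C⊆B v c }
      ; connC = conn-∪ (conn-single E b) connC refl b∈C (inj₂ e)
      ; b∈C = inj₁ refl ; p∈C = inj₂ p∈C ; p∈S = p∈S
      ; only = λ { _ (inj₁ refl) s → contradiction s ¬bS ; v (inj₂ c) s → only v c s } }
      where open Hit (first-hit E B S r sS)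

    record Component (E : Gr n) (Y : DS n) (y : Fin n) : Set₁ where
      field
        C      : DS n
        y∈C    : y ∈ C
        C⊆Y    : C ⊆ Y
        connC  : Conn E C
        closed : ∀ c v → c ∈ C → v ∈ Y → adj E c v → v ∈ C

    component : (E : Gr n) (Y : DS n) (y : Fin n) → y ∈ Y → Component E Y y
    component E Y y yY = grow (# Y) ｛ y ｝ refl (λ { _ refl → yY }) (conn-single E y) (m≤m+n _ _)
      where
      grow : ∀ k (C : DS n) → y ∈ C → C ⊆ Y → Conn E C → # Y ≤ k + # C → Component E Y y
      grow k C yC CY c bound
        with any? (λ v → any? (λ x → mem? C x ×-dec mem? Y v ×-dec adj? E x v ×-dec ¬? (mem? C v)))
      ... | no ¬e = record { C = C ; y∈C = yC ; C⊆Y = CY ; connC = c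
        ; closed = λ x v xC vY e → decidable-stable (mem? C v) λ ¬v → ¬e (v , x , xC , vY , e , ¬v) }
      grow zero C yC CY c bound | yes (v , x , xC , vY , e , ¬v) =
        contradiction bound (<⇒≱ (#-strict C Y CY v vY ¬v))
      grow (suc k) C yC CY c bound | yes (v , x , xC , vY , e , ¬v) =
        grow k (C ∪ ｛ v ｝) (inj₁ yC) (λ { w (inj₁ a) → CY w a ; _ (inj₂ refl) → vY })
          (conn-∪ c (conn-single E v) xC refl (inj₂ e))
          (subst (# Y ≤_) (trans (sym (+-suc k (# C))) (cong (k +_) (sym (#-insert C v ¬v)))) bound)

  record Link {n : ℕ} (E : Gr n) (F R : DS n) (b₁ b₂ : Fin n) : Set₁ where
    field
      A B   : DS n
      A⊆    : A ⊆ F ∪ R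
      B⊆    : B ⊆ F ∪ R
      disj  : Disjoint A B
      connA : Conn E A
      connB : Conn E B
      R⊆A   : ∀ v → v ∈ R → v ≢ b₁ → v ≢ b₂ → v ∈ A
      b₁∈B  : b₁ ∈ B
      b₂∈B  : b₂ ∈ B

  Good : ∀ {n} → Gr n → DS n → DS n → Set₁
  Good E V X = ∀ p q → p ∈ N E V X → q ∈ N E V X → p ≢ q → Link (restr E X) X (N E V X) p q

  record Piece {n : ℕ} (E : Gr n) (F X : DS n) : Set where
    field
      x₀   : Fin n
      x₀∈X : x₀ ∈ X
      X⊆F  : X ⊆ F
      conn : Conn E X

  record Roots {n : ℕ} (F R : DS n) (b₁ b₂ : Fin n) : Set where
    field
      b₁∈R  : b₁ ∈ R
      b₂∈R  : b₂ ∈ R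
      b₁≢b₂ : b₁ ≢ b₂
      F∩R   : Disjoint F R

  -- Edges that meet a given set

  module _ {n : ℕ} where

    Touch : Gr n → DS n → DS n → Fin n → Fin n → Set
    Touch E V X u v = u ∈ V × v ∈ V × adj E u v × (u ∈ X ⊎ v ∈ X)

    touch? : ∀ E V X u v → Dec (Touch E V X u v)
    touch? E V X u v = mem? V u ×-dec mem? V v ×-dec adj? E u v ×-dec (mem? X u ⊎-dec mem? X v)

    -- Twice the number of edges inside V with an end in X.
    touching : Gr n → DS n → DS n → ℕ
    touching E V X = ΣΣ (touch? E V X)

    touching-mono : ∀ E V X E′ V′ X′ → (∀ u v → Touch E V X u v → Touch E′ V′ X′ u v) →
      touching E V X ≤ touching E′ V′ X′
    touching-mono E V X E′ V′ X′ h = ΣΣ-mono (touch? E V X) (touch? E′ V′ X′) h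

    touching-split : ∀ E V X E₁ V₁ X₁ E₂ V₂ X₂ →
      (∀ u v → Touch E V X u v → Touch E₁ V₁ X₁ u v ⊎ Touch E₂ V₂ X₂ u v) →
      touching E V X ≤ touching E₁ V₁ X₁ + touching E₂ V₂ X₂
    touching-split E V X E₁ V₁ X₁ E₂ V₂ X₂ h = ΣΣ-⊎ (touch? E V X) (touch? E₁ V₁ X₁) (touch? E₂ V₂ X₂) h

    touching-remove : ∀ E V F X E₁ V₁ → (∀ v → v ∈ V → v ∉ X → v ∈ V₁) → (∀ {u v} → adj E u v → adj E₁ u v) →
      touching E V F ≤ touching E₁ V₁ (F ∖ X) + touching E V X
    touching-remove E V F X E₁ V₁ inV₁ inE₁ = touching-split E V F E₁ V₁ (F ∖ X) E V X split
      where
      split : ∀ u v → Touch E V F u v → Touch E₁ V₁ (F ∖ X) u v ⊎ Touch E V X u v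
      split u v (a , b , e , t) with mem? X u | mem? X v
      ... | yes x | _ = inj₂ (a , b , e , inj₁ x)
      ... | no _ | yes x = inj₂ (a , b , e , inj₂ x)
      ... | no x | no y = inj₁ (inV₁ u a x , inV₁ v b y , inE₁ e , [ (λ f → inj₁ (f , x)) , (λ f → inj₂ (f , y)) ]′ t)

    nbrs : Gr n → DS n → Fin n → DS n
    nbrs E V x = mkDS (λ v → v ∈ V × adj E x v) (λ v → mem? V v ×-dec adj? E x v)

    touching-vertex : ∀ E V x → touching E V ｛ x ｝ ≤ # (nbrs E V x) + # (nbrs E V x)
    touching-vertex E V x = ≤-trans
      (ΣΣ-⊎ (touch? E V ｛ x ｝) (λ u v → (u ≟ x) ×-dec mem? (nbrs E V x) v)
        (λ u v → (v ≟ x) ×-dec mem? (nbrs E V x) u)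
        λ { u v (a , b , e , inj₁ refl) → inj₁ (refl , b , e)
          ; u v (a , b , e , inj₂ refl) → inj₂ (refl , a , symm E e) })
      (≤-reflexive (cong₂ _+_ (ΣΣ-row x (nbrs E V x)) (ΣΣ-col x (nbrs E V x))))

  -- Passing to and from the quotient by a set X

  module _ {n : ℕ} where

    link-mono : ∀ {E E′ : Gr n} {F F′ R R′ p q} → E ≼[ F ∪ R ] E′ → F ∪ R ⊆ F′ ∪ R′ → R′ ⊆ R →
      Link E F R p q → Link E′ F′ R′ p q
    link-mono e h r L = record
      { A = A ; B = B
      ; A⊆ = λ v a → h v (A⊆ v a) ; B⊆ = λ v b → h v (B⊆ v b) ; disj = disj
      ; connA = conn-mono (λ u v a b → e u v (A⊆ u a) (A⊆ v b)) connA
      ; connB = conn-mono (λ u v a b → e u v (B⊆ u a) (B⊆ v b)) connB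
      ; R⊆A = λ v a → R⊆A v (r v a) ; b₁∈B = b₁∈B ; b₂∈B = b₂∈B }
      where open Link L

    good-transfer : ∀ (E E′ : Gr n) V V′ X → N E V X ⊆ N E′ V′ X → N E′ V′ X ⊆ N E V X →
      (∀ u v → u ∈ X ∪ N E V X → v ∈ X ∪ N E V X → u ∈ X ⊎ v ∈ X → adj E u v → adj E′ u v) →
      Good E V X → Good E′ V′ X
    good-transfer E E′ V V′ X h g e good p q a b ne =
      link-mono (λ { u v s t (d , x) → e u v s t x d , x })
                (λ { v (inj₁ x) → inj₁ x ; v (inj₂ y) → inj₂ (h v y) }) g (good p q (g p a) (g q b) ne)

    conn-restr : {E : Gr n} {X : DS n} → Conn E X → Conn (restr E X) X
    conn-restr = conn-mono λ u v a b e → e , inj₁ a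

    -- Joining `p` and `q` through all of `X` leaves at most one further neighbour, and a single
    -- vertex is connected.
    good-small : ∀ (E : Gr n) V X {x} → x ∈ X → Conn E X → # (N E V X) ≤ 3 → Good E V X
    good-small E V X x∈X c small p q p∈ q∈ p≢q = record
      { A = A ; B = B
      ; A⊆ = λ { v ((a , _) , _) → inj₂ a }
      ; B⊆ = λ { v (inj₁ a) → inj₁ a ; v (inj₂ (inj₁ refl)) → inj₂ p∈ ; v (inj₂ (inj₂ refl)) → inj₂ q∈ }
      ; disj = λ { v ((a , _) , _) (inj₁ x) → proj₁ (proj₂ a) x
                 ; v ((_ , b) , _) (inj₂ (inj₁ e)) → b e
                 ; v (_ , b) (inj₂ (inj₂ e)) → b e }
      ; connA = conn-subsingleton _ A (#-≤1⇒≡ A (≤-pred (≤-pred (subst (_≤ 3) size small))))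
      ; connB = conn-hub _ λ { u (inj₁ a) → inX u a ; u (inj₂ (inj₁ refl)) → viaX u (inj₂ (inj₁ refl)) p∈
                             ; u (inj₂ (inj₂ refl)) → viaX u (inj₂ (inj₂ refl)) q∈ }
      ; R⊆A = λ v a b d → (a , b) , d ; b₁∈B = inj₂ (inj₁ refl) ; b₂∈B = inj₂ (inj₂ refl) }
      where
      A B : DS n
      A = N E V X ∖ ｛ p ｝ ∖ ｛ q ｝
      B = X ∪ ｛ p ｝ ∪ ｛ q ｝
      size : # (N E V X) ≡ suc (suc (# A))
      size = trans (sym (#-remove (N E V X) p p∈))
                   (cong suc (sym (#-remove (N E V X ∖ ｛ p ｝) q (q∈ , λ e → p≢q (sym e)))))
      inX : ∀ u → u ∈ X → Reach (restr E X) B u _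
      inX u a = reach-mono (λ _ → inj₁) (λ _ _ _ _ → id) (conn-restr c u _ a x∈X)
      viaX : ∀ u → u ∈ B → u ∈ N E V X → Reach (restr E X) B u _
      viaX u u∈B (_ , _ , y , yX , e) = step u∈B (symm E e , inj₂ yX) (inX y yX)

  module _ {n : ℕ} (E : Gr n) (V X : DS n) where

    private
      S = N E V X
      Q = quot E V X

    module _ (A : DS n) (A⊆V : A ⊆ V) where

      push-out : ∀ {u v} → Reach E A u v → u ∉ X → v ∉ X → Reach Q (A ∖ X) u v
      -- Here the walk is inside `X`. The vertex `w` of `S` stands for the point of entry: when the
      -- walk leaves `X` at another vertex of `S`, a clique edge leads there from `w`.
      push-in : ∀ {u v} → Reach E A u v → u ∈ X → v ∉ X → ∀ w → w ∈ A → w ∈ S → Reach Q (A ∖ X) w v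

      push-out (here a) b _ = here (a , b)
      push-out (step {u} {w} a e r) b d with mem? X w
      ... | no ¬x = step (a , b) ((λ { refl → irr E e }) , inj₁ e) (push-out r ¬x d)
      ... | yes x = push-in r x d u a (A⊆V u a , b , w , x , symm E e)

      push-in (here a) x v∉X w wA wS = contradiction x v∉X
      push-in (step {u} {w′} a e r) x v∉X w wA wS with mem? X w′
      ... | yes x′ = push-in r x′ v∉X w wA wS
      ... | no ¬x′ with w ≟ w′
      ...   | yes refl = push-out r ¬x′ v∉X
      ...   | no ne = step (wA , proj₁ (proj₂ wS))
                (ne , inj₂ (wS , A⊆V w′ (reach-start r) , ¬x′ , u , x , e)) (push-out r ¬x′ v∉X)

      push : Conn E A → Conn Q (A ∖ X)
      push c u v (a , b) (a′ , b′) = push-out (c u v a a′) b b′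

    -- Every edge that the quotient adds has two distinct ends in `S`.
    lift-few : ∀ C → (∀ u v → u ∈ C → v ∈ C → u ∈ S → v ∈ S → u ≡ v) → Conn Q C → Conn E C
    lift-few C few = conn-mono λ { u v a b (ne , inj₁ e) → e
                                 ; u v a b (ne , inj₂ (s , t)) → contradiction (few u v a b s t) ne }

    lift-onto : ∀ A Y → Conn Q A → Conn E Y → ∀ z → z ∈ A → z ∈ Y →
      (∀ v → v ∈ A → v ∈ S → v ∈ Y) → Conn E (A ∪ Y)
    lift-onto A Y cA cY z zA zY h = conn-hub z λ
      { u (inj₁ a) → reach-map (λ _ → inj₁) edge (cA u z a zA)
      ; u (inj₂ y) → reach-mono (λ _ → inj₂) (λ _ _ _ _ → id) (cY u z y zY) }
      where
      edge : ∀ u v → u ∈ A → v ∈ A → adj Q u v → Reach E (A ∪ Y) u v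
      edge u v a b (_ , inj₁ e) = reach-edge (inj₁ a) (inj₁ b) e
      edge u v a b (_ , inj₂ (s , t)) = reach-mono (λ _ → inj₂) (λ _ _ _ _ → id) (cY u v (h u a s) (h v b t))

    lift-through-X : Conn E X → ∀ A → Conn Q A → ∀ z → z ∈ A → z ∈ S → Conn E (A ∪ X)
    lift-through-X cX A cA z zA (_ , _ , x₀ , x₀∈X , ez) = conn-hub z λ
      { u (inj₁ a) → reach-map (λ _ → inj₁) edge (cA u z a zA)
      ; u (inj₂ x) → reach-trans (inX u x₀ x x₀∈X) (reach-edge (inj₂ x₀∈X) (inj₁ zA) ez) }
      where
      inX : ∀ u v → u ∈ X → v ∈ X → Reach E (A ∪ X) u v
      inX u v a b = reach-mono (λ _ → inj₂) (λ _ _ _ _ → id) (cX u v a b)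
      edge : ∀ u v → u ∈ A → v ∈ A → adj Q u v → Reach E (A ∪ X) u v
      edge u v a b (_ , inj₁ e) = reach-edge (inj₁ a) (inj₁ b) e
      edge u v a b (_ , inj₂ ((_ , _ , x , xX , e) , (_ , _ , y , yX , d))) =
        step (inj₁ a) (symm E e) (reach-trans (inX x y xX yX) (reach-edge (inj₂ yX) (inj₁ b) d))

    record Lifted (A B : DS n) (b₁ b₂ : Fin n) : Set₁ where
      field
        A* B*  : DS n
        A⊆A*   : A ⊆ A*
        A*⊆V   : A* ⊆ V
        B*⊆    : B* ⊆ B ∪ X
        disj*  : Disjoint A* B*
        connA* : Conn E A*
        connB* : Conn E B*
        b₁∈B*  : b₁ ∈ B*
        b₂∈B*  : b₂ ∈ B*

    record Direct (B : DS n) (b₁ b₂ : Fin n) : Set₁ where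
      field
        B*     : DS n
        B*⊆B   : B* ⊆ B
        connB* : Conn E B*
        b₁∈B*  : b₁ ∈ B*
        b₂∈B*  : b₂ ∈ B*

    record Through (B : DS n) (b₁ b₂ : Fin n) : Set₁ where
      field
        C₁ C₂       : DS n
        p q         : Fin n
        p≢q         : p ≢ q
        p∈S         : p ∈ S
        q∈S         : q ∈ S
        C₁⊆B        : C₁ ⊆ B
        C₂⊆B        : C₂ ⊆ B
        b₁∈C₁       : b₁ ∈ C₁
        p∈C₁        : p ∈ C₁
        b₂∈C₂       : b₂ ∈ C₂
        q∈C₂        : q ∈ C₂
        connC₁      : Conn E C₁
        connC₂      : Conn E C₂
        only₁       : ∀ v → v ∈ C₁ → v ∈ S → v ≡ p
        only₂       : ∀ v → v ∈ C₂ → v ∈ S → v ≡ q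

    -- `B` is cut at its first vertex of `S` from either end. If the two cuts agree, or `B` misses
    -- `S`, then `b₁` and `b₂` are already joined in `E`; otherwise the stretch from `p` to `q` has
    -- to be replaced by a route through `X`.
    lift-cases : ∀ B {b₁ b₂} → Conn Q B → b₁ ∈ B → b₂ ∈ B → Direct B b₁ b₂ ⊎ Through B b₁ b₂
    lift-cases B {b₁} {b₂} c b₁B b₂B with meets? B S
    ... | inj₂ away = inj₁ record
      { B* = B ; B*⊆B = λ _ → id ; b₁∈B* = b₁B ; b₂∈B* = b₂B
      ; connB* = lift-few B (λ u v a b s t → ⊥-elim (away u a s)) c }
    ... | inj₁ (s , sB , sS) = cases (H₁.p ≟ H₂.p)
      where
      module H₁ = Hit (first-hit Q B S (c b₁ s b₁B sB) sS)
      module H₂ = Hit (first-hit Q B S (c b₂ s b₂B sB) sS)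
      c₁ : Conn E H₁.C
      c₁ = lift-few H₁.C (λ u v a b s t → trans (H₁.only u a s) (sym (H₁.only v b t))) H₁.connC
      c₂ : Conn E H₂.C
      c₂ = lift-few H₂.C (λ u v a b s t → trans (H₂.only u a s) (sym (H₂.only v b t))) H₂.connC
      cases : Dec (H₁.p ≡ H₂.p) → _
      cases (yes e) = inj₁ record
        { B* = H₁.C ∪ H₂.C ; B*⊆B = λ { v (inj₁ a) → H₁.C⊆B v a ; v (inj₂ a) → H₂.C⊆B v a }
        ; connB* = conn-∪ c₁ c₂ H₁.p∈C H₂.p∈C (inj₁ e) ; b₁∈B* = inj₁ H₁.b∈C ; b₂∈B* = inj₂ H₂.b∈C }
      cases (no ne) = inj₂ record
        { C₁ = H₁.C ; C₂ = H₂.C ; p = H₁.p ; q = H₂.p ; p≢q = ne ; p∈S = H₁.p∈S ; q∈S = H₂.p∈S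
        ; C₁⊆B = H₁.C⊆B ; C₂⊆B = H₂.C⊆B ; b₁∈C₁ = H₁.b∈C ; p∈C₁ = H₁.p∈C ; b₂∈C₂ = H₂.b∈C
        ; q∈C₂ = H₂.p∈C ; connC₁ = c₁ ; connC₂ = c₂ ; only₁ = H₁.only ; only₂ = H₂.only }

    module _ (X⊆V : X ⊆ V) (A B : DS n) (A⊆ : A ⊆ V ∖ X) (B⊆ : B ⊆ V ∖ X) (disj : Disjoint A B)
             (connA : Conn Q A) where

      -- As `B` does not need `X`, all of `X` is available to `A` for replacing clique edges. The
      -- inclusion is for `no-direct`: the lifted path avoids `X`.
      lift-direct : ∀ {b₁ b₂} → Conn E X → (D : Direct B b₁ b₂) →
        Σ (Lifted A B b₁ b₂) λ Λ → Lifted.B* Λ ⊆ Direct.B* D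
      lift-direct cX D with meets? A S
      ... | inj₁ (z , zA , zS) = record
        { A* = A ∪ X ; B* = B* ; A⊆A* = λ _ → inj₁
        ; A*⊆V = λ { v (inj₁ a) → proj₁ (A⊆ v a) ; v (inj₂ x) → X⊆V v x }
        ; B*⊆ = λ v b → inj₁ (B*⊆B v b)
        ; disj* = λ { v (inj₁ a) b → disj v a (B*⊆B v b) ; v (inj₂ x) b → proj₂ (B⊆ v (B*⊆B v b)) x }
        ; connA* = lift-through-X cX A connA z zA zS
        ; connB* = connB* ; b₁∈B* = b₁∈B* ; b₂∈B* = b₂∈B* } , λ _ → id
        where open Direct D
      ... | inj₂ away = record
        { A* = A ; B* = B* ; A⊆A* = λ _ → id
        ; A*⊆V = λ v a → proj₁ (A⊆ v a) ; B*⊆ = λ v b → inj₁ (B*⊆B v b)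
        ; disj* = λ v a b → disj v a (B*⊆B v b)
        ; connA* = lift-few A (λ u v a b s t → ⊥-elim (away u a s)) connA
        ; connB* = connB* ; b₁∈B* = b₁∈B* ; b₂∈B* = b₂∈B* } , λ _ → id
        where open Direct D

      module _ {b₁ b₂ : Fin n} (T : Through B b₁ b₂) where
        open Through T

        module _ (L : Link (restr E X) X S p q) where
          private
            module L = Link L

            B* : DS n
            B* = C₁ ∪ C₂ ∪ L.B

            inA : ∀ v → v ∈ A → v ∈ S → v ∈ L.A
            inA v a s = L.R⊆A v s (λ { refl → disj v a (C₁⊆B p p∈C₁) }) (λ { refl → disj v a (C₂⊆B q q∈C₂) })

            B*⊆ : B* ⊆ B ∪ X
            B*⊆ v (inj₁ c) = inj₁ (C₁⊆B v c)
            B*⊆ v (inj₂ (inj₁ c)) = inj₁ (C₂⊆B v c)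
            B*⊆ v (inj₂ (inj₂ b)) with L.B⊆ v b
            ... | inj₁ x = inj₂ x
            ... | inj₂ s with v ≟ p | v ≟ q
            ...   | yes refl | _ = inj₁ (C₁⊆B p p∈C₁)
            ...   | no _ | yes refl = inj₁ (C₂⊆B q q∈C₂)
            ...   | no ne | no ne′ = ⊥-elim (L.disj v (L.R⊆A v s ne ne′) b)

            clashA : Disjoint A B*
            clashA v a b with B*⊆ v b
            ... | inj₁ b′ = disj v a b′
            ... | inj₂ x = proj₂ (A⊆ v a) x

            clashL : Disjoint L.A B*
            clashL v a (inj₂ (inj₂ b)) = L.disj v a b
            clashL v a (inj₁ c) with L.A⊆ v a
            ... | inj₁ x = proj₂ (B⊆ v (C₁⊆B v c)) x
            ... | inj₂ s = L.disj v a (subst (_∈ L.B) (sym (only₁ v c s)) L.b₁∈B)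
            clashL v a (inj₂ (inj₁ c)) with L.A⊆ v a
            ... | inj₁ x = proj₂ (B⊆ v (C₂⊆B v c)) x
            ... | inj₂ s = L.disj v a (subst (_∈ L.B) (sym (only₂ v c s)) L.b₂∈B)

            connB* : Conn E B*
            connB* = conn-∪ connC₁ (conn-∪ connC₂ (conn-mono (λ _ _ _ _ → proj₁) L.connB) q∈C₂ L.b₂∈B (inj₁ refl))
              p∈C₁ (inj₂ L.b₁∈B) (inj₁ refl)

          -- The `B` of the linkage inside `X` joins `p` to `q`, and its `A` replaces all clique
          -- edges of `A`. Of the extra clauses, the one on `S` brings the root `a` into `A*` in
          -- `reroute`, and the one on `B*` shows in `crit-in` that a forced vertex of `X` lies in
          -- the inner `B`.
          lift-through : Σ (Lifted A B b₁ b₂) λ Λ →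
            (∀ z → z ∈ A → z ∈ S → ∀ v → v ∈ S → v ≢ p → v ≢ q → v ∈ Lifted.A* Λ)
            × Lifted.B* Λ ⊆ C₁ ∪ C₂ ∪ L.B
          lift-through with meets? A S
          ... | inj₁ (z , zA , zS) = record
            { A* = A ∪ L.A ; B* = B* ; A⊆A* = λ _ → inj₁
            ; A*⊆V = λ v → [ (λ a → proj₁ (A⊆ v a)) , (λ a → [ X⊆V v , proj₁ ]′ (L.A⊆ v a)) ]′
            ; B*⊆ = B*⊆ ; disj* = λ v → [ clashA v , clashL v ]′
            ; connA* = lift-onto A L.A connA (conn-mono (λ _ _ _ _ → proj₁) L.connA) z zA (inA z zA zS) inA
            ; connB* = connB* ; b₁∈B* = inj₁ b₁∈C₁ ; b₂∈B* = inj₂ (inj₁ b₂∈C₂) }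
            , (λ _ _ _ v s ne ne′ → inj₂ (L.R⊆A v s ne ne′)) , λ _ → id
          ... | inj₂ away = record
            { A* = A ; B* = B* ; A⊆A* = λ _ → id
            ; A*⊆V = λ v a → proj₁ (A⊆ v a)
            ; B*⊆ = B*⊆ ; disj* = clashA
            ; connA* = lift-few A (λ u v a b s t → ⊥-elim (away u a s)) connA
            ; connB* = connB* ; b₁∈B* = inj₁ b₁∈C₁ ; b₂∈B* = inj₂ (inj₁ b₂∈C₂) }
            , (λ z zA zS → ⊥-elim (away z zA zS)) , λ _ → id

      lift-good : ∀ {b₁ b₂} → Conn E X → Good E V X → Conn Q B → b₁ ∈ B → b₂ ∈ B → Lifted A B b₁ b₂
      lift-good cX good cB b₁B b₂B with lift-cases B cB b₁B b₂B
      ... | inj₁ D = proj₁ (lift-direct cX D)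
      ... | inj₂ T = proj₁ (lift-through T (good p q p∈S q∈S p≢q))
        where open Through T

  module _ {n : ℕ} (E : Gr n) (V X : DS n) (X⊆V : X ⊆ V)
           (V′ : DS n) (V′⊆ : V′ ⊆ V ∖ X) (⊆V′ : V ∖ X ⊆ V′) where

    private
      S = N E V X
      Q = quot E V X

    module _ (X₁ : DS n) (X₁⊆V′ : X₁ ⊆ V′) where

      module _ (away : Disjoint X₁ S) where

        away-adj : ∀ u v → u ∈ X₁ ⊎ v ∈ X₁ → adj Q u v → adj E u v
        away-adj u v _ (_ , inj₁ e) = e
        away-adj u v (inj₁ a) (_ , inj₂ (s , _)) = ⊥-elim (away u a s)
        away-adj u v (inj₂ a) (_ , inj₂ (_ , s)) = ⊥-elim (away v a s)

        away-N₁ : N Q V′ X₁ ⊆ N E V X₁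
        away-N₁ v (a , b , x , x₁ , e) = proj₁ (V′⊆ v a) , b , x , x₁ , away-adj x v (inj₁ x₁) e

        away-N₂ : N E V X₁ ⊆ N Q V′ X₁
        away-N₂ v (a , b , x , x₁ , e) =
          ⊆V′ v (a , λ xv → away x x₁ (proj₁ x∈ , proj₂ x∈ , v , xv , symm E e))
          , b , x , x₁ , (λ { refl → irr E e }) , inj₁ e
          where x∈ = V′⊆ x (X₁⊆V′ x x₁)

        away-conn : Conn Q X₁ → Conn E X₁
        away-conn = conn-mono λ u v a b → away-adj u v (inj₁ a)

        away-good : Good Q V′ X₁ → Good E V X₁
        away-good = good-transfer Q E V′ V X₁ away-N₁ away-N₂ λ u v _ _ → away-adj u v

        away-touching : touching Q V′ X₁ ≤ touching E V X₁
        away-touching = touching-mono Q V′ X₁ E V X₁ λ u v (a , b , e , t) →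
          proj₁ (V′⊆ u a) , proj₁ (V′⊆ v b) , away-adj u v t e , t

      module _ {z} (zX₁ : z ∈ X₁) (zS : z ∈ S) where

        -- In the quotient `z` is adjacent to every other neighbour of `X`, so `X₁` inherits them.
        -- Together with `merge-N₂`, `X ∪ X₁` has exactly the neighbours that `X₁` has in the
        -- quotient.
        merge-N₁ : N E V (X ∪ X₁) ⊆ N Q V′ X₁
        merge-N₁ v (a , b , x , inj₁ xX , e) = ⊆V′ v (a , b ∘ inj₁) , b ∘ inj₂ , z , zX₁
          , (λ { refl → b (inj₂ zX₁) }) , inj₂ (zS , a , b ∘ inj₁ , x , xX , e)
        merge-N₁ v (a , b , x , inj₂ x₁ , e) = ⊆V′ v (a , b ∘ inj₁) , b ∘ inj₂ , x , x₁
          , (λ { refl → irr E e }) , inj₁ e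

        merge-N₂ : N Q V′ X₁ ⊆ N E V (X ∪ X₁)
        merge-N₂ v (a , b , x , x₁ , _ , inj₁ e) =
          proj₁ (V′⊆ v a) , (λ { (inj₁ c) → proj₂ (V′⊆ v a) c ; (inj₂ c) → b c }) , x , inj₂ x₁ , e
        merge-N₂ v (a , b , x , x₁ , _ , inj₂ (_ , _ , _ , y , yX , e)) =
          proj₁ (V′⊆ v a) , (λ { (inj₁ c) → proj₂ (V′⊆ v a) c ; (inj₂ c) → b c }) , y , inj₁ yX , e

        merge-conn : Conn E X → Conn Q X₁ → Conn E (X ∪ X₁)
        merge-conn cX cX₁ = conn-cong (λ { _ (inj₁ a) → inj₂ a ; _ (inj₂ a) → inj₁ a })
          (λ { _ (inj₁ a) → inj₂ a ; _ (inj₂ a) → inj₁ a })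
          (lift-through-X E V X cX X₁ cX₁ z zX₁ zS)

        -- A linkage for `X₁` in the quotient is lifted through `X`. The lifting takes place in `E₂`
        -- and `W`, in order that the result uses only edges with an end in `X ∪ X₁`; there `X` has
        -- the same neighbours as before and is still good.
        merge-good : Conn E X → Good E V X → Good Q V′ X₁ → Good E V (X ∪ X₁)
        merge-good cX good good₁ p q p∈ q∈ p≢q = record
          { A = A* ; B = B* ; A⊆ = A*⊆V ; B⊆ = λ v b → inW₂ v (B*⊆ v b) ; disj = disj*
          ; connA = connA* ; connB = connB*
          ; R⊆A = λ v a ne ne′ → A⊆A* v (L.R⊆A v (merge-N₁ v a) ne ne′)
          ; b₁∈B = b₁∈B* ; b₂∈B = b₂∈B* }
          where
          module L = Link (good₁ p q (merge-N₁ p p∈) (merge-N₁ q q∈) p≢q)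
          E₂ = restr E (X ∪ X₁)
          W = (X ∪ X₁) ∪ N E V (X ∪ X₁)
          W⊆V : W ⊆ V
          W⊆V v (inj₁ (inj₁ a)) = X⊆V v a
          W⊆V v (inj₁ (inj₂ a)) = proj₁ (V′⊆ v (X₁⊆V′ v a))
          W⊆V v (inj₂ a) = proj₁ a
          S⊆W : S ⊆ W
          S⊆W v (a , b , x , xX , e) with mem? X₁ v
          ... | yes c = inj₁ (inj₂ c)
          ... | no c = inj₂ (a , (λ { (inj₁ d) → b d ; (inj₂ d) → c d }) , x , inj₁ xX , e)
          N⊆₁ : S ⊆ N E₂ W X
          N⊆₁ v s@(a , b , x , xX , e) = S⊆W v s , b , x , xX , e , inj₁ (inj₁ xX)
          N⊆₂ : N E₂ W X ⊆ S
          N⊆₂ v (a , b , x , xX , e , _) = W⊆V v a , b , x , xX , e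
          inW : ∀ v → v ∈ X₁ ∪ N Q V′ X₁ → v ∈ W ∖ X
          inW v (inj₁ a) = inj₁ (inj₂ a) , proj₂ (V′⊆ v (X₁⊆V′ v a))
          inW v (inj₂ a) = inj₂ (merge-N₂ v a) , proj₂ (V′⊆ v (proj₁ a))
          inW₂ : ∀ v → v ∈ L.B ∪ X → v ∈ W
          inW₂ v (inj₁ b) = proj₁ (inW v (L.B⊆ v b))
          inW₂ v (inj₂ x) = inj₁ (inj₁ x)
          toE₂ : ∀ u v → adj (restr Q X₁) u v → adj (quot E₂ W X) u v
          toE₂ u v ((ne , inj₁ e) , inj₁ a) = ne , inj₁ (e , inj₁ (inj₂ a))
          toE₂ u v ((ne , inj₁ e) , inj₂ a) = ne , inj₁ (e , inj₂ (inj₂ a))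
          toE₂ u v ((ne , inj₂ (s , t)) , _) = ne , inj₂ (N⊆₁ u s , N⊆₁ v t)
          good₂ : Good E₂ W X
          good₂ = good-transfer E E₂ V W X N⊆₁ N⊆₂ (λ
            { u v _ _ (inj₁ a) e → e , inj₁ (inj₁ a) ; u v _ _ (inj₂ a) e → e , inj₂ (inj₁ a) }) good
          open Lifted (lift-good E₂ W X (λ v a → inj₁ (inj₁ a)) L.A L.B (λ v a → inW v (L.A⊆ v a))
            (λ v a → inW v (L.B⊆ v a)) L.disj (conn-mono (λ u v _ _ → toE₂ u v) L.connA)
            (conn-mono (λ u v a b e → e , inj₁ (inj₁ a)) cX) good₂
            (conn-mono (λ u v _ _ → toE₂ u v) L.connB) L.b₁∈B L.b₂∈B)

  module _ {n : ℕ} (E : Gr n) (F R X : DS n) (b₁ b₂ : Fin n) (rts : Roots F R b₁ b₂) (X⊆F : X ⊆ F) where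
    open Roots rts

    private
      V = F ∪ R
      Q = quot E V X
      V′ = (F ∖ X) ∪ R

    quot-V⊆ : V′ ⊆ V ∖ X
    quot-V⊆ v (inj₁ (a , b)) = inj₁ a , b
    quot-V⊆ v (inj₂ a) = inj₂ a , λ x → F∩R v (X⊆F v x) a

    quot-⊆V : V ∖ X ⊆ V′
    quot-⊆V v (inj₁ a , b) = inj₁ (a , b)
    quot-⊆V v (inj₂ a , b) = inj₂ a

    quot-roots : Roots (F ∖ X) R b₁ b₂
    quot-roots = record { b₁∈R = b₁∈R ; b₂∈R = b₂∈R ; b₁≢b₂ = b₁≢b₂ ; F∩R = λ v (a , _) → F∩R v a }

    -- The inclusion makes criticality descend to the quotient: a vertex outside `X` that lies in
    -- the `B` of every linkage above lies in the `B` of every linkage below.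
    quot-lift : Conn E X → Good E V X → (L : Link Q (F ∖ X) R b₁ b₂) →
      Σ (Link E F R b₁ b₂) λ L′ → Link.B L′ ⊆ Link.B L ∪ X
    quot-lift cX good L = record
      { A = A* ; B = B* ; A⊆ = A*⊆V ; B⊆ = λ v b → [ (λ b → proj₁ (quot-V⊆ v (B⊆ v b))) , (λ x → inj₁ (X⊆F v x)) ]′ (B*⊆ v b)
      ; disj = disj* ; connA = connA* ; connB = connB* ; R⊆A = λ v a ne ne′ → A⊆A* v (R⊆A v a ne ne′)
      ; b₁∈B = b₁∈B* ; b₂∈B = b₂∈B* } , B*⊆
      where
      open Link L
      open Lifted (lift-good E V X (λ v x → inj₁ (X⊆F v x)) A B (λ v a → quot-V⊆ v (A⊆ v a))
        (λ v a → quot-V⊆ v (B⊆ v a)) disj connA cX good connB b₁∈B b₂∈B)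

    quot-push : Link E F R b₁ b₂ → Link Q (F ∖ X) R b₁ b₂
    quot-push L = record
      { A = A ∖ X ; B = B ∖ X ; A⊆ = λ v (a , x) → quot-⊆V v (A⊆ v a , x)
      ; B⊆ = λ v (a , x) → quot-⊆V v (B⊆ v a , x) ; disj = λ v (a , _) (b , _) → disj v a b
      ; connA = push E V X A A⊆ connA ; connB = push E V X B B⊆ connB
      ; R⊆A = λ v a ne ne′ → R⊆A v a ne ne′ , λ x → F∩R v (X⊆F v x) a
      ; b₁∈B = b₁∈B , (λ x → F∩R b₁ (X⊆F b₁ x) b₁∈R) ; b₂∈B = b₂∈B , (λ x → F∩R b₂ (X⊆F b₂ x) b₂∈R) }
      where open Link L

    quot-touching : touching E V F ≤ touching Q V′ (F ∖ X) + touching E V X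
    quot-touching = touching-remove E V F X Q V′ (λ v a x → quot-⊆V v (a , x)) λ e → (λ { refl → irr E e }) , inj₁ e

  module _ {n : ℕ} (E : Gr n) (V : DS n) (c : ℕ) where

    touching-components : ∀ Y →
      (∀ X x → x ∈ X → X ⊆ Y → Conn E X → (∀ u v → u ∈ X → v ∈ Y → adj E u v → v ∈ X) →
        touching E V X ≤ c * # X) →
      touching E V Y ≤ c * # Y
    touching-components Y h = go (# Y) Y ≤-refl h
      where
      go : ∀ k Y → # Y ≤ k →
        (∀ X x → x ∈ X → X ⊆ Y → Conn E X → (∀ u v → u ∈ X → v ∈ Y → adj E u v → v ∈ X) →
          touching E V X ≤ c * # X) →
        touching E V Y ≤ c * # Y
      go k Y bound h with any? (mem? Y)
      ... | no ¬e = ≤-trans (ΣΣ-mono (touch? E V Y) (λ _ _ → no λ ())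
                      λ { u v (_ , _ , _ , inj₁ y) → ¬e (u , y) ; u v (_ , _ , _ , inj₂ y) → ¬e (v , y) })
                      (≤-trans (≤-reflexive (trans (Sum-cong {n} λ _ → Sum-0 n) (Sum-0 n))) z≤n)
      go zero Y bound h | yes (y , yY) = contradiction (≤-trans (#-nonempty Y y yY) bound) λ ()
      go (suc k) Y bound h | yes (y , yY) = ≤-trans
        (touching-remove E V Y C E V (λ _ a _ → a) id)
        (≤-trans (+-mono-≤ rest (h C y y∈C C⊆Y connC closed))
          (≤-reflexive (trans (sym (*-distribˡ-+ c (# (Y ∖ C)) (# C))) (cong (c *_) (#-∖ Y C C⊆Y)))))
        where
        open Component (component E Y y yY)
        rest : touching E V (Y ∖ C) ≤ c * # (Y ∖ C)
        rest = go k (Y ∖ C)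
          (≤-pred (≤-trans (#-strict (Y ∖ C) Y (λ _ → proj₁) y yY (λ p → proj₂ p y∈C)) bound))
          λ X x xX XY cX cl → h X x xX (λ v a → proj₁ (XY v a)) cX λ u v uX vY e →
            cl u v uX (vY , λ vC → proj₂ (XY u uX) (closed v u vC (proj₁ (XY u uX)) (symm E e))) e

  -- `P` is not assumed decidable, so a largest set is only obtained under double negation. The
  -- ascent to larger sets ends because sizes are at most `b`.
  maximal : ∀ {n ℓ} (P : DS n → Set ℓ) (b : ℕ) → (∀ X → P X → # X ≤ b) → ∀ X → P X →
    ((Y : DS n) → P Y → (∀ Z → P Z → # Z ≤ # Y) → ⊥) → ⊥
  maximal {n} P b bound X pX k = go (suc b) X pX (m≤m+n (suc b) _)
    where
    go : ∀ fuel X → P X → suc b ≤ fuel + # X → ⊥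
    go zero X pX h = <⇒≱ h (bound X pX)
    go (suc fuel) X pX h = k X pX λ Z pZ → ≤-stable λ ¬le →
      go fuel Z pZ (≤-trans h (≤-trans (≤-reflexive (sym (+-suc fuel (# X)))) (+-monoʳ-≤ fuel (≰⇒> ¬le))))

  -- The two edge bounds

  -- Holds since the index set is finite. It serves to extract, from the failure of `Good`, a
  -- particular pair `p`, `q` without a linkage.
  double-negation-shift : ∀ {ℓ n} {P : Fin n → Set ℓ} →
    (∀ i → ¬ ¬ P i) → ¬ ¬ (∀ i → P i)
  double-negation-shift {n = zero}  h k = k λ ()
  double-negation-shift {n = suc n} h k =
    h zero λ p → double-negation-shift (h ∘ suc) λ q → k λ { zero → p ; (suc i) → q i }

  ΣΣ-rows : ∀ {n} {P : Fin n → Fin n → Set} (p : ∀ u v → Dec (P u v)) (S : DS n) (c : ℕ) →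
    (∀ u v → P u v → u ∈ S) → (∀ u → u ∈ S → # (mkDS (P u) (p u)) ≤ c) → ΣΣ p ≤ c * # S
  ΣΣ-rows {n} {P} p S c inS row = ≤-trans (Sum-mono λ u → bound u (mem? S u))
    (≤-reflexive (sym (Sum-* c (λ u → ⟦ mem? S u ⟧))))
    where
    bound : ∀ u (d : Dec (u ∈ S)) → # (mkDS (P u) (p u)) ≤ c * ⟦ d ⟧
    bound u (yes s) = ≤-trans (row u s) (≤-reflexive (sym (*-identityʳ c)))
    bound u (no ¬s) = ≤-trans (≤-reflexive (#-empty (mkDS (P u) (p u)) λ v a → ¬s (inS u v a))) z≤n

  module _ {n : ℕ} where

    ¬good-witness : ∀ (E : Gr n) V X → ¬ Good E V X →
      (∀ p q → p ∈ N E V X → q ∈ N E V X → p ≢ q → ¬ Link (restr E X) X (N E V X) p q → ⊥) → ⊥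
    ¬good-witness E V X ¬g k =
      double-negation-shift (λ p → double-negation-shift λ q → pair p q) ¬g
      where
      pair : ∀ p q → ¬ ¬ (p ∈ N E V X → q ∈ N E V X → p ≢ q → Link (restr E X) X (N E V X) p q)
      pair p q h with mem? (N E V X) p | mem? (N E V X) q | p ≟ q
      ... | no a | _ | _ = h λ b _ _ → contradiction b a
      ... | yes _ | no a | _ = h λ _ b _ → contradiction b a
      ... | yes _ | yes _ | yes e = h λ _ _ ne → contradiction e ne
      ... | yes a | yes b | no ne = k p q a b ne λ L → h λ _ _ _ → L

    -- Two connected sets that stop at their first vertex in the neighbourhood S of X
    -- are joined by X.
    record Bridge (E : Gr n) (B B′ X S : DS n) (b₁ b₂ p q : Fin n) : Set₁ where
      field
        D     : DS n
        D⊆    : D ⊆ B ∪ X ∪ B′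
        connD : Conn E D
        b₁∈D  : b₁ ∈ D
        b₂∈D  : b₂ ∈ D
        only  : ∀ v → v ∈ D → v ∈ S → v ≡ p ⊎ v ≡ q

    bridge : ∀ (E : Gr n) B B′ X S {b₁ b₂} → Conn E X → Disjoint X S →
      (∀ s → s ∈ S → ∃ λ x → x ∈ X × adj E x s) →
      (H₁ : Hit E B S b₁) (H₂ : Hit E B′ S b₂) → Bridge E B B′ X S b₁ b₂ (Hit.p H₁) (Hit.p H₂)
    bridge E B B′ X S cX away nb H₁ H₂ = record
      { D = H₁.C ∪ X ∪ H₂.C
      ; D⊆ = λ { v (inj₁ a) → inj₁ (H₁.C⊆B v a) ; v (inj₂ (inj₁ a)) → inj₂ (inj₁ a)
               ; v (inj₂ (inj₂ a)) → inj₂ (inj₂ (H₂.C⊆B v a)) }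
      ; connD = let x , xX , e = nb H₁.p H₁.p∈S ; y , yX , d = nb H₂.p H₂.p∈S in
          conn-∪ H₁.connC (conn-∪ cX H₂.connC yX H₂.p∈C (inj₂ d)) H₁.p∈C (inj₁ xX) (inj₂ (symm E e))
      ; b₁∈D = inj₁ H₁.b∈C ; b₂∈D = inj₂ (inj₂ H₂.b∈C)
      ; only = λ { v (inj₁ a) s → inj₁ (H₁.only v a s) ; v (inj₂ (inj₁ a)) s → ⊥-elim (away v a s)
                 ; v (inj₂ (inj₂ a)) s → inj₂ (H₂.only v a s) } }
      where
      module H₁ = Hit H₁
      module H₂ = Hit H₂

    -- B can be rerouted through X so that it meets the neighbourhood S of X in at
    -- most two vertices.
    absorb : ∀ (E : Gr n) B X S {b₁ b₂} → Conn E B → b₁ ∈ B → b₂ ∈ B → Conn E X → Disjoint X S →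
      (∀ s → s ∈ S → ∃ λ x → x ∈ X × adj E x s) → ∃ λ p → ∃ λ q → Bridge E B B X S b₁ b₂ p q
    absorb E B X S {b₁} {b₂} cB b₁B b₂B cX away nb with meets? B S
    ... | inj₂ no-hit = b₁ , b₁ , record { D = B ; D⊆ = λ _ → inj₁ ; connD = cB ; b₁∈D = b₁B
                               ; b₂∈D = b₂B ; only = λ v a s → ⊥-elim (no-hit v a s) }
    ... | inj₁ (s , sB , sS) = _ , _ , bridge E B B X S cX away nb
      (first-hit E B S (cB b₁ s b₁B sB) sS) (first-hit E B S (cB b₂ s b₂B sB) sS)

    absorb-vertex : ∀ (E : Gr n) B x S {b₁ b₂} → Conn E B → b₁ ∈ B → b₂ ∈ B →
      (∀ s → s ∈ S → adj E x s) → ∃ λ p → ∃ λ q → Bridge E B B ｛ x ｝ S b₁ b₂ p q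
    absorb-vertex E B x S cB b₁B b₂B nb = absorb E B ｛ x ｝ S cB b₁B b₂B (conn-single E x)
      (λ { _ refl s → irr E (nb x s) }) (λ s m → x , refl , nb s m)

    absorb-N : ∀ (E : Gr n) V B X {b₁ b₂} → Conn E B → b₁ ∈ B → b₂ ∈ B → Conn E X →
      ∃ λ p → ∃ λ q → Bridge E B B X (N E V X) b₁ b₂ p q
    absorb-N E V B X cB b₁B b₂B cX = absorb E B X (N E V X) cB b₁B b₂B cX
      (λ v x m → proj₁ (proj₂ m) x) (λ v m → proj₂ (proj₂ m))

    restr-N₁ : ∀ (E : Gr n) V X X′ → X ⊆ V → X′ ⊆ X →
      N (restr E X) (X ∪ N E V X) X′ ⊆ N E V X′
    restr-N₁ E V X X′ XV h v (inj₁ a , b , x , x′ , e , _) = XV v a , b , x , x′ , e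
    restr-N₁ E V X X′ XV h v (inj₂ a , b , x , x′ , e , _) = proj₁ a , b , x , x′ , e

    restr-N₂ : ∀ (E : Gr n) V X X′ → X′ ⊆ X → N E V X′ ⊆ N (restr E X) (X ∪ N E V X) X′
    restr-N₂ E V X X′ h v (a , b , x , x′ , e) with mem? X v
    ... | yes c = inj₁ c , b , x , x′ , e , inj₁ (h x x′)
    ... | no c = inj₂ (a , c , x , h x x′ , e) , b , x , x′ , e , inj₁ (h x x′)

    restr-good : ∀ (E : Gr n) V X X′ → X ⊆ V → X′ ⊆ X →
      Good (restr E X) (X ∪ N E V X) X′ → Good E V X′
    restr-good E V X X′ XV h = good-transfer (restr E X) E (X ∪ N E V X) V X′
      (restr-N₁ E V X X′ XV h) (restr-N₂ E V X X′ h) λ _ _ _ _ _ → proj₁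

    restr-touching : ∀ (E : Gr n) V X → touching E V X ≤ touching (restr E X) (X ∪ N E V X) X
    restr-touching E V X = touching-mono E V X (restr E X) (X ∪ N E V X) X λ
      { u v (a , b , e , inj₁ x) → inj₁ x , near u v x b e , (e , inj₁ x) , inj₁ x
      ; u v (a , b , e , inj₂ x) → near v u x a (symm E e) , inj₁ x , (e , inj₂ x) , inj₂ x }
      where
      near : ∀ u v → u ∈ X → v ∈ V → adj E u v → v ∈ X ∪ N E V X
      near u v x b e with mem? X v
      ... | yes c = inj₁ c
      ... | no c = inj₂ (b , c , u , x , e)

    nbr-roots : ∀ (E : Gr n) V X p q → p ∈ N E V X → q ∈ N E V X → p ≢ q → Roots X (N E V X) p q
    nbr-roots E V X p q a b ne = record
      { b₁∈R = a ; b₂∈R = b ; b₁≢b₂ = ne ; F∩R = λ v x s → proj₁ (proj₂ s) x }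

    -- `k` is one less than the number of roots, here and in `CriticalBound`. The sparseness
    -- assumption is re-established by `delete-vertex-bound` after a deletion and by `thin-bound`
    -- after a contraction.
    InfeasibleBound : Gr n → DS n → DS n → Fin n → Fin n → ℕ → Set₁
    InfeasibleBound E F R b₁ b₂ k = Roots F R b₁ b₂ → # R ≡ suc k → ¬ Link E F R b₁ b₂ →
      (∀ X → Piece E F X → # (N E (F ∪ R) X) ≤ k → Good E (F ∪ R) X →
        touching E (F ∪ R) X ≤ 2 * (k * # X)) →
      touching E (F ∪ R) F ≤ 2 * suc (k * # F)

    -- Good sets disjoint from `U` may be excluded outright, as `collection` passes to quotients
    -- until none is left. Members of the collection have to avoid `U`, so good sets that meet `U`
    -- remain and are treated by splitting the instance.
    CriticalBound : Gr n → DS n → DS n → Fin n → Fin n → DS n → ℕ → Set₁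
    CriticalBound E F R b₁ b₂ U k = Roots F R b₁ b₂ → # R ≡ suc k → Link E F R b₁ b₂ →
      U ⊆ F → (∃ λ u → u ∈ U) → ((L : Link E F R b₁ b₂) → U ⊆ Link.B L) →
      (∀ X → Piece E F X → Disjoint X U → # (N E (F ∪ R) X) ≤ suc k → ¬ Good E (F ∪ R) X) →
      touching E (F ∪ R) F + 2 * # U ≤ 2 * suc (suc k * # F)

    record Bounds (s : ℕ) : Set₁ where
      field
        infeasible : ∀ E F R b₁ b₂ k → # F + # R < s → InfeasibleBound E F R b₁ b₂ k
        critical   : ∀ E F R b₁ b₂ U k → # F + # R < s → CriticalBound E F R b₁ b₂ U k

    -- Some pair of neighbours cannot be linked through `X`, so `X` with roots `N E V X` is a
    -- smaller infeasible instance. The last hypothesis rules out good subsets with fewer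
    -- neighbours, which makes the sparseness assumption vacuous.
    not-good-bound : ∀ {s} → Bounds s → ∀ E V X x j → x ∈ X → X ⊆ V → Conn E X →
      # X + # (N E V X) < s → # (N E V X) ≤ suc j → ¬ Good E V X →
      (∀ X′ → Piece E X X′ → # (N E V X′) < # (N E V X) → ¬ Good E V X′) →
      touching E V X ≤ 2 * suc (j * # X)
    not-good-bound ih E V X x j xX XV cX small size ¬g none = ≤-stable λ ¬goal →
      ¬good-witness E V X ¬g λ p q pS qS ne ¬L → ¬goal (bound p q pS qS ne ¬L)
      where
      S = N E V X
      bound : ∀ p q → p ∈ S → q ∈ S → p ≢ q → ¬ Link (restr E X) X S p q →
        touching E V X ≤ 2 * suc (j * # X)
      bound p q pS qS ne ¬L = ≤-trans (restr-touching E V X) (≤-trans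
        (Bounds.infeasible ih (restr E X) X S p q i small (nbr-roots E V X p q pS qS ne) (sym count) ¬L
          λ X′ P le g → contradiction (restr-good E V X X′ XV (Piece.X⊆F P) g)
            (none X′ (record { x₀ = Piece.x₀ P ; x₀∈X = Piece.x₀∈X P ; X⊆F = Piece.X⊆F P
                             ; conn = conn-mono (λ _ _ _ _ → proj₁) (Piece.conn P) })
              (subst (# (N E V X′) <_) count (s≤s (≤-trans (#-mono _ _ (restr-N₂ E V X X′ (Piece.X⊆F P))) le)))))
        (*-monoʳ-≤ 2 (s≤s (*-monoˡ-≤ (# X) (≤-pred (subst (_≤ suc j) (sym count) size))))))
        where
        i = # (S ∖ ｛ p ｝)
        count : suc i ≡ # S
        count = #-remove S p pS

    touching-pendant : ∀ (E : Gr n) V V′ X u x → V′ ⊆ V → u ∈ V → u ∉ V′ → x ∈ X → x ∈ V → x ≢ u →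
      adj E x u → 2 + touching E V′ X ≤ touching E V X
    touching-pendant E V V′ X u x V′⊆V uV u∉V′ xX xV x≢u e = ≤-trans (+-monoˡ-≤ (touching E V′ X) two)
      (ΣΣ-disjoint (touch? E V X) ux? (touch? E V′ X)
        (λ { p q (inj₁ (refl , refl)) → uV , xV , symm E e , inj₂ xX
           ; p q (inj₂ (refl , refl)) → xV , uV , e , inj₁ xX })
        (λ p q (a , b , c) → V′⊆V p a , V′⊆V q b , c)
        λ { p q (inj₁ (refl , _)) (a , _) → u∉V′ a ; p q (inj₂ (refl , _)) (_ , b , _) → u∉V′ b })
      where
      ux₁? : ∀ p q → Dec (p ≡ u × q ≡ x)
      ux₁? p q = (p ≟ u) ×-dec (q ≟ x)
      ux₂? : ∀ p q → Dec (q ≡ u × p ≡ x)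
      ux₂? p q = (q ≟ u) ×-dec (p ≟ x)
      ux? : ∀ p q → Dec ((p ≡ u × q ≡ x) ⊎ (q ≡ u × p ≡ x))
      ux? p q = ux₁? p q ⊎-dec ux₂? p q
      two : 2 ≤ ΣΣ ux?
      two = ≤-trans (≤-reflexive (sym (cong₂ _+_
              (trans (ΣΣ-row u ｛ x ｝) (#-single x)) (trans (ΣΣ-col u ｛ x ｝) (#-single x)))))
        (ΣΣ-disjoint ux? ux₁? ux₂? (λ _ _ → inj₁) (λ _ _ → inj₂) λ { p q (refl , refl) (e , _) → x≢u e })

    -- If u is a neighbour of X, deleting u removes at least one of the at most
    -- j|X| + 1 edges at X; otherwise X looks the same with and without u.
    delete-vertex-bound : ∀ (E : Gr n) V V′ u X j → V′ ⊆ V → (∀ v → v ∈ V → v ≢ u → v ∈ V′) →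
      u ∈ V → u ∉ V′ → X ⊆ V′ →
      (# (N E V X) ≤ suc j → touching E V X ≤ 2 * suc (j * # X)) →
      (# (N E V X) ≤ suc j → ¬ Good E V X) →
      # (N E V′ X) ≤ j → Good E V′ X → touching E V′ X ≤ 2 * (j * # X)
    delete-vertex-bound E V V′ u X j V′⊆V V∖u uV u∉V′ XV′ bound none small good
      with mem? (N E V X) u
    ... | yes (_ , u∉X , x , xX , e) = +-cancelˡ-≤ 2 _ _ (≤-trans
        (touching-pendant E V V′ X u x V′⊆V uV u∉V′ xX (V′⊆V x (XV′ x xX)) (λ { refl → u∉X xX }) e)
        (≤-trans (bound near) (≤-reflexive (*-suc 2 (j * # X)))))
      where
      part : ∀ v → v ∈ N E V X → v ∈ N E V′ X ⊎ v ≡ u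
      part v (a , b) with v ≟ u
      ... | yes e = inj₂ e
      ... | no ne = inj₁ (V∖u v a ne , b)
      near : # (N E V X) ≤ suc j
      near = ≤-trans (#-⊎ (N E V X) (N E V′ X) ｛ u ｝ part)
        (≤-trans (+-mono-≤ small (≤-reflexive (#-single u))) (≤-reflexive (+-comm j 1)))
    ... | no u∉N = contradiction
        (good-transfer E E V′ V X (λ v (a , b) → V′⊆V v a , b) same (λ _ _ _ _ _ → id) good)
        (none (≤-trans (#-mono _ _ same) (m≤n⇒m≤1+n small)))
      where
      same : N E V X ⊆ N E V′ X
      same v m@(a , b) = V∖u v a (λ { refl → u∉N m }) , b

  -- Critically feasible instances

  module CriticalStep {n : ℕ} {s : ℕ} (ih : Bounds {n} s) (E : Gr n) (F R : DS n) (b₁ b₂ : Fin n)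
    (U : DS n) (j : ℕ) (size : # F + # R ≤ s) (rts : Roots F R b₁ b₂) (#R : # R ≡ suc j)
    (L₀ : Link E F R b₁ b₂) (U⊆F : U ⊆ F) (u₀ : ∃ λ u → u ∈ U)
    (crit : (L : Link E F R b₁ b₂) → U ⊆ Link.B L)
    (no-good : ∀ X → Piece E F X → Disjoint X U → # (N E (F ∪ R) X) ≤ suc j → ¬ Good E (F ∪ R) X) where

    open Roots rts
    module L₀ = Link L₀

    k = suc j
    V = F ∪ R

    Goal : Set
    Goal = touching E V F + 2 * # U ≤ 2 * suc (k * # F)

    -- A vertex of `U` on either side gives both halves a nonempty forced set; the one outside also
    -- makes `X` a proper subset of `F`, so that induction applies to it.
    Splitting : DS n → Set₁
    Splitting X = Piece E F X × # (N E V X) ≤ k × Good E V X × (∃ λ x → x ∈ X × x ∈ U) × (∃ λ u → u ∈ U × u ∉ X)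

    proper : ∀ X → X ⊆ F → (∃ λ u → u ∈ U × u ∉ X) → # (N E V X) ≤ k → # X + # (N E V X) < s
    proper X XF (u , uU , u∉X) small = ≤-trans
      (+-mono-≤ (#-strict X F XF u (U⊆F u uU) u∉X) small) (subst (λ r → # F + r ≤ s) #R size)

    module Separate (X : DS n) (sp : Splitting X)
                    (max : ∀ Z → Splitting Z → # Z ≤ # X) where

      X-piece = proj₁ sp
      open Piece X-piece
      X-small = proj₁ (proj₂ sp)
      X-good = proj₁ (proj₂ (proj₂ sp))
      x₁ = proj₁ (proj₁ (proj₂ (proj₂ (proj₂ sp))))
      x₁∈X = proj₁ (proj₂ (proj₁ (proj₂ (proj₂ (proj₂ sp)))))
      x₁∈U = proj₂ (proj₂ (proj₁ (proj₂ (proj₂ (proj₂ sp)))))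
      outer = proj₂ (proj₂ (proj₂ (proj₂ sp)))
      u₁ = proj₁ outer
      u₁∈U = proj₁ (proj₂ outer)
      u₁∉X = proj₂ (proj₂ outer)

      S = N E V X
      Q = quot E V X
      V′ = (F ∖ X) ∪ R

      X⊆V : X ⊆ V
      X⊆V v x = inj₁ (X⊆F v x)

      LQ : Link Q (F ∖ X) R b₁ b₂
      LQ = quot-push E F R X b₁ b₂ rts X⊆F L₀
      module LQ = Link LQ

      A⊆ : LQ.A ⊆ V ∖ X
      A⊆ v (a , x) = L₀.A⊆ v a , x
      B⊆ : LQ.B ⊆ V ∖ X
      B⊆ v (a , x) = L₀.B⊆ v a , x

      to-link : (Λ : Lifted E V X LQ.A LQ.B b₁ b₂) → Link E F R b₁ b₂
      to-link Λ = record
        { A = A* ; B = B* ; A⊆ = A*⊆V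
        ; B⊆ = λ v b → [ (λ b → L₀.B⊆ v (proj₁ b)) , X⊆V v ]′ (B*⊆ v b)
        ; disj = disj* ; connA = connA* ; connB = connB*
        ; R⊆A = λ v a ne ne′ → A⊆A* v (LQ.R⊆A v a ne ne′) ; b₁∈B = b₁∈B* ; b₂∈B = b₂∈B* }
        where open Lifted Λ

      -- The lifted path would miss `X`, and with it the forced vertex `x₁`.
      no-direct : Direct E V X LQ.B b₁ b₂ → ⊥
      no-direct D with lift-direct E V X X⊆V LQ.A LQ.B A⊆ B⊆ LQ.disj LQ.connA conn D
      ... | Λ , h = proj₂ (Direct.B*⊆B D x₁ (h x₁ (crit (to-link Λ) x₁ x₁∈U))) x₁∈X

      crit-Q : (L : Link Q (F ∖ X) R b₁ b₂) → U ∖ X ⊆ Link.B L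
      crit-Q L v (vU , v∉X) with quot-lift E F R X b₁ b₂ rts X⊆F conn X-good L
      ... | L′ , h = [ id , (λ x → contradiction x v∉X) ]′ (h v (crit L′ v vU))

      quot-bound : touching Q V′ (F ∖ X) + 2 * # (U ∖ X) ≤ 2 * suc (k * # (F ∖ X))
      quot-bound = Bounds.critical ih Q (F ∖ X) R b₁ b₂ (U ∖ X) j
        (≤-trans (+-monoˡ-≤ (# R) (#-strict (F ∖ X) F (λ _ → proj₁) x₀ (X⊆F x₀ x₀∈X) λ m → proj₂ m x₀∈X)) size)
        (quot-roots E F R X b₁ b₂ rts X⊆F) #R LQ
        (λ v (a , x) → U⊆F v a , x) (u₁ , u₁∈U , u₁∉X) crit-Q none
        where
        none : ∀ X₁ → Piece Q (F ∖ X) X₁ → Disjoint X₁ (U ∖ X) → # (N Q V′ X₁) ≤ suc j → ¬ Good Q V′ X₁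
        none X₁ P apart small g = cases (meets? X₁ S)
          where
          module P = Piece P
          V′⊆ = quot-V⊆ E F R X b₁ b₂ rts X⊆F
          ⊆V′ = quot-⊆V E F R X b₁ b₂ rts X⊆F
          X₁⊆ : X₁ ⊆ V′
          X₁⊆ v x = inj₁ (P.X⊆F v x)
          cases : (∃ λ z → z ∈ X₁ × z ∈ S) ⊎ Disjoint X₁ S → ⊥
          cases (inj₂ away) = no-good X₁ (record { x₀ = P.x₀ ; x₀∈X = P.x₀∈X ; X⊆F = λ v x → proj₁ (P.X⊆F v x)
                  ; conn = away-conn E V X X⊆V V′ V′⊆ ⊆V′ X₁ X₁⊆ away P.conn })
                (λ v x u → apart v x (u , proj₂ (P.X⊆F v x)))
                (≤-trans (#-mono _ _ (away-N₂ E V X X⊆V V′ V′⊆ ⊆V′ X₁ X₁⊆ away)) small)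
                (away-good E V X X⊆V V′ V′⊆ ⊆V′ X₁ X₁⊆ away g)
          -- The union with `X₁` would be a larger splitting set; `u₁` stays outside it because `X₁`
          -- avoids what `U` has outside `X`.
          cases (inj₁ (z , zX₁ , zS)) = <⇒≱ (#-strict X (X ∪ X₁) (λ _ → inj₁) P.x₀ (inj₂ P.x₀∈X)
                                          (proj₂ (P.X⊆F P.x₀ P.x₀∈X)))
            (max (X ∪ X₁)
              ( record { x₀ = x₀ ; x₀∈X = inj₁ x₀∈X
                       ; X⊆F = λ v → [ X⊆F v , (λ x → proj₁ (P.X⊆F v x)) ]′
                       ; conn = merge-conn E V X X⊆V V′ V′⊆ ⊆V′ X₁ X₁⊆ zX₁ zS conn P.conn }
              , ≤-trans (#-mono _ _ (merge-N₁ E V X X⊆V V′ V′⊆ ⊆V′ X₁ X₁⊆ zX₁ zS)) small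
              , merge-good E V X X⊆V V′ V′⊆ ⊆V′ X₁ X₁⊆ zX₁ zS conn X-good g
              , (x₁ , inj₁ x₁∈X , x₁∈U)
              , (u₁ , u₁∈U , [ u₁∉X , (λ x → apart u₁ x (u₁∈U , u₁∉X)) ]′)))

      module _ (T : Through E V X LQ.B b₁ b₂) where
        open Through T

        -- Inside `X` the roots are `S`, with ends `p` and `q`. Every linkage there extends by
        -- `lift-through` to one of the whole instance whose `B` meets `X` only in the inner `B`, so
        -- `U ∩ X` is forced.
        inner-bound : touching E V X + 2 * # (U ∩ X) ≤ 2 * suc (k * # X)
        inner-bound = ≤-trans (+-monoˡ-≤ (2 * # (U ∩ X)) (restr-touching E V X)) (≤-trans
          (Bounds.critical ih (restr E X) X S p q (U ∩ X) i
            (proper X X⊆F outer X-small)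
            (nbr-roots E V X p q p∈S q∈S p≢q) (sym count) (X-good p q p∈S q∈S p≢q)
            (λ v → proj₂) (x₁ , x₁∈U , x₁∈X) crit-in
            λ X′ P apart small g → no-good X′
              (record { x₀ = Piece.x₀ P ; x₀∈X = Piece.x₀∈X P ; X⊆F = λ v x → X⊆F v (Piece.X⊆F P v x)
                      ; conn = conn-mono (λ _ _ _ _ → proj₁) (Piece.conn P) })
              (λ v x u → apart v x (u , Piece.X⊆F P v x))
              (≤-trans (#-mono _ _ (restr-N₂ E V X X′ (Piece.X⊆F P)))
                (≤-trans small (≤-trans (≤-reflexive count) X-small)))
              (restr-good E V X X′ X⊆V (Piece.X⊆F P) g))
          (*-monoʳ-≤ 2 (s≤s (*-monoˡ-≤ (# X) (≤-trans (≤-reflexive count) X-small)))))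
          where
          i = # (S ∖ ｛ p ｝)
          count : suc i ≡ # S
          count = #-remove S p p∈S
          crit-in : (L : Link (restr E X) X S p q) → U ∩ X ⊆ Link.B L
          crit-in L v (vU , vX) with lift-through E V X X⊆V LQ.A LQ.B A⊆ B⊆ LQ.disj LQ.connA T L
          ... | Λ , _ , h with h v (crit (to-link Λ) v vU)
          ...   | inj₁ c = contradiction vX (proj₂ (C₁⊆B v c))
          ...   | inj₂ (inj₁ c) = contradiction vX (proj₂ (C₂⊆B v c))
          ...   | inj₂ (inj₂ b) = b

        -- Since every linkage visits X, p and q are not adjacent: the edge pq of the
        -- quotient is not an edge of E.
        ¬adj-pq : ¬ adj E p q
        ¬adj-pq e = no-direct record
          { B* = C₁ ∪ C₂ ; B*⊆B = λ v → [ C₁⊆B v , C₂⊆B v ]′ ; connB* = conn-∪ connC₁ connC₂ p∈C₁ q∈C₂ (inj₂ e)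
          ; b₁∈B* = inj₁ b₁∈C₁ ; b₂∈B* = inj₂ b₂∈C₂ }

        adj-Q-pq : adj Q p q
        adj-Q-pq = p≢q , inj₂ (p∈S , q∈S)

        ¬adj-b : ¬ adj Q b₁ b₂
        ¬adj-b e = [ (λ { refl → F∩R u₁ (U⊆F u₁ u₁∈U) b₁∈R }) , (λ { refl → F∩R u₁ (U⊆F u₁ u₁∈U) b₂∈R }) ]′
          (crit-Q record
            { A = LQ.A ; B = ｛ b₁ ｝ ∪ ｛ b₂ ｝ ; A⊆ = LQ.A⊆
            ; B⊆ = λ { _ (inj₁ refl) → inj₂ b₁∈R ; _ (inj₂ refl) → inj₂ b₂∈R }
            ; disj = λ { _ a (inj₁ refl) → LQ.disj _ a LQ.b₁∈B ; _ a (inj₂ refl) → LQ.disj _ a LQ.b₂∈B }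
            ; connA = LQ.connA
            ; connB = conn-∪ (conn-single Q b₁) (conn-single Q b₂) refl refl (inj₂ e)
            ; R⊆A = LQ.R⊆A ; b₁∈B = inj₁ refl ; b₂∈B = inj₂ refl } u₁ (u₁∈U , u₁∉X))

        free-or-root : ∀ v → v ∈ LQ.B → v ∈ F ∖ X ⊎ v ≡ b₁ ⊎ v ≡ b₂
        free-or-root v b with LQ.B⊆ v b | v ≟ b₁ | v ≟ b₂
        ... | inj₁ f | _ | _ = inj₁ f
        ... | inj₂ r | yes e | _ = inj₂ (inj₁ e)
        ... | inj₂ r | no _ | yes e = inj₂ (inj₂ e)
        ... | inj₂ r | no ne | no ne′ = ⊥-elim (LQ.disj v (LQ.R⊆A v r ne ne′) b)

        -- Only edges with a free end are counted. The only roots in `LQ.B` are `b₁` and `b₂`, so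
        -- otherwise `pq` would be `b₁b₂`, and the path consisting of that edge would miss `u₁`.
        pq-free : p ∈ F ∖ X ⊎ q ∈ F ∖ X
        pq-free with free-or-root p (C₁⊆B p p∈C₁) | free-or-root q (C₂⊆B q q∈C₂)
        ... | inj₁ a | _ = inj₁ a
        ... | inj₂ _ | inj₁ a = inj₂ a
        ... | inj₂ (inj₁ refl) | inj₂ (inj₁ refl) = contradiction refl p≢q
        ... | inj₂ (inj₂ refl) | inj₂ (inj₂ refl) = contradiction refl p≢q
        ... | inj₂ (inj₁ refl) | inj₂ (inj₂ refl) = contradiction adj-Q-pq ¬adj-b
        ... | inj₂ (inj₂ refl) | inj₂ (inj₁ refl) = contradiction (symm Q adj-Q-pq) ¬adj-b

        V∖X⊆V′ = quot-⊆V E F R X b₁ b₂ rts X⊆F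

        -- The sum of the two inductive bounds contains `+ 1` twice; the extra edge `pq` of the
        -- quotient, counted in both orders, makes up for one of them.
        touching-gap : suc (suc (touching E V F)) ≤ touching Q V′ (F ∖ X) + touching E V X
        touching-gap = ≤-trans (≤-trans lower (≤-reflexive refl)) upper
          where
          PQ : Fin n → Fin n → Set
          PQ u v = (u ≡ p × v ≡ q) ⊎ (v ≡ p × u ≡ q)
          pq₁? : ∀ u v → Dec (u ≡ p × v ≡ q)
          pq₁? u v = (u ≟ p) ×-dec (v ≟ q)
          pq₂? : ∀ u v → Dec (v ≡ p × u ≡ q)
          pq₂? u v = (v ≟ p) ×-dec (u ≟ q)
          PQ? : ∀ u v → Dec (PQ u v)
          PQ? u v = pq₁? u v ⊎-dec pq₂? u v
          All? : ∀ u v → Dec (PQ u v ⊎ Touch E V F u v)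
          All? u v = PQ? u v ⊎-dec touch? E V F u v
          two : 2 ≤ ΣΣ PQ?
          two = ≤-trans (≤-reflexive (sym (cong₂ _+_
                  (trans (ΣΣ-row p ｛ q ｝) (#-single q)) (trans (ΣΣ-col p ｛ q ｝) (#-single q)))))
            (ΣΣ-disjoint PQ? pq₁? pq₂? (λ _ _ → inj₁) (λ _ _ → inj₂) λ { u v (refl , _) (_ , e) → p≢q e })
          lower : 2 + touching E V F ≤ ΣΣ All?
          lower = ≤-trans (+-monoˡ-≤ (touching E V F) two)
            (ΣΣ-disjoint All? PQ? (touch? E V F) (λ _ _ → inj₁) (λ _ _ → inj₂)
              λ { u v (inj₁ (refl , refl)) (_ , _ , e , _) → ¬adj-pq e
                ; u v (inj₂ (refl , refl)) (_ , _ , e , _) → ¬adj-pq (symm E e) })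
          p∈V′ = LQ.B⊆ p (C₁⊆B p p∈C₁)
          q∈V′ = LQ.B⊆ q (C₂⊆B q q∈C₂)
          split : ∀ u v → PQ u v ⊎ Touch E V F u v → Touch Q V′ (F ∖ X) u v ⊎ Touch E V X u v
          split u v (inj₁ (inj₁ (refl , refl))) = inj₁ (p∈V′ , q∈V′ , adj-Q-pq , pq-free)
          split u v (inj₁ (inj₂ (refl , refl))) =
            inj₁ (q∈V′ , p∈V′ , symm Q adj-Q-pq , [ inj₂ , inj₁ ]′ pq-free)
          split u v (inj₂ (a , b , e , t)) with mem? X u | mem? X v
          ... | yes x | _ = inj₂ (a , b , e , inj₁ x)
          ... | no _ | yes x = inj₂ (a , b , e , inj₂ x)
          ... | no x | no y = inj₁ (V∖X⊆V′ u (a , x) , V∖X⊆V′ v (b , y) , ((λ { refl → irr E e }) , inj₁ e)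
                                   , [ (λ f → inj₁ (f , x)) , (λ f → inj₂ (f , y)) ]′ t)
          upper : ΣΣ All? ≤ touching Q V′ (F ∖ X) + touching E V X
          upper = ΣΣ-⊎ All? (touch? Q V′ (F ∖ X)) (touch? E V X) split

        separate-bound : Goal
        separate-bound = +-cancelˡ-≤ 2 _ _ (≤-trans (+-monoˡ-≤ (2 * # U) touching-gap) (≤-trans
          (≤-trans (≤-reflexive (cong (λ u → touching Q V′ (F ∖ X) + touching E V X + 2 * u) (sym U-count)))
            (≤-trans (≤-reflexive (rearrange (touching Q V′ (F ∖ X)) (touching E V X) (# (U ∖ X)) (# (U ∩ X))))
              (+-mono-≤ quot-bound inner-bound)))
          (≤-reflexive (trans (collect k (# (F ∖ X)) (# X)) (cong (λ f → 2 + 2 * suc (k * f)) (#-∖ F X X⊆F))))))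
          where
          U-count : # (U ∖ X) + # (U ∩ X) ≡ # U
          U-count = ≤-antisym
            (#-disjoint U (U ∖ X) (U ∩ X) (λ _ → proj₁) (λ _ → proj₁) λ v a b → proj₂ a (proj₂ b))
            (#-⊎ U (U ∖ X) (U ∩ X) λ v u → part v u (mem? X v))
            where
            part : ∀ v → v ∈ U → Dec (v ∈ X) → v ∈ U ∖ X ⊎ v ∈ U ∩ X
            part v u (yes x) = inj₂ (u , x)
            part v u (no x) = inj₁ (u , x)
          rearrange : ∀ a b c d → a + b + 2 * (c + d) ≡ (a + 2 * c) + (b + 2 * d)
          rearrange = solve-∀
          collect : ∀ k f x → 2 * suc (k * f) + 2 * suc (k * x) ≡ 2 + 2 * suc (k * (f + x))
          collect = solve-∀

      bound : Goal
      bound with lift-cases E V X LQ.B LQ.connB LQ.b₁∈B LQ.b₂∈B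
      ... | inj₁ D = ⊥-elim (no-direct D)
      ... | inj₂ T = separate-bound T

  -- Critical instances that no good set splits

  module CriticalUnsplit {n : ℕ} {s : ℕ} (ih : Bounds {n} s) (E : Gr n) (F R : DS n) (b₁ b₂ : Fin n)
    (U : DS n) (j : ℕ) (size : # F + # R ≤ s) (rts : Roots F R b₁ b₂) (#R : # R ≡ suc j)
    (L₀ : Link E F R b₁ b₂) (U⊆F : U ⊆ F) (u₀ : ∃ λ u → u ∈ U)
    (crit : (L : Link E F R b₁ b₂) → U ⊆ Link.B L)
    (no-good : ∀ X → Piece E F X → # (N E (F ∪ R) X) ≤ suc j → (∃ λ u → u ∈ U × u ∉ X) → ¬ Good E (F ∪ R) X) where

    open Roots rts
    module L₀ = Link L₀

    k = suc j
    V = F ∪ R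
    b's Ra : DS n
    b's = ｛ b₁ ｝ ∪ ｛ b₂ ｝
    Ra = R ∖ ｛ b₁ ｝ ∖ ｛ b₂ ｝

    Goal : Set
    Goal = touching E V F + 2 * # U ≤ 2 * suc (k * # F)

    #Ra : suc (suc (# Ra)) ≡ suc j
    #Ra = trans (cong suc (#-remove (R ∖ ｛ b₁ ｝) b₂ (b₂∈R , λ e → b₁≢b₂ (sym e))))
                (trans (#-remove R b₁ b₁∈R) #R)

    #F∖U : # (F ∖ U) + # U ≡ # F
    #F∖U = #-∖ F U U⊆F

    piece-bound : ∀ X → Piece E F X → # (N E V X) ≤ k → (∃ λ u → u ∈ U × u ∉ X) →
      touching E V X ≤ 2 * suc (j * # X)
    piece-bound X P small out@(u , uU , u∉X) = not-good-bound ih E V X x₀ j x₀∈X (λ v x → inj₁ (X⊆F v x)) conn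
      (≤-trans (+-mono-≤ (#-strict X F X⊆F u (U⊆F u uU) u∉X) small) (subst (λ r → # F + r ≤ s) #R size))
      small (no-good X P small out)
      λ X′ P′ less → no-good X′ (record { x₀ = Piece.x₀ P′ ; x₀∈X = Piece.x₀∈X P′
          ; X⊆F = λ v x → X⊆F v (Piece.X⊆F P′ v x) ; conn = Piece.conn P′ })
        (≤-trans (<⇒≤ less) small) (u , uU , λ x → u∉X (Piece.X⊆F P′ u x))
      where open Piece P

    B-free : L₀.B ⊆ F ∪ b's
    B-free v b with L₀.B⊆ v b | v ≟ b₁ | v ≟ b₂
    ... | inj₁ f | _ | _ = inj₁ f
    ... | inj₂ _ | yes e | _ = inj₂ (inj₁ e)
    ... | inj₂ _ | no _ | yes e = inj₂ (inj₂ e)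
    ... | inj₂ r | no ne | no ne′ = ⊥-elim (L₀.disj v (L₀.R⊆A v r ne ne′) b)

    U⊆B : U ⊆ L₀.B
    U⊆B = crit L₀

    module Avoidable (u : Fin n) (u∈U : u ∈ U) (B : DS n) (B⊆ : B ⊆ F ∪ b's) (connB : Conn E B)
                     (b₁∈B : b₁ ∈ B) (b₂∈B : b₂ ∈ B) (u∉B : u ∉ B) where

      u∈F = U⊆F u u∈U
      Fu = F ∖ ｛ u ｝
      Vu = Fu ∪ R

      u∉R : u ∉ R
      u∉R = F∩R u u∈F

      Vu⊆V : Vu ⊆ V
      Vu⊆V v (inj₁ (a , _)) = inj₁ a
      Vu⊆V v (inj₂ a) = inj₂ a

      u∉Vu : u ∉ Vu
      u∉Vu (inj₁ (_ , ne)) = ne refl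
      u∉Vu (inj₂ r) = u∉R r

      V∖u : ∀ v → v ∈ V → v ≢ u → v ∈ Vu
      V∖u v (inj₁ a) ne = inj₁ (a , ne)
      V∖u v (inj₂ a) ne = inj₂ a

      -- Otherwise the star with centre `u` on `Ra` is disjoint from `B`, and the two form a linkage
      -- whose `B` misses the forced vertex `u`.
      missing : ∃ λ a → a ∈ Ra × ¬ adj E u a
      missing with any? (λ a → mem? Ra a ×-dec ¬? (adj? E u a))
      ... | yes e = e
      ... | no none = contradiction (crit record
        { A = Ra ∪ ｛ u ｝ ; B = B
        ; A⊆ = λ { v (inj₁ ((r , _) , _)) → inj₂ r ; _ (inj₂ refl) → inj₁ u∈F }
        ; B⊆ = λ v b → inV v (B⊆ v b)
        ; disj = λ { v (inj₁ ((r , ne) , ne′)) b → [ (λ f → F∩R v f r) , [ ne , ne′ ]′ ]′ (B⊆ v b)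
                   ; _ (inj₂ refl) b → u∉B b }
        ; connA = conn-hub u λ
            { v (inj₁ a) → reach-edge (inj₁ a) (inj₂ refl)
                (symm E (decidable-stable (adj? E u v) λ ¬e → none (v , a , ¬e)))
            ; _ (inj₂ refl) → here (inj₂ refl) }
        ; connB = connB ; R⊆A = λ v r ne ne′ → inj₁ ((r , ne) , ne′) ; b₁∈B = b₁∈B ; b₂∈B = b₂∈B } u u∈U) u∉B
        where
        inV : ∀ v → v ∈ F ∪ b's → v ∈ V
        inV v (inj₁ f) = inj₁ f
        inV v (inj₂ (inj₁ refl)) = inj₂ b₁∈R
        inV v (inj₂ (inj₂ refl)) = inj₂ b₂∈R

      infeasible : ¬ Link E Fu R b₁ b₂
      infeasible L = u∉Vu (Link.B⊆ L u (crit (link-mono (λ _ _ _ _ → id) Vu⊆V (λ _ → id) L) u u∈U))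

      weak : ∀ X → Piece E Fu X → # (N E Vu X) ≤ j → Good E Vu X → touching E Vu X ≤ 2 * (j * # X)
      weak X P = delete-vertex-bound E V Vu u X j Vu⊆V V∖u (inj₁ u∈F) u∉Vu (λ v x → inj₁ (X⊆F v x))
        (λ near → piece-bound X P′ near out) (λ near → no-good X P′ near out)
        where
        open Piece P
        P′ : Piece E F X
        P′ = record { x₀ = x₀ ; x₀∈X = x₀∈X ; X⊆F = λ v a → proj₁ (X⊆F v a) ; conn = conn }
        out : ∃ λ u → u ∈ U × u ∉ X
        out = u , u∈U , λ a → proj₂ (X⊆F u a) refl

      core : touching E Vu Fu ≤ 2 * suc (j * # Fu)
      core = Bounds.infeasible ih E Fu R b₁ b₂ j
        (≤-trans (+-monoˡ-≤ (# R) (≤-reflexive (#-remove F u u∈F))) size)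
        (record { b₁∈R = b₁∈R ; b₂∈R = b₂∈R ; b₁≢b₂ = b₁≢b₂ ; F∩R = λ v (a , _) → F∩R v a })
        #R infeasible weak

      a₀ = proj₁ missing
      Ra′ = Ra ∖ ｛ a₀ ｝
      near-U = nbrs E (U ∪ b's) u

      -- `L₀.B` is shortcut at its own vertex `u` so that it meets `near-U` in at most two vertices.
      -- The result is still part of a linkage, so by criticality it contains all of `near-U`.
      near-U-small : # near-U ≤ 2
      near-U-small = #-≤2 near-U _ _ λ v m → only v (inD v (proj₁ m)) m
        where
        open Bridge (proj₂ (proj₂ (absorb-vertex E L₀.B u near-U L₀.connB L₀.b₁∈B L₀.b₂∈B λ v → proj₂)))
        D⊆B : D ⊆ L₀.B
        D⊆B v d = [ id , [ (λ { refl → U⊆B u u∈U }) , id ]′ ]′ (D⊆ v d)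
        inD : ∀ v → v ∈ U ∪ b's → v ∈ D
        inD v (inj₁ a) = crit record
          { A = L₀.A ; B = D ; A⊆ = L₀.A⊆ ; B⊆ = λ v d → L₀.B⊆ v (D⊆B v d)
          ; disj = λ v a d → L₀.disj v a (D⊆B v d) ; connA = L₀.connA ; connB = connD ; R⊆A = L₀.R⊆A
          ; b₁∈B = b₁∈D ; b₂∈B = b₂∈D } v a
        inD v (inj₂ (inj₁ refl)) = b₁∈D
        inD v (inj₂ (inj₂ refl)) = b₂∈D

      degree : # (nbrs E V u) ≤ # (F ∖ U) + (2 + # Ra′)
      degree = ≤-trans (#-⊎ (nbrs E V u) (F ∖ U) (near-U ∪ Ra′) (λ v m → part v m))
        (+-monoʳ-≤ (# (F ∖ U)) (≤-trans (#-⊎ (near-U ∪ Ra′) near-U Ra′ λ _ → id) (+-monoˡ-≤ (# Ra′) near-U-small)))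
        where
        part : ∀ v → v ∈ nbrs E V u → v ∈ F ∖ U ⊎ v ∈ near-U ∪ Ra′
        part v (inj₁ f , e) with mem? U v
        ... | yes a = inj₂ (inj₁ (inj₁ a , e))
        ... | no a = inj₁ (f , a)
        part v (inj₂ r , e) with v ≟ b₁ | v ≟ b₂
        ... | yes a | _ = inj₂ (inj₁ (inj₂ (inj₁ a) , e))
        ... | no _ | yes a = inj₂ (inj₁ (inj₂ (inj₂ a) , e))
        ... | no a | no b = inj₂ (inj₂ (((r , a) , b) , λ { refl → proj₂ (proj₂ missing) e }))

      bound : Goal
      -- The degree of `u` is at most `# F - # U + j`, since `# Ra′` is `j - 2`. Together with the
      -- term `# U` this is exactly what is gained by passing from `j` per vertex of `Fu` to `suc j`
      -- per vertex of `F`.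
      bound = ≤-trans (+-monoˡ-≤ (2 * # U) (≤-trans drop (+-monoˡ-≤ _ core)))
        (arith j (# Fu) (# (nbrs E V u)) (# (F ∖ U)) (# Ra′) (# U) (# F)
          (#-remove F u u∈F) #F∖U
          (trans (cong (λ x → suc (suc x)) (#-remove Ra a₀ (proj₁ (proj₂ missing)))) #Ra) degree)
        where
        drop : touching E V F ≤ touching E Vu Fu + (# (nbrs E V u) + # (nbrs E V u))
        drop = ≤-trans (touching-remove E V F ｛ u ｝ E Vu V∖u id) (+-monoʳ-≤ _ (touching-vertex E V u))
        arith : ∀ j f′ d g r U f → suc f′ ≡ f → g + U ≡ f → suc (suc (suc r)) ≡ suc j → d ≤ g + (2 + r) →
          2 * suc (j * f′) + (d + d) + 2 * U ≤ 2 * suc (suc j * f)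
        arith _ f′ d g r U _ refl e refl h = ≤-trans
          (+-monoˡ-≤ (2 * U) (+-monoʳ-≤ (2 * suc (suc (suc r) * f′)) (+-mono-≤ h h)))
          (≤-reflexive (trans (lhs f′ g r U) (trans (cong (λ x → 2 * suc (suc (suc r) * f′) + 2 * (2 + r) + 2 * x) e) (rhs f′ r))))
          where
          lhs : ∀ f′ g r U → 2 * suc (suc (suc r) * f′) + ((g + (2 + r)) + (g + (2 + r))) + 2 * U
            ≡ 2 * suc (suc (suc r) * f′) + 2 * (2 + r) + 2 * (g + U)
          lhs = solve-∀
          rhs : ∀ f′ r → 2 * suc (suc (suc r) * f′) + 2 * (2 + r) + 2 * suc f′
            ≡ 2 * suc (suc (suc (suc r)) * suc f′)
          rhs = solve-∀

    module Unavoidable (all : ∀ B → B ⊆ F ∪ b's → Conn E B → b₁ ∈ B → b₂ ∈ B → U ⊆ B) where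

      W : DS n
      W = U ∪ b's

      -- `L₀.B` rerouted through a component `X` still contains `U`, so `X` has at most two
      -- neighbours among `U`, `b₁`, `b₂`; with `Ra` these are at most `k`. As `X` misses `U` it is
      -- not good, and `j * # X + 1` is at most `k * # X`.
      rest-bound : touching E V (F ∖ U) ≤ 2 * k * # (F ∖ U)
      rest-bound = touching-components E V (2 * k) (F ∖ U) λ X x xX X⊆ cX closed →
        let
          P : Piece E F X
          P = record { x₀ = x ; x₀∈X = xX ; X⊆F = λ v a → proj₁ (X⊆ v a) ; conn = cX }
          p , q , br = absorb-N E V L₀.B X L₀.connB L₀.b₁∈B L₀.b₂∈B cX
          open Bridge br
          D⊆′ : D ⊆ F ∪ b's
          D⊆′ = λ v d → [ B-free v , [ (λ a → inj₁ (proj₁ (X⊆ v a))) , B-free v ]′ ]′ (D⊆ v d)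
          U⊆D : U ⊆ D
          U⊆D = all D D⊆′ connD b₁∈D b₂∈D
          part : ∀ v → v ∈ N E V X → v ∈ ｛ p ｝ ∪ ｛ q ｝ ⊎ v ∈ Ra
          part = λ v m → sort {X} {D} v m (proj₁ m) U⊆D b₁∈D b₂∈D (λ d → only v d m) closed
          small : # (N E V X) ≤ k
          small = ≤-trans (#-⊎ (N E V X) (｛ p ｝ ∪ ｛ q ｝) Ra part)
            (≤-trans (+-monoˡ-≤ (# Ra) (#-≤2 (｛ p ｝ ∪ ｛ q ｝) p q λ _ → id)) (≤-reflexive #Ra))
        in ≤-trans (piece-bound X P small (proj₁ u₀ , proj₂ u₀ , λ a → proj₂ (X⊆ (proj₁ u₀) a) (proj₂ u₀)))
           (≤-trans (*-monoʳ-≤ 2 (+-monoˡ-≤ (j * # X) (#-nonempty X x xX))) (≤-reflexive (assoc (# X) j)))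
        where
        assoc : ∀ x j → 2 * (x + j * x) ≡ 2 * suc j * x
        assoc = solve-∀
        sort : ∀ {X D p q} v → v ∈ N E V X → v ∈ V → U ⊆ D → b₁ ∈ D → b₂ ∈ D → (v ∈ D → v ≡ p ⊎ v ≡ q) →
          (∀ u v → u ∈ X → v ∈ F ∖ U → adj E u v → v ∈ X) → v ∈ ｛ p ｝ ∪ ｛ q ｝ ⊎ v ∈ Ra
        sort v m@(_ , v∉X , x , xX , e) (inj₁ f) UD b1 b2 only closed with mem? U v
        ... | yes a = inj₁ (only (UD v a))
        ... | no a = contradiction (closed x v xX (f , a) e) v∉X
        sort v m (inj₂ r) UD b1 b2 only closed with v ≟ b₁ | v ≟ b₂
        ... | yes refl | _ = inj₁ (only b1)
        ... | no _ | yes refl = inj₁ (only b2)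
        ... | no a | no b = inj₂ ((r , a) , b)

      row-U : ∀ u → u ∈ U → # (nbrs E W u) ≤ 2
      row-U u uU = #-≤2 (nbrs E W u) _ _ λ v m → only v (inD v (proj₁ m)) m
        where
        open Bridge (proj₂ (proj₂ (absorb-vertex E L₀.B u (nbrs E W u) L₀.connB L₀.b₁∈B L₀.b₂∈B λ v → proj₂)))
        inD : ∀ v → v ∈ W → v ∈ D
        inD v (inj₁ a) = all D (λ v d → [ B-free v , [ (λ { refl → inj₁ (U⊆F u uU) }) , B-free v ]′ ]′ (D⊆ v d)) connD b₁∈D b₂∈D v a
        inD v (inj₂ (inj₁ refl)) = b₁∈D
        inD v (inj₂ (inj₂ refl)) = b₂∈D

      -- A path from the other end `b′` is followed to its first neighbour `p` of `b` and closed
      -- with the edge `pb`. It contains `U`, so `b` has no further neighbour in `U`.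
      row-b : ∀ b b′ → b ∈ b's → b ∈ L₀.B → b′ ∈ L₀.B → (∀ C → b ∈ C → b′ ∈ C → b₁ ∈ C × b₂ ∈ C) →
        # (nbrs E U b) ≤ 1
      row-b b b′ bb bB b′B both with any? (mem? (nbrs E U b))
      ... | no none = ≤-trans (≤-reflexive (#-empty (nbrs E U b) λ v m → none (v , m))) z≤n
      ... | yes (w , wU , ew) = #-≤1 (nbrs E U b) p λ v m → hit v (proj₁ m) (proj₂ m)
        where
        open Hit (first-hit E L₀.B (nbrs E U b) (L₀.connB b′ w b′B (U⊆B w wU)) (wU , ew))
        D : DS n
        D = C ∪ ｛ b ｝
        ends : b₁ ∈ D × b₂ ∈ D
        ends = both D (inj₂ refl) (inj₁ b∈C)
        U⊆D : U ⊆ D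
        U⊆D = all D (λ { v (inj₁ c) → B-free v (C⊆B v c) ; _ (inj₂ refl) → inj₂ bb })
          (conn-∪ connC (conn-single E b) p∈C refl (inj₂ (symm E (proj₂ p∈S)))) (proj₁ ends) (proj₂ ends)
        hit : ∀ v → v ∈ U → adj E b v → v ≡ p
        hit v vU e with U⊆D v vU
        ... | inj₁ c = only v c (vU , e)
        ... | inj₂ refl = contradiction e (irr E)

      uu? : ∀ u v → Dec (u ∈ U × v ∈ nbrs E W u)
      uu? u v = mem? U u ×-dec mem? (nbrs E W u) v
      bu? : ∀ b u v → Dec (u ≡ b × v ∈ nbrs E U u)
      bu? b u v = (u ≟ b) ×-dec mem? (nbrs E U u) v
      ua? : ∀ u v → Dec (u ∈ U × v ∈ Ra)
      ua? u v = mem? U u ×-dec mem? Ra v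
      au? : ∀ u v → Dec (u ∈ Ra × v ∈ U)
      au? u v = mem? Ra u ×-dec mem? U v

      -- On `W` at most `# U + 1` edges meet `U`, as on a path from `b₁` to `b₂`; the edges to `Ra`
      -- are bounded trivially. Since `# Ra + 2` is `k`, adding the term for `# U` in the goal gives
      -- exactly `k` per vertex of `U`.
      bound-U : touching E (U ∪ R) U ≤ (2 * # U + 2) + 2 * (# U * # Ra)
      bound-U = ≤-trans (ΣΣ-⊎ (touch? E (U ∪ R) U) near? far? split)
        (+-mono-≤ near far)
        where
        ends? : ∀ u v → Dec ((u ≡ b₁ × v ∈ nbrs E U u) ⊎ (u ≡ b₂ × v ∈ nbrs E U u))
        ends? u v = bu? b₁ u v ⊎-dec bu? b₂ u v
        near? : ∀ u v → Dec (u ∈ U × v ∈ nbrs E W u ⊎ (u ≡ b₁ × v ∈ nbrs E U u) ⊎ (u ≡ b₂ × v ∈ nbrs E U u))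
        near? u v = uu? u v ⊎-dec ends? u v
        far? : ∀ u v → Dec (u ∈ U × v ∈ Ra ⊎ u ∈ Ra × v ∈ U)
        far? u v = ua? u v ⊎-dec au? u v
        root : ∀ v → v ∈ R → v ≡ b₁ ⊎ v ≡ b₂ ⊎ v ∈ Ra
        root v r with v ≟ b₁ | v ≟ b₂
        ... | yes a | _ = inj₁ a
        ... | no _ | yes a = inj₂ (inj₁ a)
        ... | no a | no b = inj₂ (inj₂ ((r , a) , b))
        split : ∀ u v → Touch E (U ∪ R) U u v →
          (u ∈ U × v ∈ nbrs E W u ⊎ (u ≡ b₁ × v ∈ nbrs E U u) ⊎ (u ≡ b₂ × v ∈ nbrs E U u))
          ⊎ (u ∈ U × v ∈ Ra ⊎ u ∈ Ra × v ∈ U)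
        split u v (_ , inj₁ b , e , inj₁ x) = inj₁ (inj₁ (x , inj₁ b , e))
        split u v (_ , inj₂ b , e , inj₁ x) with root v b
        ... | inj₁ a = inj₁ (inj₁ (x , inj₂ (inj₁ a) , e))
        ... | inj₂ (inj₁ a) = inj₁ (inj₁ (x , inj₂ (inj₂ a) , e))
        ... | inj₂ (inj₂ a) = inj₂ (inj₁ (x , a))
        split u v (inj₁ a , _ , e , inj₂ x) = inj₁ (inj₁ (a , inj₁ x , e))
        split u v (inj₂ a , _ , e , inj₂ x) with root u a
        ... | inj₁ b = inj₁ (inj₂ (inj₁ (b , x , e)))
        ... | inj₂ (inj₁ b) = inj₁ (inj₂ (inj₂ (b , x , e)))
        ... | inj₂ (inj₂ b) = inj₂ (inj₂ (b , x))
        row-end : ∀ b → # (nbrs E U b) ≤ 1 → ΣΣ (bu? b) ≤ 1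
        row-end b h = ≤-trans (ΣΣ-rows (bu? b) ｛ b ｝ 1 (λ _ _ → proj₁)
            λ { _ refl → ≤-trans (#-mono (mkDS _ (bu? b b)) (nbrs E U b) λ _ → proj₂) h })
          (≤-reflexive (cong (1 *_) (#-single b)))
        near : ΣΣ near? ≤ 2 * # U + 2
        near = ≤-trans (ΣΣ-⊎ near? uu? ends? (λ _ _ → id))
          (+-mono-≤ (ΣΣ-rows uu? U 2 (λ _ _ → proj₁)
                      λ u a → ≤-trans (#-mono (mkDS _ (uu? u)) (nbrs E W u) λ _ → proj₂) (row-U u a))
            (≤-trans (ΣΣ-⊎ ends? (bu? b₁) (bu? b₂) (λ _ _ → id))
              (+-mono-≤ (row-end b₁ (row-b b₁ b₂ (inj₁ refl) L₀.b₁∈B L₀.b₂∈B λ C a b → a , b))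
                        (row-end b₂ (row-b b₂ b₁ (inj₂ refl) L₀.b₂∈B L₀.b₁∈B λ C a b → b , a)))))
        far : ΣΣ far? ≤ 2 * (# U * # Ra)
        far = ≤-trans (ΣΣ-⊎ far? ua? au? (λ _ _ → id))
          (≤-trans (+-mono-≤
            (≤-trans (ΣΣ-rows ua? U (# Ra) (λ _ _ → proj₁)
              λ u _ → #-mono (mkDS _ (ua? u)) Ra λ _ → proj₂) (≤-reflexive (*-comm (# Ra) (# U))))
            (ΣΣ-rows au? Ra (# U) (λ _ _ → proj₁) λ u _ → #-mono (mkDS _ (au? u)) U λ _ → proj₂))
            (≤-reflexive (cong (# U * # Ra +_) (sym (+-identityʳ _)))))

      bound : Goal
      bound = ≤-trans (+-monoˡ-≤ (2 * # U)
          (≤-trans (touching-split E V F E V (F ∖ U) E (U ∪ R) U split) (+-mono-≤ rest-bound bound-U)))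
        (arith j (# (F ∖ U)) (# U) (# Ra) (# F) #F∖U #Ra)
        where
        inU : ∀ v → v ∈ V → v ∉ F ∖ U → v ∈ U ∪ R
        inU v (inj₁ f) h = inj₁ (decidable-stable (mem? U v) λ ¬u → h (f , ¬u))
        inU v (inj₂ r) h = inj₂ r
        split : ∀ p q → Touch E V F p q → Touch E V (F ∖ U) p q ⊎ Touch E (U ∪ R) U p q
        split p q (a , b , e , t) with mem? (F ∖ U) p | mem? (F ∖ U) q
        ... | yes x | _ = inj₁ (a , b , e , inj₁ x)
        ... | no _ | yes x = inj₁ (a , b , e , inj₂ x)
        ... | no x | no y = inj₂ (inU p a x , inU q b y , e
          , [ (λ f → inj₁ (free p x f)) , (λ f → inj₂ (free q y f)) ]′ t)
          where
          free : ∀ v → v ∉ F ∖ U → v ∈ F → v ∈ U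
          free v h f = decidable-stable (mem? U v) λ ¬u → h (f , ¬u)
        arith : ∀ j g U r f → g + U ≡ f → suc (suc r) ≡ suc j →
          2 * suc j * g + ((2 * U + 2) + 2 * (U * r)) + 2 * U ≤ 2 * suc (suc j * f)
        arith _ g U r _ refl refl = ≤-reflexive (eq g U r)
          where
          eq : ∀ g U r → 2 * suc (suc r) * g + ((2 * U + 2) + 2 * (U * r)) + 2 * U ≡ 2 * suc (suc (suc r) * (g + U))
          eq = solve-∀

    bound : Goal
    bound = ≤-stable λ ¬goal → excluded-middle
      (Σ (Fin n) λ u → Σ (DS n) λ B → u ∈ U × B ⊆ F ∪ b's × Conn E B × b₁ ∈ B × b₂ ∈ B × u ∉ B) λ
      { (yes (u , B , uU , B⊆ , c , b1 , b2 , ne)) → ¬goal (Avoidable.bound u uU B B⊆ c b1 b2 ne)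
      ; (no none) → ¬goal (Unavoidable.bound λ B B⊆ c b1 b2 u uU →
          decidable-stable (mem? B u) λ ne → none (u , B , uU , B⊆ , c , b1 , b2 , ne)) }

  critical-step : ∀ {n s} → Bounds {n} s → ∀ E F R b₁ b₂ U j → # F + # R ≤ s → CriticalBound E F R b₁ b₂ U j
  critical-step {n} {s} ih E F R b₁ b₂ U j size rts #R L₀ U⊆F u₀ crit no-good = ≤-stable λ ¬goal →
    excluded-middle (Σ (DS n) C.Splitting) λ
      { (yes (X , sp)) → maximal C.Splitting (# F) (λ Y sp → #-mono Y F (Piece.X⊆F (proj₁ sp))) X sp
          λ Y sp max → ¬goal (C.Separate.bound Y sp max)
      ; (no none) → ¬goal (CriticalUnsplit.bound ih E F R b₁ b₂ U j size rts #R L₀ U⊆F u₀ crit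
          λ X P small out g → [ (λ { (x , xX , xU) → none (X , P , small , g , (x , xX , xU) , out) })
                              , (λ away → no-good X P away small g) ]′ (meets? X U)) }
    where module C = CriticalStep ih E F R b₁ b₂ U j size rts #R L₀ U⊆F u₀ crit no-good

  -- Infeasible instances

  -- The graph in which the edge ay has been contracted to a; y itself is removed by
  -- passing to a vertex set without y.
  contract : ∀ {n} → Gr n → Fin n → Fin n → Gr n
  contract E a y = record
    { adj = λ u v → u ≢ v × (adj E u v ⊎ u ≡ a × adj E y v ⊎ v ≡ a × adj E y u)
    ; adj? = λ u v → ¬? (u ≟ v) ×-dec
        (adj? E u v ⊎-dec ((u ≟ a) ×-dec adj? E y v) ⊎-dec ((v ≟ a) ×-dec adj? E y u))
    ; symm = λ { (ne , inj₁ e) → ≢-sym ne , inj₁ (symm E e)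
               ; (ne , inj₂ (inj₁ h)) → ≢-sym ne , inj₂ (inj₂ h)
               ; (ne , inj₂ (inj₂ h)) → ≢-sym ne , inj₂ (inj₁ h) }
    ; irr = λ { (ne , _) → ne refl } }

  -- a is a root, and A′ = L.A is a largest connected set containing the other roots
  -- a_i such that some path avoids A′ and a neighbour y of a.
  module Crossing {n : ℕ} {s : ℕ} (ih : Bounds {n} s) (E : Gr n) (F R : DS n) (b₁ b₂ : Fin n) (k : ℕ)
    (size : # F + # R ≤ s) (rts : Roots F R b₁ b₂) (#R : # R ≡ suc k) (3≤k : 3 ≤ k)
    (¬link : ¬ Link E F R b₁ b₂)
    (no-good : ∀ X → Piece E F X → # (N E (F ∪ R) X) ≤ k → ¬ Good E (F ∪ R) X)
    (a r : Fin n) (a∈R : a ∈ R) (a≢b₁ : a ≢ b₁) (a≢b₂ : a ≢ b₂)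
    (r∈R : r ∈ R) (r≢b₁ : r ≢ b₁) (r≢b₂ : r ≢ b₂) (r≢a : r ≢ a)
    (L : Link E F (R ∖ ｛ a ｝) b₁ b₂) (y : Fin n) (y∈F : y ∈ F) (a~y : adj E a y) (y∉B : y ∉ Link.B L)
    (max : (L′ : Link E F (R ∖ ｛ a ｝) b₁ b₂) → (∃ λ w → w ∈ nbrs E F a × w ∉ Link.B L′) →
      # (Link.A L′) ≤ # (Link.A L)) where

    open Roots rts
    open Link L renaming (A to A′; B to B′)

    RH V VH W T b's Ω : DS n
    RH = R ∖ ｛ a ｝
    V = F ∪ R
    VH = F ∪ RH
    W = nbrs E F a
    T = N E F A′
    b's = ｛ b₁ ｝ ∪ ｛ b₂ ｝
    Ω = (F ∖ A′) ∪ b's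

    y∈W : y ∈ W
    y∈W = y∈F , a~y

    VH⊆V : VH ⊆ V
    VH⊆V v (inj₁ f) = inj₁ f
    VH⊆V v (inj₂ (x , _)) = inj₂ x

    a∉F : a ∉ F
    a∉F f = F∩R a f a∈R

    a∉VH : a ∉ VH
    a∉VH (inj₁ f) = a∉F f
    a∉VH (inj₂ (_ , ne)) = ne refl

    root-in-A′ : ∀ v → v ∈ R → v ≢ a → v ∉ b's → v ∈ A′
    root-in-A′ v x ne nb = R⊆A v (x , ne) (nb ∘ inj₁) (nb ∘ inj₂)

    b∉A′ : ∀ v → v ∈ b's → v ∉ A′
    b∉A′ _ (inj₁ refl) h = disj b₁ h b₁∈B
    b∉A′ _ (inj₂ refl) h = disj b₂ h b₂∈B

    b∈VH : ∀ v → v ∈ b's → v ∈ VH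
    b∈VH _ (inj₁ refl) = inj₂ (b₁∈R , λ e → a≢b₁ (sym e))
    b∈VH _ (inj₂ refl) = inj₂ (b₂∈R , λ e → a≢b₂ (sym e))

    Ω⊆VH : Ω ⊆ VH
    Ω⊆VH v (inj₁ (f , _)) = inj₁ f
    Ω⊆VH v (inj₂ b) = b∈VH v b

    Ω∩A′ : Disjoint A′ Ω
    Ω∩A′ v h (inj₁ (_ , ne)) = ne h
    Ω∩A′ v h (inj₂ b) = b∉A′ v b h

    VH⊆Ω : ∀ v → v ∈ VH → v ∉ A′ → v ∈ Ω
    VH⊆Ω v (inj₁ f) h = inj₁ (f , h)
    VH⊆Ω v (inj₂ (x , ne)) h with mem? b's v
    ... | yes b = inj₂ b
    ... | no nb = contradiction (root-in-A′ v x ne nb) h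

    B′⊆Ω : B′ ⊆ Ω
    B′⊆Ω v b = VH⊆Ω v (B⊆ v b) λ h → disj v h b

    in-Ω : ∀ (B X B″ D : DS n) → B ⊆ Ω → X ⊆ F ∖ A′ → B″ ⊆ Ω → D ⊆ B ∪ X ∪ B″ → D ⊆ Ω
    in-Ω B X B″ D BΩ XF B″Ω D⊆ v d = [ BΩ v , [ (λ x → inj₁ (XF v x)) , B″Ω v ]′ ]′ (D⊆ v d)

    b∈Path : ∀ {B} → b₁ ∈ B → b₂ ∈ B → ∀ v → v ∈ b's → v ∈ B
    b∈Path p q _ (inj₁ refl) = p
    b∈Path p q _ (inj₂ refl) = q

    -- Otherwise `a` could be attached to `A′`, giving a linkage for all of `R`.
    W∩A′ : ∀ w → w ∈ W → w ∉ A′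
    W∩A′ w (wF , e) h = ¬link record
      { A = A′ ∪ ｛ a ｝ ; B = B′
      ; A⊆ = λ { v (inj₁ x) → VH⊆V v (A⊆ v x) ; _ (inj₂ refl) → inj₂ a∈R }
      ; B⊆ = λ v b → VH⊆V v (B⊆ v b)
      ; disj = λ { v (inj₁ x) b → disj v x b ; _ (inj₂ refl) b → a∉VH (B⊆ a b) }
      ; connA = conn-∪ connA (conn-single E a) h refl (inj₂ (symm E e))
      ; connB = connB
      ; R⊆A = λ v x ne ne′ → rootA v x [ ne , ne′ ]′ ; b₁∈B = b₁∈B ; b₂∈B = b₂∈B }
      where
      rootA : ∀ v → v ∈ R → v ∉ b's → v ∈ A′ ∪ ｛ a ｝
      rootA v x nb with v ≟ a
      ... | yes e = inj₂ e
      ... | no ne = inj₁ (root-in-A′ v x ne nb)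

    -- If `B` misses some `t` in `T`, then `t` can be added to `A′`, which gives a linkage without
    -- `a` with a larger `A`. By the choice of `A′`, such a `B` cannot miss a vertex of `W`.
    dichotomy : ∀ B → B ⊆ Ω → Conn E B → b₁ ∈ B → b₂ ∈ B → T ⊆ B ⊎ W ⊆ B
    dichotomy B BΩ cB b1 b2 with ⊆-dec T B
    ... | inj₁ h = inj₁ h
    ... | inj₂ (t , tT@(tF , t∉A′ , x , xA′ , e) , t∉B) =
      inj₂ λ w wW → decidable-stable (mem? B w) λ w∉B → <⇒≱
        (#-strict A′ (A′ ∪ ｛ t ｝) (λ _ → inj₁) t (inj₂ refl) t∉A′)
        (max record
          { A = A′ ∪ ｛ t ｝ ; B = B
          ; A⊆ = λ { v (inj₁ x) → A⊆ v x ; _ (inj₂ refl) → inj₁ tF }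
          ; B⊆ = λ v b → Ω⊆VH v (BΩ v b)
          ; disj = λ { v (inj₁ x) b → Ω∩A′ v x (BΩ v b) ; _ (inj₂ refl) b → t∉B b }
          ; connA = conn-∪ connA (conn-single E t) xA′ refl (inj₂ e)
          ; connB = cB ; R⊆A = λ v x ne ne′ → inj₁ (R⊆A v x ne ne′) ; b₁∈B = b1 ; b₂∈B = b2 } (w , wW , w∉B))

    misses-W : ∀ B → B ⊆ Ω → Conn E B → b₁ ∈ B → b₂ ∈ B → ∀ w → w ∈ W → w ∉ B → T ⊆ B
    misses-W B BΩ cB b1 b2 w wW w∉B with dichotomy B BΩ cB b1 b2
    ... | inj₁ h = h
    ... | inj₂ h = contradiction (h w wW) w∉B

    misses-T : ∀ B → B ⊆ Ω → Conn E B → b₁ ∈ B → b₂ ∈ B → ∀ t → t ∈ T → t ∉ B → W ⊆ B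
    misses-T B BΩ cB b1 b2 t tT t∉B with dichotomy B BΩ cB b1 b2
    ... | inj₁ h = contradiction (h t tT) t∉B
    ... | inj₂ h = h

    T⊆B′ : T ⊆ B′
    T⊆B′ = misses-W B′ B′⊆Ω connB b₁∈B b₂∈B y y∈W y∉B

    y∉T : y ∉ T
    y∉T t = y∉B (T⊆B′ y t)

    y∉A′ : y ∉ A′
    y∉A′ = W∩A′ y y∈W

    no-T-edge : ∀ x v → x ∈ F → x ∉ A′ → x ∉ T → v ∈ A′ → ¬ adj E x v
    no-T-edge x v f h ¬t vA′ e = ¬t (f , h , v , vA′ , symm E e)

    outside : ∀ X → X ⊆ F ∖ A′ → Disjoint X T → ∀ v → v ∈ N E V X → v ≡ a ⊎ v ∈ Ω
    outside X XF XT v (vV , _ , x , xX , e) with v ≟ a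
    ... | yes eq = inj₁ eq
    ... | no ne = inj₂ (VH⊆Ω v (toVH vV)
            λ h → no-T-edge x v (proj₁ (XF x xX)) (proj₂ (XF x xX)) (XT x xX) h e)
      where
      toVH : v ∈ V → v ∈ VH
      toVH (inj₁ f) = inj₁ f
      toVH (inj₂ m) = inj₂ (m , ne)

    module Second (B″ : DS n) (B″⊆Ω : B″ ⊆ Ω) (connB″ : Conn E B″) (b₁∈B″ : b₁ ∈ B″) (b₂∈B″ : b₂ ∈ B″)
                  (t₀ : Fin n) (t₀∈T : t₀ ∈ T) (t₀∉B″ : t₀ ∉ B″) where

      W⊆B″ : W ⊆ B″
      W⊆B″ = misses-T B″ B″⊆Ω connB″ b₁∈B″ b₂∈B″ t₀ t₀∈T t₀∉B″

      -- B′ and B″ are rerouted through X; crossing over from B′ to B″ at X misses a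
      -- vertex of T or a vertex of W, whence one of four candidates is superfluous.
      three : ∀ X x → x ∈ X → X ⊆ F ∖ A′ → Conn E X → Disjoint X T → y ∉ X →
        (∀ v → v ∈ N E Ω X → v ∈ T ⊎ v ∈ W ⊎ v ∈ b's) → # (N E Ω X) ≤ 3
      three X x xX XF cX XT y∉X kind with meets? B′ S | meets? B″ S
        where
        S = N E Ω X
      -- `B′` contains `T` and misses `S`; so `S` consists of vertices of `W` and ends, all of which
      -- lie on the reroute of `B″`.
      ... | inj₂ off | _ = ≤-trans (#-≤2 S _ _ λ v m → only v (inD v m (kind v m)) m) (n≤1+n 2)
        where
        S = N E Ω X
        open Bridge (proj₂ (proj₂ (absorb-N E Ω B″ X connB″ b₁∈B″ b₂∈B″ cX)))
        t₀∉D : t₀ ∉ D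
        t₀∉D d = [ t₀∉B″ , [ (λ p → XT t₀ p t₀∈T) , t₀∉B″ ]′ ]′ (D⊆ t₀ d)
        inD : ∀ v → v ∈ S → v ∈ T ⊎ v ∈ W ⊎ v ∈ b's → v ∈ D
        inD v m (inj₁ t) = ⊥-elim (off v (T⊆B′ v t) m)
        inD v m (inj₂ (inj₁ w)) = misses-T D (in-Ω B″ X B″ D B″⊆Ω XF B″⊆Ω D⊆) connD b₁∈D b₂∈D t₀ t₀∈T t₀∉D v w
        inD v m (inj₂ (inj₂ b)) = b∈Path {D} b₁∈D b₂∈D v b
      ... | inj₁ _ | inj₂ off = ≤-trans (#-≤2 S _ _ λ v m → only v (inD v m (kind v m)) m) (n≤1+n 2)
        where
        S = N E Ω X
        open Bridge (proj₂ (proj₂ (absorb-N E Ω B′ X connB b₁∈B b₂∈B cX)))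
        y∉D : y ∉ D
        y∉D d = [ y∉B , [ y∉X , y∉B ]′ ]′ (D⊆ y d)
        inD : ∀ v → v ∈ S → v ∈ T ⊎ v ∈ W ⊎ v ∈ b's → v ∈ D
        inD v m (inj₁ t) = misses-W D (in-Ω B′ X B′ D B′⊆Ω XF B′⊆Ω D⊆) connD b₁∈D b₂∈D y y∈W y∉D v t
        inD v m (inj₂ (inj₁ w)) = ⊥-elim (off v (W⊆B″ v w) m)
        inD v m (inj₂ (inj₂ b)) = b∈Path {D} b₁∈D b₂∈D v b
      ... | inj₁ (s , sB , sS) | inj₁ (s′ , sB′ , sS′) = cases (dichotomy M.D (in-Ω B′ X B″ M.D B′⊆Ω XF B″⊆Ω M.D⊆) M.connD M.b₁∈D M.b₂∈D)
        where
        S = N E Ω X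
        apart : Disjoint X S
        apart v p m = proj₁ (proj₂ m) p
        touch : ∀ v → v ∈ S → ∃ λ x → x ∈ X × adj E x v
        touch v m = proj₂ (proj₂ m)
        H₁ = first-hit E B′ S (connB b₁ s b₁∈B sB) sS
        H₂ = first-hit E B′ S (connB b₂ s b₂∈B sB) sS
        K₁ = first-hit E B″ S (connB″ b₁ s′ b₁∈B″ sB′) sS′
        K₂ = first-hit E B″ S (connB″ b₂ s′ b₂∈B″ sB′) sS′
        module P = Bridge (bridge E B′ B′ X S cX apart touch H₁ H₂)
        module Q = Bridge (bridge E B″ B″ X S cX apart touch K₁ K₂)
        module M = Bridge (bridge E B′ B″ X S cX apart touch H₁ K₂)
        T⊆P : T ⊆ P.D
        T⊆P = misses-W P.D (in-Ω B′ X B′ P.D B′⊆Ω XF B′⊆Ω P.D⊆) P.connD P.b₁∈D P.b₂∈D y y∈W λ d → [ y∉B , [ y∉X , y∉B ]′ ]′ (P.D⊆ y d)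
        W⊆Q : W ⊆ Q.D
        W⊆Q = misses-T Q.D (in-Ω B″ X B″ Q.D B″⊆Ω XF B″⊆Ω Q.D⊆) Q.connD Q.b₁∈D Q.b₂∈D t₀ t₀∈T
          λ d → [ t₀∉B″ , [ (λ p → XT t₀ p t₀∈T) , t₀∉B″ ]′ ]′ (Q.D⊆ t₀ d)
        h₁ = Hit.p H₁
        h₂ = Hit.p H₂
        k₁ = Hit.p K₁
        k₂ = Hit.p K₂
        cases : T ⊆ M.D ⊎ W ⊆ M.D → # S ≤ 3
        cases (inj₁ T⊆M) = #-≤3 S h₁ k₁ k₂ λ v m → pick v m (kind v m)
          where
          fromM : ∀ {v} → v ≡ h₁ ⊎ v ≡ k₂ → v ≡ h₁ ⊎ v ≡ k₁ ⊎ v ≡ k₂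
          fromM = [ inj₁ , (λ e → inj₂ (inj₂ e)) ]′
          pick : ∀ v → v ∈ S → v ∈ T ⊎ v ∈ W ⊎ v ∈ b's → v ≡ h₁ ⊎ v ≡ k₁ ⊎ v ≡ k₂
          pick v m (inj₁ t) = fromM (M.only v (T⊆M v t) m)
          pick v m (inj₂ (inj₁ w)) = inj₂ (Q.only v (W⊆Q v w) m)
          pick v m (inj₂ (inj₂ b)) = fromM (M.only v (b∈Path {M.D} M.b₁∈D M.b₂∈D v b) m)
        cases (inj₂ W⊆M) = #-≤3 S h₁ h₂ k₂ λ v m → pick v m (kind v m)
          where
          fromM : ∀ {v} → v ≡ h₁ ⊎ v ≡ k₂ → v ≡ h₁ ⊎ v ≡ h₂ ⊎ v ≡ k₂
          fromM = [ inj₁ , (λ e → inj₂ (inj₂ e)) ]′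
          pick : ∀ v → v ∈ S → v ∈ T ⊎ v ∈ W ⊎ v ∈ b's → v ≡ h₁ ⊎ v ≡ h₂ ⊎ v ≡ k₂
          pick v m (inj₁ t) = [ inj₁ , (λ e → inj₂ (inj₁ e)) ]′ (P.only v (T⊆P v t) m)
          pick v m (inj₂ (inj₁ w)) = fromM (M.only v (W⊆M v w) m)
          pick v m (inj₂ (inj₂ b)) = fromM (M.only v (b∈Path {M.D} M.b₁∈D M.b₂∈D v b) m)

      -- A component of the remaining vertices sees only `T`, `W`, `b₁` and `b₂`, and not `a`,
      -- because it misses `W`. By `three` it has at most three neighbours, so it would be good by
      -- `good-small`, contrary to `no-good`.
      cover : ∀ o → o ∈ F → o ∉ A′ → o ∈ T ⊎ o ∈ W
      cover o oF oA′ with mem? T o | mem? W o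
      ... | yes t | _ = inj₁ t
      ... | no _ | yes w = inj₂ w
      ... | no ¬t | no ¬w = contradiction
            (good-small E V C y∈C connC small)
            (no-good C (record { x₀ = o ; x₀∈X = y∈C ; X⊆F = λ v c → proj₁ (CF v c) ; conn = connC })
              (≤-trans small 3≤k))
        where
        open Component (component E ((F ∖ A′) ∖ T ∖ W) o (((oF , oA′) , ¬t) , ¬w))
        CF : C ⊆ F ∖ A′
        CF v c = proj₁ (proj₁ (C⊆Y v c))
        CT : Disjoint C T
        CT v c = proj₂ (proj₁ (C⊆Y v c))
        CW : Disjoint C W
        CW v c = proj₂ (C⊆Y v c)
        kind : ∀ v → v ∈ N E Ω C → v ∈ T ⊎ v ∈ W ⊎ v ∈ b's
        kind v (inj₂ b , _) = inj₂ (inj₂ b)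
        kind v (inj₁ f , v∉C , x , xC , e) with mem? T v | mem? W v
        ... | yes t | _ = inj₁ t
        ... | no _ | yes w = inj₂ (inj₁ w)
        ... | no t | no w = contradiction (closed x v xC ((f , t) , w) e) v∉C
        toΩ : N E V C ⊆ N E Ω C
        toΩ v m@(vV , v∉C , x , xC , e) with outside C CF CT v m
        ... | inj₁ refl = contradiction (proj₁ (CF x xC) , symm E e) (CW x xC)
        ... | inj₂ vΩ = vΩ , v∉C , x , xC , e
        small : # (N E V C) ≤ 3
        small = ≤-trans (#-mono _ _ toΩ) (three C o y∈C CF connC CT (λ c → CW y c y∈W) kind)

      near-y : DS n
      near-y = nbrs E (W ∪ b's) y

      -- `B″` is shortcut at its own vertex `y`. It still misses `t₀`, hence still contains `W`, but
      -- it meets `near-y` in at most two vertices.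
      near-y-small : # near-y ≤ 2
      near-y-small = #-≤2 near-y _ _ λ v m → only v (inD v (proj₁ m)) m
        where
        open Bridge (proj₂ (proj₂ (absorb-vertex E B″ y near-y connB″ b₁∈B″ b₂∈B″ λ v → proj₂)))
        D⊆B″ : D ⊆ B″
        D⊆B″ v d = [ id , [ (λ { refl → W⊆B″ y y∈W }) , id ]′ ]′ (D⊆ v d)
        inD : ∀ v → v ∈ W ∪ b's → v ∈ D
        inD v (inj₁ w) = misses-T D (λ v d → B″⊆Ω v (D⊆B″ v d)) connD b₁∈D b₂∈D t₀ t₀∈T
          (λ d → t₀∉B″ (D⊆B″ t₀ d)) v w
        inD v (inj₂ b) = b∈Path {D} b₁∈D b₂∈D v b

      -- This is `three` for a single vertex, whose neighbours in `Ω` are of the required kind by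
      -- `cover`.
      degree-Ω : ∀ x → x ∈ F → x ∉ A′ → x ∉ T → x ≢ y → # (nbrs E Ω x) ≤ 3
      degree-Ω x xF xA′ xT ne = ≤-trans (#-mono (nbrs E Ω x) (N E Ω ｛ x ｝) λ v (vΩ , e) →
          vΩ , (λ { refl → irr E e }) , x , refl , e)
        (three ｛ x ｝ x refl (λ { _ refl → xF , xA′ }) (conn-single E x) (λ { _ refl → xT })
          (λ e → ne (sym e)) λ { v (inj₁ (f , h) , _) → [ inj₁ , (λ w → inj₂ (inj₁ w)) ]′ (cover v f h)
                               ; v (inj₂ b , _) → inj₂ (inj₂ b) })

      E₁ : Gr n
      E₁ = contract E a y

      Fy V₁ : DS n
      Fy = F ∖ ｛ y ｝
      V₁ = Fy ∪ R

      y∉V₁ : y ∉ V₁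
      y∉V₁ (inj₁ (_ , ne)) = ne refl
      y∉V₁ (inj₂ m) = F∩R y y∈F m

      V₁⊆V : V₁ ⊆ V
      V₁⊆V v (inj₁ (f , _)) = inj₁ f
      V₁⊆V v (inj₂ m) = inj₂ m

      V∖y : ∀ v → v ∈ V → v ≢ y → v ∈ V₁
      V∖y v (inj₁ f) ne = inj₁ (f , ne)
      V∖y v (inj₂ m) ne = inj₂ m

      a∈V₁ : a ∈ V₁
      a∈V₁ = inj₂ a∈R

      E⊆E₁ : ∀ {u v} → adj E u v → adj E₁ u v
      E⊆E₁ e = (λ { refl → irr E e }) , inj₁ e

      E₁⊆E : ∀ u v → u ≢ a → v ≢ a → adj E₁ u v → adj E u v
      E₁⊆E u v ne ne′ (_ , inj₁ e) = e
      E₁⊆E u v ne ne′ (_ , inj₂ (inj₁ (e , _))) = contradiction e ne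
      E₁⊆E u v ne ne′ (_ , inj₂ (inj₂ (e , _))) = contradiction e ne′

      ¬link₁ : ¬ Link E₁ Fy R b₁ b₂
      ¬link₁ L₁ = ¬link record
        { A = L₁.A ∪ ｛ y ｝ ; B = L₁.B
        ; A⊆ = λ { v (inj₁ x) → V₁⊆V v (L₁.A⊆ v x) ; _ (inj₂ refl) → inj₁ y∈F }
        ; B⊆ = λ v x → V₁⊆V v (L₁.B⊆ v x)
        ; disj = λ { v (inj₁ x) b → L₁.disj v x b ; _ (inj₂ refl) b → y∉V₁ (L₁.B⊆ y b) }
        ; connA = conn-hub a λ { u (inj₁ x) → reach-map (λ _ → inj₁) edge (L₁.connA u a x a∈A)
                               ; _ (inj₂ refl) → reach-edge (inj₂ refl) (inj₁ a∈A) (symm E a~y) }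
        ; connB = conn-mono (λ u v x x′ → E₁⊆E u v (λ { refl → L₁.disj a a∈A x }) (λ { refl → L₁.disj a a∈A x′ })) L₁.connB
        ; R⊆A = λ v x ne ne′ → inj₁ (L₁.R⊆A v x ne ne′) ; b₁∈B = L₁.b₁∈B ; b₂∈B = L₁.b₂∈B }
        where
        module L₁ = Link L₁
        a∈A : a ∈ L₁.A
        a∈A = L₁.R⊆A a a∈R a≢b₁ a≢b₂
        edge : ∀ u v → u ∈ L₁.A → v ∈ L₁.A → adj E₁ u v → Reach E (L₁.A ∪ ｛ y ｝) u v
        edge u v x x′ (_ , inj₁ e) = reach-edge (inj₁ x) (inj₁ x′) e
        edge u v x x′ (_ , inj₂ (inj₁ (refl , e))) = step (inj₁ x) a~y (reach-edge (inj₂ refl) (inj₁ x′) e)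
        edge u v x x′ (_ , inj₂ (inj₂ (refl , e))) =
          step (inj₁ x) (symm E e) (reach-edge (inj₂ refl) (inj₁ x′) (symm E a~y))

      module Contracted (X : DS n) (P : Piece E₁ Fy X) (x₁ : Fin n) (x₁∈X : x₁ ∈ X) (y~x₁ : adj E y x₁) where
        open Piece P

        X⊆V₁ : X ⊆ V₁
        X⊆V₁ v x = inj₁ (X⊆F v x)
        a∉X : a ∉ X
        a∉X x = a∉F (proj₁ (X⊆F a x))
        y∉X : y ∉ X
        y∉X x = proj₂ (X⊆F y x) refl
        S₁ = N E₁ V₁ X
        Q₁ = quot E₁ V₁ X
        a∈S₁ : a ∈ S₁
        a∈S₁ = a∈V₁ , a∉X , x₁ , x₁∈X , (λ { refl → a∉X x₁∈X }) , inj₂ (inj₂ (refl , y~x₁))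

        -- If X meets T, then A′ and B′ can be rerouted through X.
        reroute : ∀ t → t ∈ X → t ∈ T → ¬ Good E₁ V₁ X
        reroute t tX tT@(_ , _ , z₀ , z₀∈A′ , z₀~t) good
          with lift-cases E₁ V₁ X (B′ ∖ X) cB (b₁∈B , b∉X b₁∈R) (b₂∈B , b∉X b₂∈R)
          where
          b∉X : ∀ {b} → b ∈ R → b ∉ X
          b∉X {b} m x = F∩R b (proj₁ (X⊆F b x)) m
          cB : Conn Q₁ (B′ ∖ X)
          cB = push E₁ V₁ X B′ (λ v x → V∖y v (VH⊆V v (B⊆ v x)) λ { refl → y∉B x }) (conn-mono (λ _ _ _ _ → E⊆E₁) connB)
        -- A route that avoids `X` misses `t`, so it contains `W` and in particular `y`, which is
        -- not in `B′`.
        ... | inj₁ D = y∉B (proj₁ (B*⊆B y (misses-T B* (λ v x → B′⊆Ω v (proj₁ (B*⊆B v x)))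
                (conn-mono (λ u v x x′ → E₁⊆E u v (λ { refl → a∉B* x }) (λ { refl → a∉B* x′ })) connB*)
                b₁∈B* b₂∈B* t tT (λ x → proj₂ (B*⊆B t x) tX) y y∈W)))
          where
          open Direct D
          a∉B* : a ∉ B*
          a∉B* x = a∉VH (B⊆ a (proj₁ (B*⊆B a x)))
        ... | inj₂ Th = ¬link₁ record
                { A = A* ; B = B* ; A⊆ = A*⊆V ; B⊆ = λ v x → [ (λ m → proj₁ (B⊆₁ v m)) , X⊆V₁ v ]′ (B*⊆ v x)
                ; disj = disj* ; connA = connA* ; connB = connB* ; R⊆A = roots ; b₁∈B = b₁∈B* ; b₂∈B = b₂∈B* }
          where
          open Through Th
          A⊆₁ : A′ ∖ X ⊆ V₁ ∖ X
          A⊆₁ v (x , h) = V∖y v (VH⊆V v (A⊆ v x)) (λ { refl → y∉A′ x }) , h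
          B⊆₁ : B′ ∖ X ⊆ V₁ ∖ X
          B⊆₁ v (x , h) = V∖y v (VH⊆V v (B⊆ v x)) (λ { refl → y∉B x }) , h
          cA : Conn Q₁ (A′ ∖ X)
          cA = push E₁ V₁ X A′ (λ v x → V∖y v (VH⊆V v (A⊆ v x)) λ { refl → y∉A′ x }) (conn-mono (λ _ _ _ _ → E⊆E₁) connA)
          lifted = lift-through E₁ V₁ X X⊆V₁ (A′ ∖ X) (B′ ∖ X) A⊆₁ B⊆₁ (λ v (x , _) (x′ , _) → disj v x x′) cA Th
            (good p q p∈S q∈S p≢q)
          open Lifted (proj₁ lifted)
          r∈A′ : r ∈ A′
          r∈A′ = root-in-A′ r r∈R r≢a λ { (inj₁ e) → r≢b₁ e ; (inj₂ e) → r≢b₂ e }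
          -- If the neighbour `z₀` of `t` lies in `X`, a walk in `A′` from `z₀` to the root `r` has
          -- to leave `X`. With such a vertex, `lift-through` puts `a` into `A*`, so that `A*`
          -- contains all the roots it should.
          exit : ∃ λ z → z ∈ A′ ∖ X × z ∈ S₁
          exit with mem? X z₀
          ... | no h = z₀ , (z₀∈A′ , h) , proj₁ (A⊆₁ z₀ (z₀∈A′ , h)) , h , t , tX , E⊆E₁ (symm E z₀~t)
          ... | yes h with reach-exit X (connA z₀ r z₀∈A′ r∈A′) h (λ x → F∩R r (proj₁ (X⊆F r x)) r∈R)
          ...   | x , w , xX , _ , wA′ , w∉X , e =
                  w , (wA′ , w∉X) , proj₁ (A⊆₁ w (wA′ , w∉X)) , w∉X , x , xX , E⊆E₁ e
          a∉B₁ : ∀ {v} → v ∈ B′ ∖ X → a ≢ v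
          a∉B₁ x refl = a∉VH (B⊆ a (proj₁ x))
          a∈A* : a ∈ A*
          a∈A* = proj₁ (proj₂ lifted) (proj₁ exit) (proj₁ (proj₂ exit)) (proj₂ (proj₂ exit)) a a∈S₁
            (a∉B₁ (C₁⊆B p p∈C₁)) (a∉B₁ (C₂⊆B q q∈C₂))
          roots : ∀ v → v ∈ R → v ≢ b₁ → v ≢ b₂ → v ∈ A*
          roots v m ne ne′ with v ≟ a
          ... | yes refl = a∈A*
          ... | no na = A⊆A* v (R⊆A v (m , na) ne ne′ , λ x → F∩R v (proj₁ (X⊆F v x)) m)

        module Thin (away : Disjoint X T) where

          a≢X : ∀ {v} → v ∈ X → v ≢ a
          a≢X x refl = a∉X x

          x₁∉A′ : x₁ ∉ A′
          x₁∉A′ h = no-T-edge y x₁ y∈F y∉A′ y∉T h y~x₁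

          -- `X` is connected and contains `x₁` outside `A′`; it could reach `A′` only through a
          -- vertex of `T`.
          X∩A′ : ∀ x → x ∈ X → x ∉ A′
          X∩A′ x xX h with reach-exit A′ (conn x x₁ xX x₁∈X) h x₁∉A′
          ... | p , q , pA′ , pX , qX , q∉A′ , e =
            away q qX (proj₁ (X⊆F q qX) , q∉A′ , p , pA′ , E₁⊆E p q (a≢X pX) (a≢X qX) e)

          -- By `degree-Ω` there are at most three neighbours in `Ω`. One of them, `z`, is `y` or
          -- already in `Z` and no longer counts; the contraction adds only `a`.
          degree-3 : ∀ Z x z → x ∈ X → (z ≡ y ⊎ z ∈ X × z ∈ Z) → adj E x z → # (nbrs E₁ (V₁ ∖ Z) x) ≤ 3
          degree-3 Z x z xX zZ e = ≤-trans
            (#-⊎ (nbrs E₁ (V₁ ∖ Z) x) (S ∖ ｛ z ｝) ｛ a ｝ part)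
            (≤-trans (≤-reflexive (trans (cong (# (S ∖ ｛ z ｝) +_) (#-single a)) (trans (+-comm _ 1) (#-remove S z zS))))
              (degree-Ω x (proj₁ (X⊆F x xX)) (X∩A′ x xX) (away x xX) (proj₂ (X⊆F x xX))))
            where
            S = nbrs E Ω x
            zS : z ∈ S
            zS = [ (λ { refl → inj₁ (y∈F , y∉A′) }) , (λ (zX , _) → inj₁ (proj₁ (X⊆F z zX) , X∩A′ z zX)) ]′ zZ , e
            part : ∀ v → v ∈ nbrs E₁ (V₁ ∖ Z) x → v ∈ S ∖ ｛ z ｝ ⊎ v ≡ a
            part v ((vV , v∉Z) , d) with v ≟ a
            ... | yes eq = inj₂ eq
            ... | no ne = inj₁ ((VH⊆Ω v (toVH (V₁⊆V v vV)) (λ h → no-T-edge x v (proj₁ (X⊆F x xX)) (X∩A′ x xX) (away x xX) h d′) , d′)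
                               , λ { refl → [ (λ { refl → y∉V₁ vV }) , (λ (_ , m) → v∉Z m) ]′ zZ })
              where
              d′ = E₁⊆E x v (a≢X xX) ne d
              toVH : v ∈ V → v ∈ VH
              toVH (inj₁ f) = inj₁ f
              toVH (inj₂ m) = inj₂ (m , ne)

          -- Grow Z from the neighbours of y until it exhausts X; each new vertex has at
          -- most three neighbours left.
          grow : ∀ fuel Z → Z ⊆ X → # X ≤ fuel + # Z → touching E₁ V₁ Z ≤ 6 * # Z → touching E₁ V₁ X ≤ 6 * # X
          grow fuel Z ZX bound h
            with any? (λ x → mem? (X ∖ Z) x ×-dec any? (λ z → ((z ≟ y) ⊎-dec (mem? X z ×-dec mem? Z z)) ×-dec adj? E x z))
          grow zero Z ZX bound h | yes (x , (xX , x∉Z) , _) = contradiction bound (<⇒≱ (#-strict Z X ZX x xX x∉Z))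
          grow (suc fuel) Z ZX bound h | yes (x , (xX , x∉Z) , z , zZ , e) =
            grow fuel (Z ∪ ｛ x ｝) (λ { v (inj₁ m) → ZX v m ; _ (inj₂ refl) → xX })
              (subst (# X ≤_) (trans (sym (+-suc fuel (# Z))) (cong (fuel +_) (sym (#-insert Z x x∉Z)))) bound)
              (≤-trans (touching-split E₁ V₁ (Z ∪ ｛ x ｝) E₁ V₁ Z E₁ (V₁ ∖ Z) ｛ x ｝ split)
                (≤-trans (+-mono-≤ h (≤-trans (touching-vertex E₁ (V₁ ∖ Z) x) (+-mono-≤ deg deg)))
                  (≤-reflexive (trans (+-comm _ 6) (trans (sym (*-suc 6 (# Z))) (cong (6 *_) (sym (#-insert Z x x∉Z))))))))
            where
            deg = degree-3 Z x z xX zZ e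
            split : ∀ p q → Touch E₁ V₁ (Z ∪ ｛ x ｝) p q → Touch E₁ V₁ Z p q ⊎ Touch E₁ (V₁ ∖ Z) ｛ x ｝ p q
            split p q (m , m′ , d , t) with mem? Z p | mem? Z q
            ... | yes pZ | _ = inj₁ (m , m′ , d , inj₁ pZ)
            ... | no _ | yes qZ = inj₁ (m , m′ , d , inj₂ qZ)
            ... | no p∉ | no q∉ = inj₂ ((m , p∉) , (m′ , q∉) , d
              , [ [ (λ c → contradiction c p∉) , inj₁ ]′ , [ (λ c → contradiction c q∉) , inj₂ ]′ ]′ t)
          grow fuel Z ZX bound h | no none = done (exhausted (⊆-dec X Z))
            where
            exhausted : X ⊆ Z ⊎ (∃ λ v → v ∈ X × v ∉ Z) → X ⊆ Z
            exhausted (inj₁ m) = m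
            exhausted (inj₂ (v , vX , v∉Z)) with mem? Z x₁
            ... | no x₁∉Z = ⊥-elim (none (x₁ , (x₁∈X , x₁∉Z) , y , inj₁ refl , symm E y~x₁))
            ... | yes x₁∈Z with reach-exit Z (conn x₁ v x₁∈X vX) x₁∈Z v∉Z
            ...   | p , q , pZ , pX , qX , q∉Z , e =
                    ⊥-elim (none (q , (qX , q∉Z) , p , inj₂ (pX , pZ) , symm E (E₁⊆E p q (a≢X pX) (a≢X qX) e)))
            done : X ⊆ Z → touching E₁ V₁ X ≤ 6 * # X
            done XZ = ≤-trans (touching-mono E₁ V₁ X E₁ V₁ Z λ { p q (m , m′ , d , t) →
                m , m′ , d , [ (λ c → inj₁ (XZ p c)) , (λ c → inj₂ (XZ q c)) ]′ t })
              (≤-trans h (*-monoʳ-≤ 6 (#-mono Z X ZX)))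

          thin-bound : touching E₁ V₁ X ≤ 2 * (k * # X)
          thin-bound = ≤-trans (grow (# X) ∅ (λ _ ()) (m≤m+n _ _)
              (≤-trans (touching-mono E₁ V₁ ∅ E₁ V₁ ∅ λ _ _ → id) (≤-trans (≤-reflexive none) z≤n)))
            (≤-trans (*-monoˡ-≤ (# X) (*-monoʳ-≤ 2 3≤k)) (≤-reflexive (*-assoc 2 k (# X))))
            where
            none : touching E₁ V₁ ∅ ≡ 0
            none = trans (Sum-cong λ u → trans (Sum-cong λ v →
              ⟦⟧-no (touch? E₁ V₁ ∅ u v) λ { (_ , _ , _ , inj₁ ()) ; (_ , _ , _ , inj₂ ()) }) (Sum-0 n)) (Sum-0 n)

      -- A set not adjacent to `y` looks the same before the contraction, so `no-good` excludes it.
      -- A set adjacent to `y` is not good if it meets `T`, and sparse if it does not.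
      weak : ∀ X → Piece E₁ Fy X → # (N E₁ V₁ X) ≤ k → Good E₁ V₁ X → touching E₁ V₁ X ≤ 2 * (k * # X)
      weak X P small good with any? (λ x → mem? X x ×-dec adj? E y x)
      ... | yes (x₁ , x₁∈X , e) with meets? X T
      ...   | inj₁ (t , tX , tT) = contradiction good (Contracted.reroute X P x₁ x₁∈X e t tX tT)
      ...   | inj₂ away = Contracted.Thin.thin-bound X P x₁ x₁∈X e away
      weak X P small good | no far = contradiction
        (good-transfer E₁ E V₁ V X N₁ N₂ (λ u v _ _ → same u v) good)
        (no-good X (record { x₀ = x₀ ; x₀∈X = x₀∈X ; X⊆F = λ v x → proj₁ (X⊆F v x)
                           ; conn = conn-mono (λ u v x _ → same u v (inj₁ x)) conn })
          (≤-trans (#-mono _ _ N₂) small))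
        where
        open Piece P
        a∉X : a ∉ X
        a∉X x = a∉F (proj₁ (X⊆F a x))
        same : ∀ u v → u ∈ X ⊎ v ∈ X → adj E₁ u v → adj E u v
        same u v _ (_ , inj₁ e) = e
        same u v (inj₁ x) (_ , inj₂ (inj₁ (refl , _))) = contradiction x a∉X
        same u v (inj₁ x) (_ , inj₂ (inj₂ (_ , e))) = ⊥-elim (far (u , x , e))
        same u v (inj₂ x) (_ , inj₂ (inj₁ (_ , e))) = ⊥-elim (far (v , x , e))
        same u v (inj₂ x) (_ , inj₂ (inj₂ (refl , _))) = contradiction x a∉X
        N₁ : N E₁ V₁ X ⊆ N E V X
        N₁ v (m , h , x , xX , e) = V₁⊆V v m , h , x , xX , same x v (inj₁ xX) e
        N₂ : N E V X ⊆ N E₁ V₁ X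
        N₂ v (m , h , x , xX , e) = V∖y v m (λ { refl → far (x , xX , symm E e) }) , h , x , xX , E⊆E₁ e

      contracted-bound : touching E₁ V₁ Fy ≤ 2 * suc (k * # Fy)
      contracted-bound = Bounds.infeasible ih E₁ Fy R b₁ b₂ k
        (≤-trans (+-monoˡ-≤ (# R) (≤-reflexive (#-remove F y y∈F))) size)
        (record { b₁∈R = b₁∈R ; b₂∈R = b₂∈R ; b₁≢b₂ = b₁≢b₂ ; F∩R = λ v (f , _) → F∩R v f })
        #R ¬link₁ weak

      -- Edges from `y` to these vertices reappear at `a` after the contraction. Lost are only `ay`
      -- and at most two edges to `near-y`, since the other roots lie in `A′` and `y` is not in `T`.
      new : DS n
      new = nbrs E (F ∖ W) y

      degree-y : # (nbrs E V y) ≤ 3 + # new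
      degree-y = ≤-trans (#-⊎ (nbrs E V y) (｛ a ｝ ∪ near-y) new part)
        (+-monoˡ-≤ (# new) (≤-trans (#-⊎ (｛ a ｝ ∪ near-y) ｛ a ｝ near-y λ _ → id)
          (+-mono-≤ (≤-reflexive (#-single a)) near-y-small)))
        where
        part : ∀ v → v ∈ nbrs E V y → v ∈ ｛ a ｝ ∪ near-y ⊎ v ∈ new
        part v (inj₁ f , e) with mem? W v
        ... | yes w = inj₁ (inj₂ (inj₁ w , e))
        ... | no ¬w = inj₂ ((f , ¬w) , e)
        part v (inj₂ m , e) with v ≟ a | mem? b's v
        ... | yes eq | _ = inj₁ (inj₁ eq)
        ... | no _ | yes b = inj₁ (inj₂ (inj₂ b , e))
        ... | no ne | no nb = ⊥-elim (no-T-edge y v y∈F y∉A′ y∉T (root-in-A′ v m ne nb) e)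

      bound : touching E V F ≤ 2 * suc (k * # F)
      bound = ≤-trans (touching-remove E V F ｛ y ｝ E V₁ V∖y id)
        (≤-trans (+-monoʳ-≤ (touching E V₁ Fy) (≤-trans (touching-vertex E V y) (+-mono-≤ degree-y degree-y)))
          (arith (touching E V₁ Fy) (# new) (touching E₁ V₁ Fy) k (# Fy) (# F) gain contracted-bound 3≤k (#-remove F y y∈F)))
        where
        row? : ∀ u v → Dec (u ≡ a × v ∈ new)
        row? u v = (u ≟ a) ×-dec mem? new v
        col? : ∀ u v → Dec (v ≡ a × u ∈ new)
        col? u v = (v ≟ a) ×-dec mem? new u
        both? : ∀ u v → Dec ((u ≡ a × v ∈ new) ⊎ (v ≡ a × u ∈ new))
        both? u v = row? u v ⊎-dec col? u v
        a≢F : ∀ {v} → v ∈ F → a ≢ v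
        a≢F f refl = a∉F f
        y≢ : ∀ {v} → v ∈ new → v ≢ y
        y≢ (_ , e) refl = irr E e
        gain : touching E V₁ Fy + (# new + # new) ≤ touching E₁ V₁ Fy
        gain = ≤-trans (+-monoʳ-≤ (touching E V₁ Fy) (≤-trans
            (≤-reflexive (sym (cong₂ _+_ (ΣΣ-row a new) (ΣΣ-col a new))))
            (ΣΣ-disjoint both? row? col? (λ _ _ → inj₁) (λ _ _ → inj₂)
              λ { u v (refl , _) (_ , ((f , _) , _)) → a∉F f })))
          (ΣΣ-disjoint (touch? E₁ V₁ Fy) (touch? E V₁ Fy) both?
            (λ u v (m , m′ , e , t) → m , m′ , E⊆E₁ e , t)
            (λ { u v (inj₁ (refl , w@((f , _) , e))) →
                   a∈V₁ , inj₁ (f , y≢ w) , (a≢F f , inj₂ (inj₁ (refl , e))) , inj₂ (f , y≢ w)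
               ; u v (inj₂ (refl , w@((f , _) , e))) →
                   inj₁ (f , y≢ w) , a∈V₁ , ((λ eq → a≢F f (sym eq)) , inj₂ (inj₂ (refl , e))) , inj₁ (f , y≢ w) })
            λ { u v (_ , _ , e , _) (inj₁ (refl , (f , ¬w) , _)) → ¬w (f , e)
              ; u v (_ , _ , e , _) (inj₂ (refl , (f , ¬w) , _)) → ¬w (f , symm E e) })
        arith : ∀ t w t₁ k f′ f → t + (w + w) ≤ t₁ → t₁ ≤ 2 * suc (k * f′) → 3 ≤ k → suc f′ ≡ f →
          t + ((3 + w) + (3 + w)) ≤ 2 * suc (k * f)
        arith t w t₁ k f′ _ h h′ h″ refl = ≤-trans (≤-reflexive (eq₁ t w))
          (≤-trans (+-mono-≤ (≤-trans h h′) (*-monoʳ-≤ 2 h″)) (≤-reflexive (eq₂ k f′)))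
          where
          eq₁ : ∀ t w → t + ((3 + w) + (3 + w)) ≡ (t + (w + w)) + 6
          eq₁ = solve-∀
          eq₂ : ∀ k f → 2 * suc (k * f) + 2 * k ≡ 2 * suc (k * suc f)
          eq₂ = solve-∀

    -- Some path misses a vertex of T: otherwise the component of y in Ω ∖ T would be
    -- cut off by a and two vertices of T ∪ {b₁, b₂}.
    avoid-T : (∀ B → B ⊆ Ω → Conn E B → b₁ ∈ B → b₂ ∈ B → T ⊆ B) → ⊥
    avoid-T all = no-good C (record { x₀ = y ; x₀∈X = y∈C ; X⊆F = λ v c → proj₁ (CF v c) ; conn = connC })
        (≤-trans small 3≤k) (good-small E V C y∈C connC small)
      where
      open Component (component E ((F ∖ A′) ∖ T) y ((y∈F , y∉A′) , y∉T))
      CF : C ⊆ F ∖ A′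
      CF v c = proj₁ (C⊆Y v c)
      small : # (N E V C) ≤ 3
      small = via (proj₂ (proj₂ (absorb-N E V B′ C connB b₁∈B b₂∈B connC)))
        where
        via : ∀ {p q} → Bridge E B′ B′ C (N E V C) b₁ b₂ p q → # (N E V C) ≤ 3
        via {p} {q} br = #-≤3 (N E V C) a p q λ v m → pick v m (outside C CF (λ v c → proj₂ (C⊆Y v c)) v m)
          where
          open Bridge br
          pick : ∀ v → v ∈ N E V C → v ≡ a ⊎ v ∈ Ω → v ≡ a ⊎ v ≡ p ⊎ v ≡ q
          pick v m (inj₁ eq) = inj₁ eq
          pick v m (inj₂ (inj₂ b)) = inj₂ (only v (b∈Path {D} b₁∈D b₂∈D v b) m)
          pick v m@(_ , v∉C , x , xC , e) (inj₂ (inj₁ f)) with mem? T v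
          ... | yes t = inj₂ (only v (all D (in-Ω B′ C B′ D B′⊆Ω CF B′⊆Ω D⊆) connD b₁∈D b₂∈D v t) m)
          ... | no ¬t = contradiction (closed x v xC (f , ¬t) e) v∉C

    crossing-bound : touching E V F ≤ 2 * suc (k * # F)
    crossing-bound = ≤-stable λ ¬goal → excluded-middle
      (Σ (DS n) λ B → Σ (Fin n) λ t → B ⊆ Ω × Conn E B × b₁ ∈ B × b₂ ∈ B × t ∈ T × t ∉ B) λ
      { (yes (B , t , BΩ , c , b1 , b2 , tT , t∉B)) → ¬goal (Second.bound B BΩ c b1 b2 t tT t∉B)
      ; (no none) → avoid-T λ B BΩ c b1 b2 t tT →
          decidable-stable (mem? B t) λ t∉B → none (B , t , BΩ , c , b1 , b2 , tT , t∉B) }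

  -- Infeasible instances without good sets

  module Irreducible {n : ℕ} {s : ℕ} (ih : Bounds {n} s) (E : Gr n) (F R : DS n) (b₁ b₂ : Fin n) (k : ℕ)
    (size : # F + # R ≤ s) (rts : Roots F R b₁ b₂) (#R : # R ≡ suc k)
    (¬link : ¬ Link E F R b₁ b₂)
    (no-good : ∀ X → Piece E F X → # (N E (F ∪ R) X) ≤ k → ¬ Good E (F ∪ R) X) where

    open Roots rts

    V Ra : DS n
    V = F ∪ R
    Ra = R ∖ ｛ b₁ ｝ ∖ ｛ b₂ ｝

    #Ra : suc (suc (# Ra)) ≡ suc k
    #Ra = trans (cong suc (#-remove (R ∖ ｛ b₁ ｝) b₂ (b₂∈R , λ e → b₁≢b₂ (sym e))))
                (trans (#-remove R b₁ b₁∈R) #R)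

    piece-bound : ∀ X → Piece E F X → # (N E V X) ≤ k → ∀ i → # (N E V X) ≤ suc i →
      touching E V X ≤ 2 * suc (i * # X)
    piece-bound X P small i le = not-good-bound ih E V X x₀ i x₀∈X (λ v x → inj₁ (X⊆F v x)) conn
      (≤-trans (s≤s (+-mono-≤ (#-mono X F X⊆F) small))
        (subst (λ r → r ≤ s) (trans (cong (# F +_) #R) (+-suc (# F) k)) size))
      le (no-good X P small)
      λ X′ P′ less → no-good X′ (record { x₀ = Piece.x₀ P′ ; x₀∈X = Piece.x₀∈X P′
          ; X⊆F = λ v x → X⊆F v (Piece.X⊆F P′ v x) ; conn = Piece.conn P′ }) (≤-trans (<⇒≤ less) small)
      where open Piece P

    missed-root : # Ra ≤ 1 → ∀ f (fF : f ∈ F) b → b ∈ R → b ∉ N E V (Component.C (component E F f fF)) → ⊥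
    missed-root one f fF b bR b∉ = no-good C (record { x₀ = f ; x₀∈X = y∈C ; X⊆F = C⊆Y ; conn = connC }) le
        (good-small E V C y∈C connC (≤-trans le (≤-trans (≤-pred (≤-reflexive (sym #Ra))) (s≤s (≤-trans one (n≤1+n 1))))))
      where
      open Component (component E F f fF)
      inR : ∀ v → v ∈ N E V C → v ∈ R ∖ ｛ b ｝
      inR v m@(inj₁ vF , v∉C , x , xC , e) = contradiction (closed x v xC vF e) v∉C
      inR v m@(inj₂ vR , _) = vR , λ { refl → b∉ m }
      le : # (N E V C) ≤ k
      le = ≤-trans (#-mono _ _ inR) (≤-pred (≤-reflexive (trans (#-remove R b bR) #R)))

    -- With at most one root besides b₁ and b₂, a component of F misses b₁ or b₂, so it
    -- has at most three neighbours and is good.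
    few-roots : # Ra ≤ 1 → ∀ f → f ∈ F → ⊥
    few-roots one f fF with mem? (N E V C) b₁ | mem? (N E V C) b₂
      where open Component (component E F f fF)
    ... | yes (_ , _ , x , xC , e) | yes (_ , _ , x′ , xC′ , e′) = ¬link record
          { A = Ra ; B = ｛ b₁ ｝ ∪ C ∪ ｛ b₂ ｝ ; A⊆ = λ v ((m , _) , _) → inj₂ m
          ; B⊆ = λ { _ (inj₁ refl) → inj₂ b₁∈R ; v (inj₂ (inj₁ c)) → inj₁ (C⊆Y v c)
                   ; _ (inj₂ (inj₂ refl)) → inj₂ b₂∈R }
          ; disj = λ { v ((_ , ne) , _) (inj₁ eq) → ne eq
                     ; v ((m , _) , _) (inj₂ (inj₁ c)) → F∩R v (C⊆Y v c) m
                     ; v (_ , ne) (inj₂ (inj₂ eq)) → ne eq }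
          ; connA = conn-subsingleton E Ra (#-≤1⇒≡ Ra one)
          ; connB = conn-∪ (conn-single E b₁) (conn-∪ connC (conn-single E b₂) xC′ refl (inj₂ e′))
              refl (inj₁ xC) (inj₂ (symm E e))
          ; R⊆A = λ v m ne ne′ → (m , ne) , ne′ ; b₁∈B = inj₁ refl ; b₂∈B = inj₂ (inj₂ refl) }
      where open Component (component E F f fF)
    ... | no b₁∉ | _ = missed-root one f fF b₁ b₁∈R b₁∉
    ... | yes _ | no b₂∉ = missed-root one f fF b₂ b₂∈R b₂∉

    module Delete (a r : Fin n) (a∈Ra : a ∈ Ra) (r∈Ra : r ∈ Ra) (r≢a : r ≢ a) where

      a∈R = proj₁ (proj₁ a∈Ra)
      a≢b₁ = proj₂ (proj₁ a∈Ra)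
      a≢b₂ = proj₂ a∈Ra

      RH W VH : DS n
      RH = R ∖ ｛ a ｝
      W = nbrs E F a
      VH = F ∪ RH

      j : ℕ
      j = # (RH ∖ ｛ b₁ ｝)

      #RH : # RH ≡ k
      #RH = suc-injective (trans (#-remove R a a∈R) #R)

      sucj : suc j ≡ k
      sucj = trans (#-remove RH b₁ (b₁∈R , λ e → a≢b₁ (sym e))) #RH

      3≤k : 3 ≤ k
      3≤k = ≤-pred (≤-trans (s≤s (s≤s (≤-trans (≤-reflexive (sym (cong₂ _+_ (#-single a) (#-single r))))
          (#-disjoint Ra ｛ a ｝ ｛ r ｝ (λ { _ refl → a∈Ra }) (λ { _ refl → r∈Ra }) λ { _ refl eq → r≢a (sym eq) }))))
        (≤-reflexive #Ra))

      a∉F : a ∉ F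
      a∉F f = F∩R a f a∈R

      VH⊆V : VH ⊆ V
      VH⊆V v (inj₁ f) = inj₁ f
      VH⊆V v (inj₂ (m , _)) = inj₂ m

      V∖a : ∀ v → v ∈ V → v ≢ a → v ∈ VH
      V∖a v (inj₁ f) ne = inj₁ f
      V∖a v (inj₂ m) ne = inj₂ (m , ne)

      a∉VH : a ∉ VH
      a∉VH (inj₁ f) = a∉F f
      a∉VH (inj₂ (_ , ne)) = ne refl

      roots-H : Roots F RH b₁ b₂
      roots-H = record { b₁∈R = b₁∈R , (λ e → a≢b₁ (sym e)) ; b₂∈R = b₂∈R , (λ e → a≢b₂ (sym e))
                       ; b₁≢b₂ = b₁≢b₂ ; F∩R = λ v f (m , _) → F∩R v f m }

      size-H : # F + # RH < s
      size-H = ≤-trans (≤-reflexive (trans (sym (+-suc (# F) (# RH))) (cong (# F +_) (#-remove R a a∈R)))) size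

      add-a : touching E V F ≤ touching E VH F + (# W + # W)
      add-a = ≤-trans (ΣΣ-⊎ (touch? E V F) (touch? E VH F) ends? split)
        (+-monoʳ-≤ _ (≤-trans (ΣΣ-⊎ ends? row? col? (λ _ _ → id)) (≤-reflexive (cong₂ _+_ (ΣΣ-row a W) (ΣΣ-col a W)))))
        where
        row? : ∀ u v → Dec (u ≡ a × v ∈ W)
        row? u v = (u ≟ a) ×-dec mem? W v
        col? : ∀ u v → Dec (v ≡ a × u ∈ W)
        col? u v = (v ≟ a) ×-dec mem? W u
        ends? : ∀ u v → Dec ((u ≡ a × v ∈ W) ⊎ (v ≡ a × u ∈ W))
        ends? u v = row? u v ⊎-dec col? u v
        split : ∀ u v → Touch E V F u v → Touch E VH F u v ⊎ ((u ≡ a × v ∈ W) ⊎ (v ≡ a × u ∈ W))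
        split u v (m , m′ , e , t) with u ≟ a | v ≟ a
        ... | no x | no x′ = inj₁ (V∖a u m x , V∖a v m′ x′ , e , t)
        ... | yes refl | _ = inj₂ (inj₁ (refl , [ (λ f → contradiction f a∉F) , id ]′ t , e))
        ... | no _ | yes refl = inj₂ (inj₂ (refl , [ id , (λ f → contradiction f a∉F) ]′ t , symm E e))

      -- A component of `F` has all its neighbours in `RH`, so at most `k`, and is not good. Its
      -- bound `j * # X + 1` is at most `k * # X`.
      isolated : (∀ w → w ∉ W) → touching E V F ≤ 2 * suc (k * # F)
      isolated none = ≤-trans (touching-components E V (2 * k) F λ X x xX X⊆F cX closed →
          let P : Piece E F X
              P = record { x₀ = x ; x₀∈X = xX ; X⊆F = X⊆F ; conn = cX }
              small : # (N E V X) ≤ k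
              small = ≤-trans (#-mono (N E V X) RH (inRH {X} closed X⊆F)) (≤-reflexive #RH)
          in ≤-trans (piece-bound X P small j (≤-trans small (≤-reflexive (sym sucj))))
               (arith (# X) (#-nonempty X x xX)))
        (≤-trans (≤-reflexive (*-assoc 2 k (# F))) (*-monoʳ-≤ 2 (n≤1+n _)))
        where
        inRH : ∀ {X} → (∀ u v → u ∈ X → v ∈ F → adj E u v → v ∈ X) → X ⊆ F → N E V X ⊆ RH
        inRH closed XF v (inj₁ f , v∉X , x , xX , e) = contradiction (closed x v xX f e) v∉X
        inRH closed XF v (inj₂ m , v∉X , x , xX , e) = m , λ { refl → none x (XF x xX , symm E e) }
        arith : ∀ x → 1 ≤ x → 2 * suc (j * x) ≤ 2 * k * x
        arith x h = ≤-trans (*-monoʳ-≤ 2 (+-monoˡ-≤ (j * x) h))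
          (≤-reflexive (trans (sym (*-assoc 2 (suc j) x)) (cong (λ i → 2 * i * x) sucj)))

      -- Deleting `a` lowers the number of edges allowed per free vertex from `k` to `j`, and `a`
      -- has at most one edge to each free vertex.
      infeasible : ¬ Link E F RH b₁ b₂ → touching E V F ≤ 2 * suc (k * # F)
      infeasible ¬L = ≤-trans add-a (≤-trans (+-mono-≤
          (Bounds.infeasible ih E F RH b₁ b₂ j size-H roots-H (trans #RH (sym sucj)) ¬L weak)
          (+-mono-≤ W≤ W≤)) (≤-reflexive (trans (eq j (# F)) (cong (λ i → 2 * suc (i * # F)) sucj))))
        where
        W≤ : # W ≤ # F
        W≤ = #-mono W F λ _ → proj₁
        eq : ∀ j f → 2 * suc (j * f) + (f + f) ≡ 2 * suc (suc j * f)
        eq = solve-∀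
        weak : ∀ X → Piece E F X → # (N E VH X) ≤ j → Good E VH X → touching E VH X ≤ 2 * (j * # X)
        weak X P = delete-vertex-bound E V VH a X j VH⊆V V∖a (inj₂ a∈R) a∉VH (λ v x → inj₁ (Piece.X⊆F P v x))
          (λ near → piece-bound X P (≤-trans near (≤-reflexive sucj)) j near)
          (λ near → no-good X P (≤-trans near (≤-reflexive sucj)))

      -- The term `2 * # W` of the critical bound is twice the number of edges from `a` to `F`, and
      -- `suc j` is `k`. A good set disjoint from `W` does not see `a`, so it would be good in the
      -- presence of `a` as well.
      forced : Link E F RH b₁ b₂ → (∃ λ w → w ∈ W) → ((L : Link E F RH b₁ b₂) → W ⊆ Link.B L) →
        touching E V F ≤ 2 * suc (k * # F)
      forced L₀ w₀ crit = ≤-trans add-a (≤-trans (≤-reflexive (cong (touching E VH F +_) (sym (cong (# W +_) (+-identityʳ _)))))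
        (≤-trans (Bounds.critical ih E F RH b₁ b₂ W j size-H roots-H (trans #RH (sym sucj)) L₀ (λ _ → proj₁) w₀ crit none)
          (≤-reflexive (cong (λ i → 2 * suc (i * # F)) sucj))))
        where
        none : ∀ X → Piece E F X → Disjoint X W → # (N E VH X) ≤ suc j → ¬ Good E VH X
        none X P away small good = no-good X P (≤-trans (#-mono _ _ same) (≤-trans small (≤-reflexive sucj)))
          (good-transfer E E VH V X (λ v (m , h) → VH⊆V v m , h) same (λ _ _ _ _ _ → id) good)
          where
          same : N E V X ⊆ N E VH X
          same v (m , h , x , xX , e) = V∖a v m (λ { refl → away x xX (Piece.X⊆F P x xX , symm E e) }) , h , x , xX , e

      bound : touching E V F ≤ 2 * suc (k * # F)
      bound with any? (mem? W)
      ... | no none = isolated λ w wW → none (w , wW)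
      ... | yes w₀ = ≤-stable λ ¬goal → excluded-middle (Link E F RH b₁ b₂) λ
        { (no ¬L) → ¬goal (infeasible ¬L)
        ; (yes L₀) → excluded-middle (Σ (DS n) Largest) λ
          { (no none) → ¬goal (forced L₀ w₀ λ L w wW → decidable-stable (mem? (Link.B L) w) λ w∉ →
              none (Link.A L , L , refl , w , wW , w∉))
          ; (yes (A , big)) → maximal Largest (# VH) (λ { _ (L , refl , _) → #-mono (Link.A L) VH (Link.A⊆ L) }) A big λ
            { _ (L , refl , y , (yF , e) , y∉B) max → ¬goal (Crossing.crossing-bound ih E F R b₁ b₂ k size rts #R 3≤k
                ¬link no-good a r a∈R a≢b₁ a≢b₂ (proj₁ (proj₁ r∈Ra)) (proj₂ (proj₁ r∈Ra)) (proj₂ r∈Ra) r≢a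
                L y yF e y∉B λ L′ out → max (Link.A L′) (L′ , refl , out)) } } }
        where
        Largest : DS n → Set₁
        Largest A = Σ (Link E F RH b₁ b₂) λ L → Link.A L ≡ A × ∃ λ w → w ∈ W × w ∉ Link.B L

    bound : touching E V F ≤ 2 * suc (k * # F)
    bound with # Ra ≤? 1
    ... | yes one = ≤-trans (touching-components E V 0 F λ X x xX XF _ _ → ⊥-elim (few-roots one x (XF x xX))) z≤n
    ... | no many with #-two Ra many
    ...   | a , r , aRa , rRa , ne = Delete.bound a r aRa rRa ne

  -- A largest good set `X` is replaced by a clique, at a cost of `k * # X` edges by the sparseness
  -- assumption. A good set of the quotient that meets `N E V X` could be merged with `X`, against
  -- maximality; any other was good and sparse before.
  infeasible-step : ∀ {n s} → Bounds {n} s → ∀ E F R b₁ b₂ k → # F + # R ≤ s → InfeasibleBound E F R b₁ b₂ k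
  infeasible-step {n} {s} ih E F R b₁ b₂ k size rts #R ¬link hyp = ≤-stable λ ¬goal →
    excluded-middle (Σ (DS n) Reducible) λ
      { (no none) → ¬goal (Irreducible.bound ih E F R b₁ b₂ k size rts #R ¬link
          λ X P small good → none (X , P , small , good))
      ; (yes (X , red)) → maximal Reducible (# F) (λ Y red → #-mono Y F (Piece.X⊆F (proj₁ red))) X red
          λ Y red max → ¬goal (reduce Y red max) }
    where
    V = F ∪ R
    Reducible : DS n → Set₁
    Reducible X = Piece E F X × # (N E V X) ≤ k × Good E V X
    reduce : ∀ X → Reducible X → (∀ Z → Reducible Z → # Z ≤ # X) → touching E V F ≤ 2 * suc (k * # F)
    reduce X (P , small , good) max = ≤-trans (quot-touching E F R X b₁ b₂ rts X⊆F)
      (≤-trans (+-mono-≤ (Bounds.infeasible ih Q (F ∖ X) R b₁ b₂ k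
          (≤-trans (+-monoˡ-≤ (# R) (#-strict (F ∖ X) F (λ _ → proj₁) x₀ (X⊆F x₀ x₀∈X) λ m → proj₂ m x₀∈X)) size)
          (quot-roots E F R X b₁ b₂ rts X⊆F) #R
          (λ L → ¬link (proj₁ (quot-lift E F R X b₁ b₂ rts X⊆F conn good L))) weak)
          (hyp X P small good))
        (≤-reflexive (trans (eq k (# (F ∖ X)) (# X)) (cong (λ f → 2 * suc (k * f)) (#-∖ F X X⊆F)))))
      where
      open Piece P
      Q = quot E V X
      V′ = (F ∖ X) ∪ R
      V′⊆ = quot-V⊆ E F R X b₁ b₂ rts X⊆F
      ⊆V′ = quot-⊆V E F R X b₁ b₂ rts X⊆F
      X⊆V : X ⊆ V
      X⊆V v x = inj₁ (X⊆F v x)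
      eq : ∀ k f x → 2 * suc (k * f) + 2 * (k * x) ≡ 2 * suc (k * (f + x))
      eq = solve-∀
      weak : ∀ X₁ → Piece Q (F ∖ X) X₁ → # (N Q V′ X₁) ≤ k → Good Q V′ X₁ → touching Q V′ X₁ ≤ 2 * (k * # X₁)
      weak X₁ P₁ small₁ good₁ = cases (meets? X₁ (N E V X))
        where
        module P₁ = Piece P₁
        X₁⊆ : X₁ ⊆ V′
        X₁⊆ v x = inj₁ (P₁.X⊆F v x)
        cases : (∃ λ z → z ∈ X₁ × z ∈ N E V X) ⊎ Disjoint X₁ (N E V X) → touching Q V′ X₁ ≤ 2 * (k * # X₁)
        cases (inj₂ away) = ≤-trans (away-touching E V X X⊆V V′ V′⊆ ⊆V′ X₁ X₁⊆ away)
            (hyp X₁ (record { x₀ = P₁.x₀ ; x₀∈X = P₁.x₀∈X ; X⊆F = λ v x → proj₁ (P₁.X⊆F v x)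
                            ; conn = away-conn E V X X⊆V V′ V′⊆ ⊆V′ X₁ X₁⊆ away P₁.conn })
              (≤-trans (#-mono _ _ (away-N₂ E V X X⊆V V′ V′⊆ ⊆V′ X₁ X₁⊆ away)) small₁)
              (away-good E V X X⊆V V′ V′⊆ ⊆V′ X₁ X₁⊆ away good₁))
        cases (inj₁ (z , zX₁ , zS)) = contradiction
            (max (X ∪ X₁)
              ( record { x₀ = x₀ ; x₀∈X = inj₁ x₀∈X
                       ; X⊆F = λ v → [ X⊆F v , (λ x → proj₁ (P₁.X⊆F v x)) ]′
                       ; conn = merge-conn E V X X⊆V V′ V′⊆ ⊆V′ X₁ X₁⊆ zX₁ zS conn P₁.conn }
              , ≤-trans (#-mono _ _ (merge-N₁ E V X X⊆V V′ V′⊆ ⊆V′ X₁ X₁⊆ zX₁ zS)) small₁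
              , merge-good E V X X⊆V V′ V′⊆ ⊆V′ X₁ X₁⊆ zX₁ zS conn good good₁))
            (<⇒≱ (#-strict X (X ∪ X₁) (λ _ → inj₁) P₁.x₀ (inj₂ P₁.x₀∈X) (proj₂ (P₁.X⊆F P₁.x₀ P₁.x₀∈X))))

  bounds : ∀ {n} s → Bounds {n} s
  bounds zero = record { infeasible = λ _ _ _ _ _ _ () ; critical = λ _ _ _ _ _ _ _ () }
  bounds (suc s) = record
    { infeasible = λ E F R b₁ b₂ k size → infeasible-step (bounds s) E F R b₁ b₂ k (≤-pred size)
    ; critical = λ E F R b₁ b₂ U k size → critical-step (bounds s) E F R b₁ b₂ U k (≤-pred size) }

  -- Collections

  module _ {n : ℕ} where

    ⋃ : (Fin n → DS n) → DS n
    ⋃ X = mkDS (λ v → ∃ λ i → v ∈ X i) (λ v → any? λ i → mem? (X i) v)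

    quot-family : Gr n → DS n → (Fin n → DS n) → Gr n
    quot-family E V X = record
      { adj = λ u v → u ≢ v × (adj E u v ⊎ ∃ λ i → u ∈ N E V (X i) × v ∈ N E V (X i))
      ; adj? = λ u v → ¬? (u ≟ v) ×-dec (adj? E u v ⊎-dec any? λ i → mem? (N E V (X i)) u ×-dec mem? (N E V (X i)) v)
      ; symm = λ { (ne , inj₁ e) → ≢-sym ne , inj₁ (symm E e)
                 ; (ne , inj₂ (i , a , b)) → ≢-sym ne , inj₂ (i , b , a) }
      ; irr = λ { (ne , _) → ne refl } }

    -- A collection is indexed by all vertices: its nonempty members X i satisfy i ∈ X i.
    record Collection (E : Gr n) (F R : DS n) (b₁ b₂ : Fin n) (U : DS n) (k : ℕ) : Set₁ where
      field
        X      : Fin n → DS n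
        X⊆F    : ∀ i → X i ⊆ F
        X∩U    : ∀ i → Disjoint (X i) U
        index  : ∀ i v → v ∈ X i → i ∈ X i
        apart  : ∀ i i′ → i ≢ i′ → ∀ v → v ∈ X i′ → v ∉ X i × v ∉ N E (F ∪ R) (X i)
        small  : ∀ i → # (N E (F ∪ R) (X i)) ≤ k
        -- Keeps the pair `b₁`, `b₂` out of the edges between roots, which later pays for the `+ 1`
        -- in `bound`.
        ¬adj-b : ¬ adj (quot-family E (F ∪ R) X) b₁ b₂
        bound  : touching (quot-family E (F ∪ R) X) ((F ∪ R) ∖ ⋃ X) (F ∖ ⋃ X) + 2 * # U
                 ≤ 2 * suc (k * # (F ∖ ⋃ X))

    module Extend (E : Gr n) (F R : DS n) (b₁ b₂ : Fin n) (U : DS n) (k : ℕ) (rts : Roots F R b₁ b₂)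
      (X₀ : DS n) (P : Piece E F X₀) (X₀∩U : Disjoint X₀ U) (small₀ : # (N E (F ∪ R) X₀) ≤ k)
      (C : Collection (quot E (F ∪ R) X₀) (F ∖ X₀) R b₁ b₂ U k) where

      open Piece P renaming (X⊆F to X₀⊆F)
      open Roots rts
      module C = Collection C

      V V′ S : DS n
      V = F ∪ R
      V′ = (F ∖ X₀) ∪ R
      S = N E V X₀
      Q : Gr n
      Q = quot E V X₀

      X₀⊆V : X₀ ⊆ V
      X₀⊆V v x = inj₁ (X₀⊆F v x)
      V′⊆ = quot-V⊆ E F R X₀ b₁ b₂ rts X₀⊆F
      ⊆V′ = quot-⊆V E F R X₀ b₁ b₂ rts X₀⊆F

      C⊆V′ : ∀ i → C.X i ⊆ V′
      C⊆V′ i v x = inj₁ (C.X⊆F i v x)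

      N-away : ∀ i → Disjoint (C.X i) S → N E V (C.X i) ⊆ N Q V′ (C.X i)
      N-away i away = away-N₂ E V X₀ X₀⊆V V′ V′⊆ ⊆V′ (C.X i) (C⊆V′ i) away

      module _ (X : Fin n → DS n) (⊆₁ : ∀ i v → v ∈ X i → v ∈ X₀ ⊎ v ∈ C.X i)
        (⊆₂ : X₀ ∪ ⋃ C.X ⊆ ⋃ X)
        (Q-nbrs : ∀ i u v → u ∈ N E V (X i) → v ∈ N E V (X i) →
          (u ∈ S × v ∈ S) ⊎ (∃ λ i′ → u ∈ N Q V′ (C.X i′) × v ∈ N Q V′ (C.X i′)))
        (index : ∀ i v → v ∈ X i → i ∈ X i)
        (apart : ∀ i i′ → i ≢ i′ → ∀ v → v ∈ X i′ → v ∉ X i × v ∉ N E V (X i))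
        (small : ∀ i → # (N E V (X i)) ≤ k) where

        -- Only an upper bound is pulled back, so it suffices that forming all cliques at once
        -- yields no more edges than the two successive quotients.
        coarser : ∀ u v → adj (quot-family E V X) u v → adj (quot-family Q V′ C.X) u v
        coarser u v (ne , inj₁ e) = ne , inj₁ (ne , inj₁ e)
        coarser u v (ne , inj₂ (i , a , b)) =
          ne , [ (λ st → inj₁ (ne , inj₂ st)) , inj₂ ]′ (Q-nbrs i u v a b)

        outV : ∀ v → v ∈ V ∖ ⋃ X → v ∈ V′ ∖ ⋃ C.X
        outV v (a , b) = ⊆V′ v (a , λ x → b (⊆₂ v (inj₁ x))) , λ x → b (⊆₂ v (inj₂ x))

        outF₁ : ∀ v → v ∈ F ∖ ⋃ X → v ∈ (F ∖ X₀) ∖ ⋃ C.X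
        outF₁ v (a , b) = (a , λ x → b (⊆₂ v (inj₁ x))) , λ x → b (⊆₂ v (inj₂ x))

        outF₂ : ∀ v → v ∈ (F ∖ X₀) ∖ ⋃ C.X → v ∈ F ∖ ⋃ X
        outF₂ v ((a , b) , c) = a , λ (i , x) → [ b , (λ y → c (i , y)) ]′ (⊆₁ i v x)

        assemble : Collection E F R b₁ b₂ U k
        assemble = record
          { X = X
          ; X⊆F = λ i v x → [ X₀⊆F v , (λ y → proj₁ (C.X⊆F i v y)) ]′ (⊆₁ i v x)
          ; X∩U = λ i v x u → [ (λ y → X₀∩U v y u) , (λ y → C.X∩U i v y u) ]′ (⊆₁ i v x)
          ; index = index ; apart = apart ; small = small
          ; ¬adj-b = λ e → C.¬adj-b (coarser b₁ b₂ e)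
          ; bound = ≤-trans (+-monoˡ-≤ (2 * # U) (touching-mono (quot-family E V X) (V ∖ ⋃ X) (F ∖ ⋃ X) (quot-family Q V′ C.X) (V′ ∖ ⋃ C.X) ((F ∖ X₀) ∖ ⋃ C.X)
                λ u v (a , b , e , t) → outV u a , outV v b , coarser u v e
                  , [ (λ f → inj₁ (outF₁ u f)) , (λ f → inj₂ (outF₁ v f)) ]′ t))
              (≤-trans C.bound (*-monoʳ-≤ 2 (s≤s (*-monoʳ-≤ k (#-mono ((F ∖ X₀) ∖ ⋃ C.X) (F ∖ ⋃ X) outF₂))))) }

      module Add (i₀ : Fin n) (away : ∀ i → i ≢ i₀ → Disjoint (C.X i) S)
        (i₀∈ : i₀ ∈ X₀ ∪ C.X i₀) (small-i₀ : # (N E V (X₀ ∪ C.X i₀)) ≤ k)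
        (Q-nbrs-i₀ : ∀ u v → u ∈ N E V (X₀ ∪ C.X i₀) → v ∈ N E V (X₀ ∪ C.X i₀) →
          (u ∈ S × v ∈ S) ⊎ (∃ λ i → u ∈ N Q V′ (C.X i) × v ∈ N Q V′ (C.X i)))
        (N-i₀ : ∀ i → i ≢ i₀ → ∀ v → v ∈ C.X i → v ∉ N E V (X₀ ∪ C.X i₀)) where

        pick : ∀ i → Dec (i ≡ i₀) → DS n
        pick i (yes _) = X₀ ∪ C.X i₀
        pick i (no _) = C.X i

        X : Fin n → DS n
        X i = pick i (i ≟ i₀)

        ⊆₁ : ∀ i v → v ∈ X i → v ∈ X₀ ⊎ v ∈ C.X i
        ⊆₁ i v x with i ≟ i₀
        ... | yes refl = x
        ... | no _ = inj₂ x

        inX₀ : X₀ ⊆ X i₀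
        inX₀ v x with i₀ ≟ i₀
        ... | yes _ = inj₁ x
        ... | no ne = contradiction refl ne

        inC : ∀ i → C.X i ⊆ X i
        inC i v x with i ≟ i₀
        ... | yes refl = inj₂ x
        ... | no _ = x

        Q-nbrs : ∀ i u v → u ∈ N E V (X i) → v ∈ N E V (X i) →
          (u ∈ S × v ∈ S) ⊎ (∃ λ i′ → u ∈ N Q V′ (C.X i′) × v ∈ N Q V′ (C.X i′))
        Q-nbrs i u v a b with i ≟ i₀
        ... | yes _ = Q-nbrs-i₀ u v a b
        ... | no ne = inj₂ (i , N-away i (away i ne) u a , N-away i (away i ne) v b)

        index : ∀ i v → v ∈ X i → i ∈ X i
        index i v x with i ≟ i₀
        ... | yes refl = i₀∈
        ... | no _ = C.index i v x

        small : ∀ i → # (N E V (X i)) ≤ k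
        small i with i ≟ i₀
        ... | yes _ = small-i₀
        ... | no ne = ≤-trans (#-mono _ _ (N-away i (away i ne))) (C.small i)

        apart : ∀ i i′ → i ≢ i′ → ∀ v → v ∈ X i′ → v ∉ X i × v ∉ N E V (X i)
        apart i i′ ne v x with i ≟ i₀ | i′ ≟ i₀
        ... | yes e | yes e′ = contradiction (trans e (sym e′)) ne
        ... | yes refl | no ni = [ proj₂ (C.X⊆F i′ v x) , proj₁ (C.apart i i′ ne v x) ]′ , N-i₀ i′ ni v x
        ... | no ni | yes refl with x
        ...   | inj₁ y = (λ w → proj₂ (C.X⊆F i v w) y) , λ (_ , _ , w , wC , e) →
                  let wV , w∉X₀ = V′⊆ w (C⊆V′ i w wC) in away i ni w wC (wV , w∉X₀ , v , y , symm E e)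
        ...   | inj₂ y = proj₁ (C.apart i i′ ne v y) , λ m → proj₂ (C.apart i i′ ne v y) (N-away i (away i ni) v m)
        apart i i′ ne v x | no ni | no _ =
          proj₁ (C.apart i i′ ne v x) , λ m → proj₂ (C.apart i i′ ne v x) (N-away i (away i ni) v m)

        result : Collection E F R b₁ b₂ U k
        result = assemble X ⊆₁ (λ v → [ (λ x → i₀ , inX₀ v x) , (λ (i , x) → i , inC i v x) ]′) Q-nbrs index apart small

      -- `C.X x₀` is empty, since by `index` it would otherwise contain `x₀`, which lies in `X₀`; so
      -- the position `x₀` is free.
      new-member : (∀ i → Disjoint (C.X i) S) → Collection E F R b₁ b₂ U k
      new-member away = Add.result x₀ (λ i _ → away i) (inj₁ x₀∈X) (≤-trans (#-mono _ _ nbrs-S) small₀)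
          (λ u v a b → inj₁ (nbrs-S u a , nbrs-S v b)) λ i _ v x m → away i v x (nbrs-S v m)
        where
        nbrs-S : N E V (X₀ ∪ C.X x₀) ⊆ S
        nbrs-S v (a , b , x , inj₁ y , e) = a , b ∘ inj₁ , x , y , e
        nbrs-S v (_ , _ , x , inj₂ y , _) = contradiction x₀∈X (proj₂ (C.X⊆F x₀ x₀ (C.index x₀ x y)))

      -- `S` is a clique of the quotient and members are apart, so no other member meets `S`. By
      -- `merge-N₁`, adding `X₀` does not enlarge the neighbourhood that `C.X i₀` has in the
      -- quotient.
      enlarge-member : ∀ i₀ z → z ∈ C.X i₀ → z ∈ S → Collection E F R b₁ b₂ U k
      enlarge-member i₀ z zC zS = Add.result i₀ away (inj₂ (C.index i₀ z zC)) (≤-trans (#-mono _ _ merged) (C.small i₀))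
          (λ u v a b → inj₂ (i₀ , merged u a , merged v b))
          λ i ne v x m → proj₂ (C.apart i₀ i (≢-sym ne) v x) (merged v m)
        where
        merged : N E V (X₀ ∪ C.X i₀) ⊆ N Q V′ (C.X i₀)
        merged = merge-N₁ E V X₀ X₀⊆V V′ V′⊆ ⊆V′ (C.X i₀) (C⊆V′ i₀) zC zS
        away : ∀ i → i ≢ i₀ → Disjoint (C.X i) S
        away i ne s sC sS with C.apart i₀ i (≢-sym ne) s sC
        ... | s∉ , s∉N = s∉N (C⊆V′ i s sC , s∉ , z , zC , (λ { refl → s∉ zC }) , inj₂ (zS , sS))

      extend : Collection E F R b₁ b₂ U k
      extend with any? (λ i → any? (λ z → mem? (C.X i) z ×-dec mem? S z))
      ... | yes (i , z , zC , zS) = enlarge-member i z zC zS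
      ... | no none = new-member λ i z zC zS → none (i , z , zC , zS)

    -- Good sets disjoint from `U` are taken out one at a time until the critical bound applies;
    -- `quot-push` and `quot-lift` preserve feasibility and criticality. The double negation is
    -- there because the existence of such a set is not decided.
    collection : ∀ fuel E F R b₁ b₂ U j → # F ≤ fuel → Roots F R b₁ b₂ → # R ≡ suc j → Link E F R b₁ b₂ →
      U ⊆ F → (∃ λ u → u ∈ U) → ((L : Link E F R b₁ b₂) → U ⊆ Link.B L) →
      (Collection E F R b₁ b₂ U (suc j) → ⊥) → ⊥
    collection fuel E F R b₁ b₂ U j size rts #R L₀ U⊆F u₀ crit done =
      excluded-middle (Σ (DS n) λ X → Piece E F X × Disjoint X U × # (N E V X) ≤ suc j × Good E V X) λ
        { (no none) → done (base λ X P away small good → none (X , P , away , small , good))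
        ; (yes (X , P , away , small , good)) → reduce fuel X P away small good size }
      where
      V = F ∪ R
      open Roots rts
      nothing : Fin n → DS n
      nothing _ = ∅
      base : (∀ X → Piece E F X → Disjoint X U → # (N E V X) ≤ suc j → ¬ Good E V X) → Collection E F R b₁ b₂ U (suc j)
      base no-good = record
        { X = nothing ; X⊆F = λ _ _ () ; X∩U = λ _ _ () ; index = λ _ _ () ; apart = λ _ _ _ _ ()
        ; small = λ _ → ≤-trans (≤-reflexive (#-empty (N E V ∅) λ { _ (_ , _ , _ , () , _) })) z≤n
        ; ¬adj-b = ¬adj
        ; bound = ≤-trans (+-monoˡ-≤ (2 * # U) (touching-mono (quot-family E V nothing) (V ∖ ⋃ nothing) (F ∖ ⋃ nothing) E V F
              λ { u v ((a , _) , (b , _) , (_ , inj₁ e) , t) → a , b , e , [ (λ f → inj₁ (proj₁ f)) , (λ f → inj₂ (proj₁ f)) ]′ t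
                ; u v (_ , _ , (_ , inj₂ (_ , (_ , _ , _ , () , _) , _)) , _) }))
            (≤-trans (Bounds.critical (bounds (suc (# F + # R))) E F R b₁ b₂ U j ≤-refl rts #R L₀ U⊆F u₀ crit no-good)
              (*-monoʳ-≤ 2 (s≤s (*-monoʳ-≤ (suc j) (#-mono F (F ∖ ⋃ nothing) λ v f → f , λ ()))))) }
        where
        ¬adj : ¬ adj (quot-family E V nothing) b₁ b₂
        ¬adj (_ , inj₂ (_ , (_ , _ , _ , () , _) , _))
        ¬adj (_ , inj₁ e) = [ (λ { refl → F∩R _ (U⊆F _ (proj₂ u₀)) b₁∈R }) , (λ { refl → F∩R _ (U⊆F _ (proj₂ u₀)) b₂∈R }) ]′
          (crit record
            { A = A ; B = ｛ b₁ ｝ ∪ ｛ b₂ ｝ ; A⊆ = A⊆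
            ; B⊆ = λ { _ (inj₁ refl) → inj₂ b₁∈R ; _ (inj₂ refl) → inj₂ b₂∈R }
            ; disj = λ { _ a (inj₁ refl) → disj _ a b₁∈B ; _ a (inj₂ refl) → disj _ a b₂∈B }
            ; connA = connA
            ; connB = conn-∪ (conn-single E b₁) (conn-single E b₂) refl refl (inj₂ e)
            ; R⊆A = R⊆A ; b₁∈B = inj₁ refl ; b₂∈B = inj₂ refl } (proj₁ u₀) (proj₂ u₀))
          where open Link L₀
      reduce : ∀ fuel X → Piece E F X → Disjoint X U → # (N E V X) ≤ suc j → Good E V X → # F ≤ fuel → ⊥
      reduce zero X P away small good size =
        contradiction (≤-trans (#-nonempty F _ (Piece.X⊆F P _ (Piece.x₀∈X P))) size) λ ()
      reduce (suc fuel) X P away small good size =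
        collection fuel (quot E V X) (F ∖ X) R b₁ b₂ U j
          (≤-pred (≤-trans (#-strict (F ∖ X) F (λ _ → proj₁) x₀ (X⊆F x₀ x₀∈X) λ m → proj₂ m x₀∈X) size))
          (quot-roots E F R X b₁ b₂ rts X⊆F) #R (quot-push E F R X b₁ b₂ rts X⊆F L₀)
          (λ v u → U⊆F v u , λ x → away v x u) u₀
          (λ L v u → [ id , (λ x → ⊥-elim (away v x u)) ]′
            (proj₂ (quot-lift E F R X b₁ b₂ rts X⊆F conn good L) v (crit (proj₁ (quot-lift E F R X b₁ b₂ rts X⊆F conn good L)) v u)))
          λ C → done (Extend.extend E F R b₁ b₂ U (suc j) rts X P away small C)
        where open Piece P

  -- Path linkages and Boolean adjacency

  ∨-true : ∀ x {y} → x ∨ y ≡ true → x ≡ true ⊎ y ≡ true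
  ∨-true true  _ = inj₁ refl
  ∨-true false e = inj₂ e

  ∨-trueˡ : ∀ {x} y → x ≡ true → x ∨ y ≡ true
  ∨-trueˡ y refl = refl

  ∨-trueʳ : ∀ x {y} → y ≡ true → x ∨ y ≡ true
  ∨-trueʳ x refl = Bool.∨-zeroʳ x

  ∧-true : ∀ x {y} → x ∧ y ≡ true → x ≡ true × y ≡ true
  ∧-true true e = refl , e

  true-∧ : ∀ {x y} → x ≡ true → y ≡ true → x ∧ y ≡ true
  true-∧ refl refl = refl

  not-true : ∀ {x} → not x ≡ true → ¬ x ≡ true
  not-true {true} () _

  true-not : ∀ {x} → ¬ x ≡ true → not x ≡ true
  true-not {true}  h = contradiction refl h
  true-not {false} h = refl

  ⌊⌋-true : ∀ {P : Set} (d : Dec P) → ⌊ d ⌋ ≡ true → P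
  ⌊⌋-true (yes p) _ = p

  true-⌊⌋ : ∀ {P : Set} (d : Dec P) → P → ⌊ d ⌋ ≡ true
  true-⌊⌋ (yes _) _ = refl
  true-⌊⌋ (no ¬p) p = contradiction p ¬p

  any-true : ∀ {k} (p : Fin k → Bool) → Bool.any p (allFin k) ≡ true → ∃ λ i → p i ≡ true
  any-true p e = go p (subst (λ l → Bool.or l ≡ true) (map-tabulate id p) e)
    where
    go : ∀ {k} (p : Fin k → Bool) → Bool.or (List.tabulate p) ≡ true → ∃ λ i → p i ≡ true
    go {suc k} p e with ∨-true (p zero) e
    ... | inj₁ h = zero , h
    ... | inj₂ h with go (p ∘ suc) h
    ...   | i , q = suc i , q

  true-any : ∀ {k} (p : Fin k → Bool) i → p i ≡ true → Bool.any p (allFin k) ≡ true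
  true-any p i e = subst (λ l → Bool.or l ≡ true) (sym (map-tabulate id p)) (go p i e)
    where
    go : ∀ {k} (p : Fin k → Bool) i → p i ≡ true → Bool.or (List.tabulate p) ≡ true
    go p zero e = ∨-trueˡ _ e
    go p (suc i) e = ∨-trueʳ (p zero) (go (p ∘ suc) i e)

  sum-allFin : ∀ {n} (f : Fin n → ℕ) → Nat.sum (map f (allFin n)) ≡ Sum f
  sum-allFin f = trans (cong Nat.sum (map-tabulate id f)) (go f)
    where
    go : ∀ {n} (f : Fin n → ℕ) → Nat.sum (List.tabulate f) ≡ Sum f
    go {zero} f = refl
    go {suc n} f = cong (f zero +_) (go (f ∘ suc))

  module _ {n : ℕ} where

    ofSubset : Subset n → DS n
    ofSubset S = mkDS (λ v → lookup S v ≡ true) (λ v → lookup S v Bool.≟ true)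

    toSubset : DS n → Subset n
    toSubset S = tabulate (λ v → ⌊ mem? S v ⌋)

    ∈-toSubset : ∀ S v → v ∈ S → lookup (toSubset S) v ≡ true
    ∈-toSubset S v s = trans (lookup∘tabulate _ v) (true-⌊⌋ (mem? S v) s)

    toSubset-∈ : ∀ S v → lookup (toSubset S) v ≡ true → v ∈ S
    toSubset-∈ S v e = ⌊⌋-true (mem? S v) (trans (sym (lookup∘tabulate _ v)) e)

  ∣∣-# : ∀ {n} (S : Subset n) → ∣ S ∣ ≡ # (ofSubset S)
  ∣∣-# [] = refl
  ∣∣-# (true ∷ S) = cong suc (∣∣-# S)
  ∣∣-# (false ∷ S) = ∣∣-# S

  image : ∀ {m n} → (Fin m → Fin n) → DS n
  image f = mkDS (λ v → ∃ λ i → f i ≡ v) (λ v → any? λ i → f i ≟ v)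

  #-image : ∀ {m n} (f : Fin m → Fin n) → (∀ i j → f i ≡ f j → i ≡ j) → # (image f) ≡ m
  #-image {zero} f inj = #-empty (image f) λ { v (() , _) }
  #-image {suc m} f inj = trans
    (#-cong (image f) (image (f ∘ suc) ∪ ｛ f zero ｝)
      (λ { v (zero , e) → inj₂ (sym e) ; v (suc i , e) → inj₁ (i , e) })
      (λ { v (inj₁ (i , e)) → suc i , e ; v (inj₂ e) → zero , sym e }))
    (trans (#-insert (image (f ∘ suc)) (f zero) λ { (i , e) → contradiction (inj _ _ e) λ () })
      (cong suc (#-image (f ∘ suc) λ i j e → suc-inj (inj _ _ e))))
    where
    suc-inj : ∀ {k} {i j : Fin k} → Fin.suc i ≡ suc j → i ≡ j
    suc-inj refl = refl

  any-vec? : ∀ {A : Set} → (∀ {P : A → Set} → (∀ x → Dec (P x)) → Dec (∃ P)) →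
    ∀ l {P : Vec A l → Set} → (∀ v → Dec (P v)) → Dec (∃ P)
  any-vec? search zero P? = map′ ([] ,_) (λ { ([] , p) → p }) (P? [])
  any-vec? search (suc l) P? = map′ (λ { (x , xs , p) → x ∷ xs , p }) (λ { (x ∷ xs , p) → x , xs , p })
    (search λ x → any-vec? search l λ xs → P? (x ∷ xs))

  -- Rooted graphs as instances

  module Translation {m n : ℕ} (Rt : D.Rooted m n) where

    b₁ b₂ : Fin n
    b₁ = D.b₁ Rt
    b₂ = D.b₂ Rt
    a : Fin m → Fin n
    a = D.a Rt

    E : Gr n
    E = record
      { adj = λ u v → D.adj (D.G Rt) u v ≡ true
      ; adj? = λ u v → D.adj (D.G Rt) u v Bool.≟ true
      ; symm = λ {u} {v} e → trans (D.sym (D.G Rt) v u) e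
      ; irr = λ {v} e → contradiction (trans (sym e) (D.irrefl (D.G Rt) v)) λ () }

    R F V : DS n
    R = mkDS (λ v → D.isRoot Rt v ≡ true) (λ v → D.isRoot Rt v Bool.≟ true)
    F = mkDS (λ v → ¬ D.isRoot Rt v ≡ true) (λ v → ¬? (D.isRoot Rt v Bool.≟ true))
    V = F ∪ R

    everything : ∀ v → v ∈ V
    everything v with D.isRoot Rt v Bool.≟ true
    ... | yes r = inj₂ r
    ... | no ¬r = inj₁ ¬r

    root-cases : ∀ v → v ∈ R → (∃ λ i → a i ≡ v) ⊎ v ≡ b₁ ⊎ v ≡ b₂
    root-cases v r with ∨-true (D.isA Rt v) r
    ... | inj₁ h = let i , e = any-true _ h in inj₁ (i , ⌊⌋-true (a i ≟ v) e)
    ... | inj₂ h with ∨-true ⌊ v ≟ b₁ ⌋ h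
    ...   | inj₁ e = inj₂ (inj₁ (⌊⌋-true (v ≟ b₁) e))
    ...   | inj₂ e = inj₂ (inj₂ (⌊⌋-true (v ≟ b₂) e))

    a∈R : ∀ i → a i ∈ R
    a∈R i = ∨-trueˡ _ (true-any _ i (true-⌊⌋ (a i ≟ a i) refl))

    b₁∈R : b₁ ∈ R
    b₁∈R = ∨-trueʳ (D.isA Rt b₁) (∨-trueˡ _ (true-⌊⌋ (b₁ ≟ b₁) refl))

    b₂∈R : b₂ ∈ R
    b₂∈R = ∨-trueʳ (D.isA Rt b₂) (∨-trueʳ ⌊ b₂ ≟ b₁ ⌋ (true-⌊⌋ (b₂ ≟ b₂) refl))

    roots : Roots F R b₁ b₂
    roots = record { b₁∈R = b₁∈R ; b₂∈R = b₂∈R ; b₁≢b₂ = D.b₁≢b₂ Rt ; F∩R = λ v f r → f r }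

    #R : # R ≡ suc (suc m)
    #R = trans (#-cong R ((image a ∪ ｛ b₁ ｝) ∪ ｛ b₂ ｝)
        (λ v r → [ (λ i → inj₁ (inj₁ i)) , [ (λ e → inj₁ (inj₂ e)) , inj₂ ]′ ]′ (root-cases v r))
        (λ { v (inj₁ (inj₁ (i , refl))) → a∈R i ; _ (inj₁ (inj₂ refl)) → b₁∈R ; _ (inj₂ refl) → b₂∈R }))
      (trans (#-insert (image a ∪ ｛ b₁ ｝) b₂ λ { (inj₁ (i , e)) → D.a≢b₂ Rt i e ; (inj₂ e) → D.b₁≢b₂ Rt (sym e) })
        (cong suc (trans (#-insert (image a) b₁ λ { (i , e) → D.a≢b₁ Rt i e })
          (cong suc (#-image a (D.a-inj Rt))))))

    Chain : List (Fin n) → Set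
    Chain = D.Chain (D.G Rt)

    chain-reach : ∀ (S : DS n) x xs → Chain (x ∷ xs) → (∀ w → w List.∈ (x ∷ xs) → w ∈ S) →
      ∀ w → w List.∈ (x ∷ xs) → Reach E S x w
    chain-reach S x xs c inS w (here refl) = here (inS w (here refl))
    chain-reach S x (y ∷ xs) (D.cons e c) inS w (there p) =
      step (inS x (here refl)) e (chain-reach S y xs c (λ w q → inS w (there q)) w p)

    last-∈ : ∀ (xs : List (Fin n)) {v} → last xs ≡ just v → v List.∈ xs
    last-∈ (x ∷ []) refl = here refl
    last-∈ (x ∷ y ∷ xs) e = there (last-∈ (y ∷ xs) e)

    walk-reach : ∀ (S : DS n) u v xs → D.IsWalk (D.G Rt) u v xs → (∀ w → w List.∈ xs → w ∈ S) → Reach E S u v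
    walk-reach S u v (x ∷ xs) (c , refl , e) inS = chain-reach S x xs c inS v (last-∈ (x ∷ xs) e)

    record Path (S : DS n) (u v : Fin n) : Set where
      field
        list   : List (Fin n)
        chain  : Chain list
        start  : head list ≡ just u
        end    : last list ≡ just v
        unique : Unique list
        inside : ∀ w → w List.∈ list → w ∈ S

    suffix : ∀ {S v} u xs → Chain xs → last xs ≡ just v → Unique xs → (∀ w → w List.∈ xs → w ∈ S) →
      u List.∈ xs → Path S u v
    suffix u (x ∷ xs) c e un inS (here refl) = record
      { list = x ∷ xs ; chain = c ; start = refl ; end = e ; unique = un ; inside = inS }
    suffix u (x ∷ y ∷ xs) (D.cons _ c) e (_ ∷ un) inS (there p) =
      suffix u (y ∷ xs) c e un (λ w q → inS w (there q)) p

    reach-path : ∀ {S u v} → Reach E S u v → Path S u v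
    reach-path {u = u} (here s) = record
      { list = u ∷ [] ; chain = D.one u ; start = refl ; end = refl ; unique = [] ∷ []
      ; inside = λ { _ (here refl) → s } }
    reach-path {S} {u} {v} (step {w = w} s e r) with reach-path r
    ... | P with list-∈? _≟_ u (Path.list P)
    ...   | yes p = suffix u (Path.list P) (Path.chain P) (Path.end P) (Path.unique P) (Path.inside P) p
    ...   | no ∉P = extend (Path.list P) (Path.chain P) (Path.start P) (Path.end P) (Path.unique P) (Path.inside P) ∉P
      where
      extend : ∀ xs → Chain xs → head xs ≡ just w → last xs ≡ just v → Unique xs →
        (∀ w → w List.∈ xs → w ∈ S) → ¬ u List.∈ xs → Path S u v
      extend (x ∷ xs) c refl l un inS u∉ = record
        { list = u ∷ x ∷ xs ; chain = D.cons e c ; start = refl ; end = l ; unique = All.¬Any⇒All¬ _ u∉ ∷ un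
        ; inside = λ { _ (here refl) → s ; w (there p) → inS w p } }

    ∈ₛ : ∀ {S : Subset n} {v} → lookup S v ≡ true → v Subset.∈ S
    ∈ₛ e = lookup⇒[]= _ _ e

    to-link : ∀ A B → D.LinkagePair Rt A B → Link E F R b₁ b₂
    to-link A B (cA , aA , (walk@(c , _ , _) , _) , disj) = record
      { A = ofSubset A ; B = onB ; A⊆ = λ v _ → everything v ; B⊆ = λ v _ → everything v
      ; disj = λ v x y → disj v (∈ₛ x) y
      ; connA = λ u v x y → let xs , w , inA = cA u v (∈ₛ x) (∈ₛ y) in
          walk-reach (ofSubset A) u v xs w λ w p → []=⇒lookup (inA w p)
      ; connB = connected-list B c
      ; R⊆A = λ v r ne ne′ → [ (λ { (i , refl) → []=⇒lookup (aA i) })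
          , [ (λ e → contradiction e ne) , (λ e → contradiction e ne′) ]′ ]′ (root-cases v r)
      ; b₁∈B = first B walk ; b₂∈B = last-∈ B (proj₂ (proj₂ walk)) }
      where
      onB : DS n
      onB = mkDS (λ v → v List.∈ B) (λ v → list-∈? _≟_ v B)
      first : ∀ B → D.IsWalk (D.G Rt) b₁ b₂ B → b₁ List.∈ B
      first (x ∷ B) (_ , refl , _) = here refl
      connected-list : ∀ B → Chain B → Conn E (mkDS (λ v → v List.∈ B) (λ v → list-∈? _≟_ v B))
      connected-list [] c u v () _
      connected-list (x ∷ xs) c = conn-hub x λ u p → reach-sym (chain-reach _ x xs c (λ _ q → q) u p)

    -- The last clause lets criticality, which speaks of paths, force `U` into the connected set
    -- `Link.B L`.
    from-link : (L : Link E F R b₁ b₂) →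
      ∃ λ A → ∃ λ B → D.LinkagePair Rt A B × (∀ v → v List.∈ B → v ∈ Link.B L)
    from-link L = toSubset A , list , (conn-A , inA , ((chain , start , end) , unique) , apart) , inside
      where
      open Link L
      open Path (reach-path (connB b₁ b₂ b₁∈B b₂∈B))
      fromA : ∀ v → v Subset.∈ toSubset A → v ∈ A
      fromA v p = toSubset-∈ A v ([]=⇒lookup p)
      conn-A : D.Connected (D.G Rt) (toSubset A)
      conn-A u v p q = let P = reach-path (connA u v (fromA u p) (fromA v q)) in
        Path.list P , (Path.chain P , Path.start P , Path.end P) , λ w x → ∈ₛ (∈-toSubset A w (Path.inside P w x))
      inA : ∀ i → a i Subset.∈ toSubset A
      inA i = ∈ₛ (∈-toSubset A (a i) (R⊆A (a i) (a∈R i) (D.a≢b₁ Rt i) (D.a≢b₂ Rt i)))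
      apart : ∀ v → v Subset.∈ toSubset A → ¬ v List.∈ list
      apart v p q = disj v (fromA v p) (inside v q)

    nbhd-∈ : ∀ X v → lookup (D.nbhd (D.G Rt) X) v ≡ true → v ∈ N E V (ofSubset X)
    nbhd-∈ X v e with ∧-true (not (lookup X v)) (trans (sym (lookup∘tabulate _ v)) e)
    ... | out , h with any-true _ h
    ...   | u , g with ∧-true (lookup X u) g
    ...     | uX , d = everything v , not-true out , u , uX , d

    N-cong : ∀ X Y → X ⊆ Y → Y ⊆ X → N E V X ⊆ N E V Y
    N-cong X Y h g v (p , q , x , xX , e) = p , (λ y → q (g v y)) , x , h x xX , e

    quotVerts-out : ∀ {k} (X : Fin k → Subset n) v → D.mem (D.quotVerts X) v ≡ true → ∀ i → ¬ lookup (X i) v ≡ true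
    quotVerts-out X v e i h = not-true (trans (sym (lookup-map v not (D.unionC X))) e)
      (trans (lookup∘tabulate _ v) (true-any _ i h))

    out-quotVerts : ∀ {k} (X : Fin k → Subset n) v → (∀ i → ¬ lookup (X i) v ≡ true) → D.mem (D.quotVerts X) v ≡ true
    out-quotVerts X v h = trans (lookup-map v not (D.unionC X)) (true-not λ e →
      let i , g = any-true _ (trans (sym (lookup∘tabulate _ v)) e) in h i g)

    -- Each counted pair has `u < v` and yields two ordered pairs. `rootedQuotAdj` may relate a
    -- vertex to itself, hence the hypothesis asks for nothing on the diagonal.
    countPairs-bound : ∀ (p : Fin n → Fin n → Bool) {Q : Fin n → Fin n → Set} (q : ∀ u v → Dec (Q u v)) →
      (∀ u v → u ≢ v → p u v ≡ true → Q u v) → (∀ u v → Q u v → Q v u) → 2 * D.countPairs p ≤ ΣΣ q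
    countPairs-bound p {Q} q h symQ = ≤-trans
      (≤-trans (≤-reflexive (cong (D.countPairs p +_) (+-identityʳ _)))
        (+-mono-≤ count≤ (≤-trans count≤ swap)))
      (ΣΣ-disjoint q below? above? (λ _ _ → proj₂) (λ _ _ → proj₂) λ u v (x , _) (y , _) → <-asym x y)
      where
      below? : ∀ u v → Dec (toℕ u < toℕ v × Q u v)
      below? u v = (toℕ u <? toℕ v) ×-dec q u v
      above? : ∀ u v → Dec (toℕ v < toℕ u × Q u v)
      above? u v = (toℕ v <? toℕ u) ×-dec q u v
      summand : Fin n → Fin n → ℕ
      summand u v = if ⌊ toℕ u <? toℕ v ⌋ ∧ p u v then 1 else 0
      entry : ∀ u v → summand u v ≤ ⟦ below? u v ⟧
      entry u v with ⌊ toℕ u <? toℕ v ⌋ ∧ p u v in e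
      ... | false = z≤n
      ... | true = let l , r = ∧-true ⌊ toℕ u <? toℕ v ⌋ e
                       less = ⌊⌋-true (toℕ u <? toℕ v) l in
        ≤-reflexive (sym (⟦⟧-yes (below? u v) (less , h u v (λ { refl → <-irrefl refl less }) r)))
      count≤ : D.countPairs p ≤ ΣΣ below?
      count≤ = ≤-trans (≤-reflexive (trans (sum-allFin λ u → Nat.sum (map (summand u) (allFin n)))
                                         (Sum-cong λ u → sum-allFin (summand u))))
        (Sum-mono λ u → Sum-mono λ v → entry u v)
      swap : ΣΣ below? ≤ ΣΣ above?
      swap = ≤-trans (≤-reflexive (Sum-swap (λ u v → ⟦ below? u v ⟧)))
        (ΣΣ-mono (λ v u → below? u v) above? λ v u (l , x) → l , symQ u v x)

    distinct-roots? : ∀ u v → Dec (u ∈ R × v ∈ R ∖ ｛ u ｝)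
    distinct-roots? u v = mem? R u ×-dec mem? (R ∖ ｛ u ｝) v

    distinct-roots : ΣΣ distinct-roots? ≤ suc m * suc (suc m)
    distinct-roots = ≤-trans (ΣΣ-rows distinct-roots? R (suc m) (λ _ _ → proj₁)
        λ u r → ≤-trans (#-mono (mkDS _ (distinct-roots? u)) (R ∖ ｛ u ｝) λ _ → proj₂)
          (≤-pred (≤-reflexive (trans (#-remove R u r) #R))))
      (≤-reflexive (cong (suc m *_) #R))

    module _ (U : Subset n) (U-free : ∀ v → v Subset.∈ U → ¬ v Subset.∈ D.rootSet Rt) where

      Us : DS n
      Us = ofSubset U

      U⊆F : Us ⊆ F
      U⊆F v u r = U-free v (∈ₛ u) (∈ₛ (trans (lookup∘tabulate _ v) r))

      Conclusion : ∀ k → (Fin k → Subset n) → Set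
      Conclusion k X = D.IsCollection {n} {k} (D.G Rt) (D.rootSet Rt Subset.∪ U) X ×
        (∀ i → ∣ D.nbhd (D.G Rt) (X i) ∣ ≤ m + 2) ×
        (2 * D.eRootedQuot Rt X + m * m + 5 * m + 6 + 2 * ∣ U ∣ ≤ 2 * ((m + 2) * D.vQuot X))

      avoids : ∀ X → ofSubset X ⊆ F → Disjoint (ofSubset X) Us →
        ∀ v → v Subset.∈ X → ¬ v Subset.∈ (D.rootSet Rt Subset.∪ U)
      avoids X XF XU v p q with Subset.x∈p∪q⁻ (D.rootSet Rt) U q
      ... | inj₁ r = XF v ([]=⇒lookup p) (trans (sym (lookup∘tabulate _ v)) ([]=⇒lookup r))
      ... | inj₂ u = XU v ([]=⇒lookup p) ([]=⇒lookup u)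

      nbhd-small : ∀ X → # (N E V (ofSubset X)) ≤ suc (suc m) → ∣ D.nbhd (D.G Rt) X ∣ ≤ m + 2
      nbhd-small X h = ≤-trans (≤-reflexive (∣∣-# (D.nbhd (D.G Rt) X)))
        (≤-trans (#-mono _ _ (nbhd-∈ X)) (≤-trans h (≤-reflexive (+-comm 2 m))))

      -- With nothing forced, all of `F` can be the only member. Just the `m + 2` roots remain, and
      -- the inequality holds, with equality, even for the complete graph on them.
      no-U : (∀ v → v ∉ Us) → ∃ λ k → ∃ λ X → Conclusion k X
      no-U none = 1 , X , ((λ _ → avoids (toSubset F) (toSubset-∈ F) λ v _ → none v)
          , λ { zero zero ne → contradiction refl ne }) , (λ _ → nbhd-small (toSubset F) small) , bound
        where
        X : Fin 1 → Subset n
        X _ = toSubset F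
        small : # (N E V (ofSubset (toSubset F))) ≤ suc (suc m)
        small = ≤-trans (#-mono _ R λ v (p , q , _) → [ (λ f → contradiction (∈-toSubset F v f) q) , id ]′ p)
          (≤-reflexive #R)
        root : ∀ v → D.mem (D.quotVerts X) v ≡ true → v ∈ R
        root v e = [ (λ f → contradiction (∈-toSubset F v f) (quotVerts-out X v e zero)) , id ]′ (everything v)
        ends : ∀ u v → D.rootedQuotAdj Rt X u v ≡ true → u ∈ R × v ∈ R
        ends u v e with ∨-true (D.quotAdj (D.G Rt) X u v) e
        ... | inj₁ h = let x , h′ = ∧-true (D.mem (D.quotVerts X) u) h in
                       root u x , root v (proj₁ (∧-true (D.mem (D.quotVerts X) v) h′))
        ... | inj₂ h = let x , h′ = ∧-true (D.mem (D.quotVerts X) u) h in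
                       root u x , root v (proj₁ (∧-true (D.mem (D.quotVerts X) v) h′))
        edges : 2 * D.eRootedQuot Rt X ≤ suc m * suc (suc m)
        edges = ≤-trans (countPairs-bound (D.rootedQuotAdj Rt X) distinct-roots?
            (λ u v ne e → let x , y = ends u v e in x , y , λ eq → ne (sym eq))
            λ { u v (x , y , ne) → y , x , λ eq → ne (sym eq) })
          distinct-roots
        vertices : suc (suc m) ≤ D.vQuot X
        vertices = ≤-trans (≤-reflexive (sym #R)) (≤-trans
          (#-mono R (ofSubset (D.quotVerts X)) λ v r → out-quotVerts X v λ _ f → toSubset-∈ F v f r)
          (≤-reflexive (sym (∣∣-# (D.quotVerts X)))))
        #U : ∣ U ∣ ≡ 0
        #U = trans (∣∣-# U) (#-empty Us none)
        bound : 2 * D.eRootedQuot Rt X + m * m + 5 * m + 6 + 2 * ∣ U ∣ ≤ 2 * ((m + 2) * D.vQuot X)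
        bound = ≤-trans (+-mono-≤ (+-monoˡ-≤ 6 (+-monoˡ-≤ (5 * m) (+-monoˡ-≤ (m * m) edges))) (≤-reflexive (cong (2 *_) #U)))
          (≤-trans (≤-reflexive (eq m)) (*-monoʳ-≤ 2 (*-monoʳ-≤ (m + 2) vertices)))
          where
          eq : ∀ m → suc m * suc (suc m) + m * m + 5 * m + 6 + 0 ≡ 2 * ((m + 2) * suc (suc m))
          eq = solve-∀

      module _ (C : Collection E F R b₁ b₂ Us (suc (suc m))) (X : Fin n → Subset n)
               (to : ∀ i v → lookup (X i) v ≡ true → v ∈ Collection.X C i)
               (from : ∀ i v → v ∈ Collection.X C i → lookup (X i) v ≡ true) where

        private
          module C = Collection C
          Z = ⋃ C.X
          Q = quot-family E V C.X

        nbhd-C : ∀ i v → lookup (D.nbhd (D.G Rt) (X i)) v ≡ true → v ∈ N E V (C.X i)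
        nbhd-C i v e = N-cong (ofSubset (X i)) (C.X i) (to i) (from i) v (nbhd-∈ (X i) v e)

        outside-Z : ∀ v → D.mem (D.quotVerts X) v ≡ true → v ∈ V ∖ Z
        outside-Z v e = everything v , λ (i , x) → quotVerts-out X v e i (from i v x)

        bb : Fin n → Fin n → Set
        bb u v = (u ≡ b₁ × v ≡ b₂) ⊎ (v ≡ b₁ × u ≡ b₂)
        bb₁? : ∀ u v → Dec (u ≡ b₁ × v ≡ b₂)
        bb₁? u v = (u ≟ b₁) ×-dec (v ≟ b₂)
        bb₂? : ∀ u v → Dec (v ≡ b₁ × u ≡ b₂)
        bb₂? u v = (v ≟ b₁) ×-dec (u ≟ b₂)
        bb? : ∀ u v → Dec (bb u v)
        bb? u v = bb₁? u v ⊎-dec bb₂? u v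

        RR : Fin n → Fin n → Set
        RR u v = (u ∈ R × v ∈ R ∖ ｛ u ｝) × ¬ bb u v
        RR? : ∀ u v → Dec (RR u v)
        RR? u v = distinct-roots? u v ×-dec ¬? (bb? u v)

        RQ : Fin n → Fin n → Set
        RQ u v = Touch Q (V ∖ Z) (F ∖ Z) u v ⊎ RR u v
        RQ? : ∀ u v → Dec (RQ u v)
        RQ? u v = touch? Q (V ∖ Z) (F ∖ Z) u v ⊎-dec RR? u v

        RQ-sym : ∀ u v → RQ u v → RQ v u
        RQ-sym u v (inj₁ (p , q , e , t)) = inj₁ (q , p , symm Q e , [ inj₂ , inj₁ ]′ t)
        RQ-sym u v (inj₂ ((p , q , ne) , nb)) = inj₂ ((q , p , λ eq → ne (sym eq)) , λ { (inj₁ h) → nb (inj₂ h) ; (inj₂ h) → nb (inj₁ h) })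

        classify : ∀ u v → u ∈ V ∖ Z → v ∈ V ∖ Z → u ≢ v → adj Q u v → RQ u v
        classify u v (inj₁ f , z) q ne e = inj₁ ((inj₁ f , z) , q , e , inj₁ (f , z))
        classify u v (inj₂ r , z) (inj₁ f , z′) ne e = inj₁ ((inj₂ r , z) , (inj₁ f , z′) , e , inj₂ (f , z′))
        classify u v (inj₂ r , z) (inj₂ r′ , z′) ne e = inj₂ ((r , r′ , λ eq → ne (sym eq)) , λ
          { (inj₁ (refl , refl)) → C.¬adj-b e ; (inj₂ (refl , refl)) → C.¬adj-b (symm Q e) })

        edge-RQ : ∀ u v → u ≢ v → D.rootedQuotAdj Rt X u v ≡ true → RQ u v
        edge-RQ u v ne e with ∨-true (D.quotAdj (D.G Rt) X u v) e
        ... | inj₁ h with ∧-true (D.mem (D.quotVerts X) u) h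
        ...   | hu , h′ with ∧-true (D.mem (D.quotVerts X) v) h′
        ...     | hv , h″ = classify u v (outside-Z u hu) (outside-Z v hv) ne (ne , real (∨-true (D.adj (D.G Rt) u v) h″))
          where
          real : adj E u v ⊎ _ → adj E u v ⊎ ∃ λ i → u ∈ N E V (C.X i) × v ∈ N E V (C.X i)
          real (inj₁ d) = inj₁ d
          real (inj₂ g) = let i , g′ = any-true _ g ; x , y = ∧-true (D.mem (D.nbhd (D.G Rt) (X i)) u) g′ in
            inj₂ (i , nbhd-C i u x , nbhd-C i v y)
        edge-RQ u v ne e | inj₂ h with ∧-true (D.mem (D.quotVerts X) u) h
        ... | _ , h₁ with ∧-true (D.mem (D.quotVerts X) v) h₁
        ...   | _ , h₂ with ∧-true (D.isRoot Rt u) h₂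
        ...     | ru , h₃ with ∧-true (D.isRoot Rt v) h₃
        ...       | rv , h₄ = inj₂ ((ru , rv , λ eq → ne (sym eq)) , λ
          { (inj₁ (refl , refl)) → not-true h₄ (∨-trueˡ _ (true-∧ (true-⌊⌋ (u ≟ b₁) refl) (true-⌊⌋ (v ≟ b₂) refl)))
          ; (inj₂ (refl , refl)) → not-true h₄ (∨-trueʳ (⌊ u ≟ b₁ ⌋ ∧ ⌊ v ≟ b₂ ⌋)
              (true-∧ (true-⌊⌋ (u ≟ b₂) refl) (true-⌊⌋ (v ≟ b₁) refl))) })

        -- The pair `b₁`, `b₂` is missing in both orders. The resulting `2` cancels the `+ 1` of the
        -- doubled critical bound; it stands on the left here, and is added to both sides in
        -- `arith`, to avoid subtraction.
        root-pairs : ΣΣ RR? + 2 ≤ suc m * suc (suc m)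
        root-pairs = ≤-trans (+-monoʳ-≤ (ΣΣ RR?) two) (≤-trans
          (ΣΣ-disjoint distinct-roots? RR? bb? (λ _ _ → proj₁)
            (λ { u v (inj₁ (refl , refl)) → b₁∈R , b₂∈R , λ eq → D.b₁≢b₂ Rt (sym eq)
               ; u v (inj₂ (refl , refl)) → b₂∈R , b₁∈R , D.b₁≢b₂ Rt })
            λ u v (_ , nb) b → nb b)
          distinct-roots)
          where
          two : 2 ≤ ΣΣ bb?
          two = ≤-trans (≤-reflexive (sym (cong₂ _+_
                  (trans (ΣΣ-row b₁ ｛ b₂ ｝) (#-single b₂)) (trans (ΣΣ-col b₁ ｛ b₂ ｝) (#-single b₂)))))
            (ΣΣ-disjoint bb? bb₁? bb₂? (λ _ _ → inj₁) (λ _ _ → inj₂) λ { u v (refl , _) (_ , e) → D.b₁≢b₂ Rt e })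

        edges : 2 * D.eRootedQuot Rt X ≤ touching Q (V ∖ Z) (F ∖ Z) + ΣΣ RR?
        edges = ≤-trans (countPairs-bound (D.rootedQuotAdj Rt X) RQ? edge-RQ RQ-sym)
          (ΣΣ-⊎ RQ? (touch? Q (V ∖ Z) (F ∖ Z)) RR? (λ _ _ → id))

        vertices : # (F ∖ Z) + suc (suc m) ≤ D.vQuot X
        vertices = ≤-trans (≤-reflexive (cong (# (F ∖ Z) +_) (sym #R))) (≤-trans
          (#-disjoint (ofSubset (D.quotVerts X)) (F ∖ Z) R
            (λ v (_ , z) → out-quotVerts X v λ i x → z (i , to i v x))
            (λ v r → out-quotVerts X v λ i x → C.X⊆F i v (to i v x) r)
            λ v (f , _) r → f r)
          (≤-reflexive (sym (∣∣-# (D.quotVerts X)))))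

        collection-conclusion : Conclusion n X
        collection-conclusion =
          ( (λ i → avoids (X i) (λ v x → C.X⊆F i v (to i v x)) λ v x → C.X∩U i v (to i v x))
          , λ i j ne → Subset.Empty-unique λ (v , p) → apart i j ne v p)
          , (λ i → nbhd-small (X i) (≤-trans (#-mono _ _ (N-cong (ofSubset (X i)) (C.X i) (to i) (from i))) (C.small i)))
          , arith (D.eRootedQuot Rt X) (touching Q (V ∖ Z) (F ∖ Z)) (ΣΣ RR?) (# Us) ∣ U ∣ (# (F ∖ Z)) (D.vQuot X)
              edges root-pairs C.bound vertices (∣∣-# U)
          where
          apart : ∀ i j → i ≢ j → ∀ v → ¬ v Subset.∈ (D.cnbhd (D.G Rt) (X i) Subset.∩ X j)
          apart i j ne v p with Subset.x∈p∩q⁻ (D.cnbhd (D.G Rt) (X i)) (X j) p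
          ... | q , r with Subset.x∈p∪q⁻ (D.nbhd (D.G Rt) (X i)) (X i) q
          ...   | inj₁ s = proj₂ (C.apart i j ne v (to j v ([]=⇒lookup r))) (nbhd-C i v ([]=⇒lookup s))
          ...   | inj₂ s = proj₁ (C.apart i j ne v (to j v ([]=⇒lookup r))) (to i v ([]=⇒lookup s))
          arith : ∀ e t r u u′ f w → 2 * e ≤ t + r → r + 2 ≤ suc m * suc (suc m) →
            t + 2 * u ≤ 2 * suc (suc (suc m) * f) → f + suc (suc m) ≤ w → u′ ≡ u →
            2 * e + m * m + 5 * m + 6 + 2 * u′ ≤ 2 * ((m + 2) * w)
          arith e t r u _ f w h₁ h₂ h₃ h₄ refl = +-cancelʳ-≤ 2 _ _ (≤-trans
            (+-monoˡ-≤ 2 (+-monoˡ-≤ (2 * u) (+-monoˡ-≤ 6 (+-monoˡ-≤ (5 * m) (+-monoˡ-≤ (m * m) h₁)))))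
            (≤-trans (≤-reflexive (eq₁ t r u m)) (≤-trans
              (+-monoˡ-≤ (m * m + 5 * m + 6) (+-mono-≤ h₃ h₂))
              (≤-trans (≤-reflexive (eq₂ f m)) (+-monoˡ-≤ 2 (*-monoʳ-≤ 2 (*-monoʳ-≤ (m + 2) h₄)))))))
            where
            eq₁ : ∀ t r u m → t + r + m * m + 5 * m + 6 + 2 * u + 2 ≡ (t + 2 * u) + (r + 2) + (m * m + 5 * m + 6)
            eq₁ = solve-∀
            eq₂ : ∀ f m → 2 * suc (suc (suc m) * f) + suc m * suc (suc m) + (m * m + 5 * m + 6)
              ≡ 2 * ((m + 2) * (f + suc (suc m))) + 2
            eq₂ = solve-∀

      conclusion? : ∀ k X → Dec (Conclusion k X)
      conclusion? k X =
        ((all? λ i → all? λ v → (v Subset.∈? X i) →-dec ¬? (v Subset.∈? (D.rootSet Rt Subset.∪ U)))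
          ×-dec all? λ i → all? λ j → ¬? (i ≟ j) →-dec ≡-dec Bool._≟_ (D.cnbhd (D.G Rt) (X i) Subset.∩ X j) Subset.⊥)
        ×-dec (all? λ i → ∣ D.nbhd (D.G Rt) (X i) ∣ ≤? m + 2)
        ×-dec (2 * D.eRootedQuot Rt X + m * m + 5 * m + 6 + 2 * ∣ U ∣ ≤? 2 * ((m + 2) * D.vQuot X))

      critically-feasible-bound : D.CriticallyFeasible Rt U → ∃ λ k → ∃ λ X → Conclusion k X
      critically-feasible-bound ((A , B , pair) , forced) with any? (mem? Us)
      ... | no none = no-U λ v u → none (v , u)
      -- For families of `n` subsets the conclusion can be settled by finite search, so it is stable
      -- and the double negation of `collection` can be removed. `n` members suffice because
      -- collections are indexed by vertices.
      ... | yes u₀ = let ξ , c = decidable-stable (any-vec? Subset.anySubset? n λ ξ → conclusion? n (lookup ξ))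
                           λ none → collection (# F) E F R b₁ b₂ Us (suc m) ≤-refl roots #R (to-link A B pair)
                             U⊆F u₀ crit λ C → none (found C) in
                     n , lookup ξ , c
        where
        crit : (L : Link E F R b₁ b₂) → Us ⊆ Link.B L
        crit L u uU = let A′ , B′ , pair′ , inB = from-link L in inB u (forced A′ B′ pair′ u (∈ₛ uU))
        found : Collection E F R b₁ b₂ Us (suc (suc m)) → ∃ λ (ξ : Vec (Subset n) n) → Conclusion n (lookup ξ)
        found C = ξ , collection-conclusion C (lookup ξ)
            (λ i v e → toSubset-∈ (X i) v (subst (λ S → lookup S v ≡ true) (at i) e))
            (λ i v x → subst (λ S → lookup S v ≡ true) (sym (at i)) (∈-toSubset (X i) v x))
          where
          X = Collection.X C
          ξ : Vec (Subset n) n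
          ξ = tabulate λ i → toSubset (X i)
          at : ∀ i → lookup ξ i ≡ toSubset (X i)
          at = lookup∘tabulate λ i → toSubset (X i)

open import Defs
open import Data.Nat using (ℕ; _+_; _*_; _≤_)
open import Data.Fin using (Fin)
open import Data.Fin.Subset using (Subset; _∈_; _∉_; _∪_; ∣_∣)
open import Data.Product using (Σ; _×_; ∃-syntax)

theorem2p2 : (m n : ℕ) (R : Rooted m n) (U : Subset n) →
    (∀ v → v ∈ U → v ∉ rootSet R) →
    CriticallyFeasible R U →
    ∃[ k ] ∃[ X ] (IsCollection {n} {k} (G R) (rootSet R ∪ U) X ×
    (∀ i → ∣ nbhd (G R) (X i) ∣ ≤ m + 2) ×
    (2 * eRootedQuot R X + m * m + 5 * m + 6 + 2 * ∣ U ∣ ≤ 2 * ((m + 2) * vQuot X)))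
theorem2p2 m n R U U-free critical = Development.Translation.critically-feasible-bound R U U-free critical
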